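{- Let $q$ be an odd prime power and $n$ an odd prime with $(q^n-1)/2$ even, let $Q=\frac{q^n-1}{q-1}$, and let $m$ be a divisor of $Q$. Then $$\mathcal{N}_0(m)\ \ge\ \theta(m)\,q^{\frac n2-1}\left\{q^{\frac n2}-2W(m)(q-1)\right\}.$$ Consequently, if $q^{\frac n2}>2W(Q)(q-1)$, then $\mathcal{N}_0(q^n-1)>0$.
   Context: For a divisor $m$ of $q^n-1$, $\xi\in\mathbb{F}_{q^n}^*$ is $m$-free if $\xi=\zeta^d$ with $d\mid m$, $\zeta\in\mathbb{F}_{q^n}^*$ implies $d=1$. $\mathcal{N}_0(m)$ is the number of $m$-free $\xi\in\mathbb{F}_{q^n}^*$ with $\mathrm{Tr}(\xi^2)=0$, where $\mathrm{Tr}:\mathbb{F}_{q^n}\to\mathbb{F}_q$ is the trace. $\theta(m)=\phi(m)/m$, and $W(m)=2^{\nu(m)}$ with $\nu(m)$ the number of distinct prime divisors of $m$. -}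

module Defs where

open import Level using (Level; _⊔_)
open import Data.Nat using (ℕ; zero; suc; _≤_; _<_; NonZero; s≤s)
import Data.Nat as Nat
open Nat using (_∸_) renaming (_^_ to _^ℕ_)
open import Data.Nat.Properties using (anyUpTo?; ≤-<-trans; n<1+n; _≟_)
open import Data.Nat.Divisibility using (_∣_; _∣?_; ∣⇒≤)
open import Data.Nat.GCD using (gcd)
open import Data.Nat.Primality using (Prime; prime?)
open import Data.Fin using (Fin)
open import Data.Fin.Properties using (any?)
open import Data.List using (List; length; filter; upTo; map; allFin)
open import Data.Product using (Σ; ∃; _×_; _,_; proj₁; proj₂)
open import Relation.Nullary using (¬_; Dec; yes; no)
open import Relation.Nullary.Decidable using (_×-dec_; ¬?)
open import Relation.Binary using (Decidable)
open import Relation.Binary.PropositionalEquality using (_≡_; refl)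
open import Algebra.Bundles using (CommutativeRing)
import Algebra.Bundles
import Algebra.Definitions.RawSemiring as RawSemiringDefs
import Algebra.Properties.Semiring.Exp as ExpProps

count : ∀ {a p} {A : Set a} {P : A → Set p} → (∀ x → Dec (P x)) → List A → ℕ
count P? xs = length (filter P? xs)

φ : ℕ → ℕ
φ m = count (λ k → gcd k m ≟ 1) (map suc (upTo m))

-- ν(m) = number of distinct primes dividing m (for m ≥ 1 they are ≤ m)
ν : ℕ → ℕ
ν m = count (λ p → prime? p ×-dec (p ∣? m)) (upTo (suc m))

W : ℕ → ℕ
W m = 2 ^ℕ ν m

IsPrimePower : ℕ → Set
IsPrimePower q = Σ ℕ λ p → Σ ℕ λ k → Prime p × 1 ≤ k × q ≡ p ^ℕ k

-- Q = (q^n - 1)/(q - 1)  (only meaningful for q ≥ 2; value 0 otherwise)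
Q : ℕ → ℕ → ℕ
Q zero n = 0
Q (suc zero) n = 0
Q (suc (suc k)) n = (suc (suc k) ^ℕ n ∸ 1) Data.Nat./ suc k

record FiniteField (c ℓ : Level) : Set (Level.suc (c ⊔ ℓ)) where
  field
    commRing : CommutativeRing c ℓ
  open CommutativeRing commRing public
  field
    _≈?_      : Decidable _≈_
    1≉0       : ¬ (1# ≈ 0#)
    inverse   : ∀ x → ¬ (x ≈ 0#) → ∃ λ y → x * y ≈ 1#
    size      : ℕ
    enum      : Fin size → Carrier
    enum-inj  : ∀ i j → enum i ≈ enum j → i ≡ j
    enum-surj : ∀ x → ∃ λ i → enum i ≈ x

  open RawSemiringDefs (Algebra.Bundles.Semiring.rawSemiring semiring) public using () renaming (_^_ to _^ᶠ_)

module _ {c ℓ} (F : FiniteField c ℓ) where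
  open FiniteField F

  -- Trace from F_{q^n} down to F_q (the fixed field of x ↦ x^q):
  -- Tr(x) = x + x^q + ... + x^{q^{n-1}}, viewed as an element of F_{q^n}.
  Tr : (q n : ℕ) → Carrier → Carrier
  Tr q zero x = 0#
  Tr q (suc i) x = (x ^ᶠ (q ^ℕ i)) + Tr q i x

  Free : ℕ → Carrier → Set (c ⊔ ℓ)
  Free m ξ = ¬ (ξ ≈ 0#) ×
             (∀ (d : ℕ) (ζ : Carrier) → ¬ (ζ ≈ 0#) → d ∣ m → ξ ≈ ζ ^ᶠ d → d ≡ 1)

  private
    open ExpProps semiring using (^-congˡ)
    open import Relation.Binary.Reasoning.Setoid setoid

    Bad : ℕ → Carrier → ℕ → Set ℓ
    Bad m ξ d = d ∣ m × ¬ (d ≡ 1) × ∃ λ j → ¬ (enum j ≈ 0#) × ξ ≈ enum j ^ᶠ d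

    bad? : ∀ m ξ d → Dec (Bad m ξ d)
    bad? m ξ d = (d ∣? m) ×-dec (¬? (d ≟ 1)) ×-dec
                 any? (λ j → ¬? (enum j ≈? 0#) ×-dec (ξ ≈? (enum j ^ᶠ d)))

  free? : ∀ m .{{_ : NonZero m}} ξ → Dec (Free m ξ)
  free? m ξ with ξ ≈? 0# | anyUpTo? (bad? m ξ) (suc m)
  ... | yes ξ≈0 | _ = no λ f → proj₁ f ξ≈0
  ... | no ξ≉0 | yes (d , _ , d∣m , d≢1 , j , j≉0 , eq) =
        no λ f → d≢1 (proj₂ f d (enum j) j≉0 d∣m eq)
  ... | no ξ≉0 | no ¬bad = yes (ξ≉0 , g)
    where
    g : ∀ d ζ → ¬ (ζ ≈ 0#) → d ∣ m → ξ ≈ ζ ^ᶠ d → d ≡ 1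
    g d ζ ζ≉0 d∣m eq with d ≟ 1
    ... | yes d≡1 = d≡1
    ... | no d≢1 with enum-surj ζ
    ...   | j , ej≈ζ = Data.Empty.⊥-elim (¬bad (d , s≤s (∣⇒≤ d∣m) , d∣m , d≢1 , j ,
                         (λ ej≈0 → ζ≉0 (trans (sym ej≈ζ) ej≈0)) ,
                         trans eq (sym (^-congˡ d ej≈ζ))))
      where import Data.Empty

  -- 𝒩₀(m) = #{ ξ ∈ F* : ξ m-free, Tr(ξ²) = 0 }.
  -- Only defined for m ≥ 1 (every divisor of q^n - 1 is ≥ 1); value 0 at m = 0.
  N₀ : (q n m : ℕ) → ℕ
  N₀ q n zero = 0
  N₀ q n m@(suc _) =
    count (λ i → free? m (enum i) ×-dec (Tr q n (enum i ^ᶠ 2) ≈? 0#)) (allFin size)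

{-# OPTIONS --safe #-}
-- The condition Tr(ξ²) = 0 can be replaced by Tr(ξ) = 0: with m odd, ξ is m-free iff ξ² is, and a
-- nonsquare of F_q (n is odd) exchanges the squares and nonsquares among the m-free elements of trace 0.
-- Write elements as powers of a primitive root g and let κ(k) = q [Tr gᵏ = 0] - 1, the sum of ψ(s gᵏ) over
-- s ∈ F_q* for the canonical additive character ψ. Its autocorrelation is concentrated on F_q*, so for the
-- sum f of all multiplicative characters of exact order d ∣ Q (a product of Ramanujan sums, hence integer
-- valued and idempotent under convolution up to a factor) Cauchy-Schwarz gives
-- |Σ κ f| ≤ φ(d) (q - 1) q^{n/2}: this is the modulus of the Gauss sums, obtained without complex numbers.
-- The indicator of the m-free elements is, up to the factor θ(m), an alternating sum of W(m) such f/φ(d).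
-- For the last claim, a Q-free solution is made (qⁿ - 1)-free by multiplying it by an element of F_q*.
module Submission where

open import Defs
open import Level using (Level; _⊔_)
open import Data.Nat using (ℕ; zero; suc; _+_; _*_; _∸_; _^_; _≤_; _<_; _%_; _!; NonZero; z≤n; s≤s; z<s)
open import Data.Nat using (>-nonZero; >-nonZero⁻¹; ≢-nonZero; ≢-nonZero⁻¹; nonTrivial⇒n>1)
open import Data.Nat.DivMod using (_/_; m≡m%n+[m/n]*n; m%n<n; m/n*n≡m; m*n/n≡m)
open import Data.Nat.Divisibility using (_∣_; divides; _∣?_)
open import Data.Nat.Primality using (Prime; prime?; prime[2]; prime⇒irreducible; prime⇒nonTrivial; prime⇒nonZero)
open import Data.Nat.Primality using (euclidsLemma; productOfPrimes≢0)
open import Data.Nat.Primality.Factorisation using (factorise; factorisationHasAllPrimeFactors)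
open import Data.Nat.Coprimality using (Coprime; coprime-Bézout; coprime-divisor; gcd≡1⇒coprime; coprime⇒gcd≡1)
open import Data.Nat.GCD using (module Bézout; gcd; gcd[m,n]∣m; gcd[m,n]∣n; gcd-greatest)
open import Data.Nat.Combinatorics using (nCn≡1; nCk≡n!/k![n-k]!; k![n∸k]!∣n!) renaming (_C_ to _choose_)
open import Data.Nat.Properties using (_!*_!≢0)
open import Data.Nat.Induction using (<-rec)
open import Data.Nat.ListAction using (product)
open import Data.Nat.ListAction.Properties using (∈⇒∣product)
open import Data.Fin as Fin using (Fin; toℕ; fromℕ<; inject≤)
open import Data.Fin.Permutation using (Permutation; permutation)
open import Data.List using (List; []; _∷_; length; tabulate; filter; upTo; applyUpTo)
open import Data.List.Properties using (map-upTo)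
open import Data.List.Membership.Propositional using (_∈_)
open import Data.List.Membership.Propositional.Properties using (∈-filter⁺; ∈-filter⁻; ∈-upTo⁺; ∈-allFin; ∈-length)
open import Data.List.Relation.Unary.All using (All; []; _∷_)
open import Data.List.Relation.Unary.Any using (here; there)
open import Data.List.Relation.Unary.AllPairs using ([]; _∷_)
open import Data.List.Relation.Unary.Unique.Propositional using (Unique)
open import Data.Product using (_×_; _,_; ∃; proj₁; proj₂)
open import Data.Sum using (_⊎_; inj₁; inj₂)
open import Data.Empty using (⊥; ⊥-elim)
open import Data.Maybe using (nothing)
open import Relation.Nullary using (¬_; Dec; yes; no; contradiction)
open import Relation.Nullary.Decidable using (_×-dec_; ¬?; decidable-stable)
open import Relation.Binary using (tri<; tri≈; tri>)
open import Relation.Binary.PropositionalEquality using (_≡_; _≢_; refl; sym; trans; cong; cong₂; subst; subst₂; module ≡-Reasoning)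
open import Algebra.Bundles using (CommutativeMonoid)
open import Tactic.RingSolver.Core.AlmostCommutativeRing using (AlmostCommutativeRing; fromCommutativeRing)
import Data.Nat.Properties as ℕₚ
import Data.Nat.Divisibility as ∣
import Data.Nat.Coprimality as Coprimality
import Data.Integer as ℤ
import Data.Integer.Properties as ℤₚ
import Data.Fin.Properties as Finₚ
import Data.Vec.Functional as Vector
import Data.List.Relation.Unary.All as All
import Data.List.Relation.Unary.All.Properties as All
import Data.List.Relation.Unary.Unique.Propositional.Properties as Unique
import Data.Nat.Tactic.RingSolver as ℕ-Solver
import Data.Integer.Tactic.RingSolver as ℤ-Solver
import Tactic.RingSolver.NonReflective as RingSolver
import Relation.Binary.Reasoning.Setoid
import Algebra.Properties.Group
import Algebra.Properties.Ring
import Algebra.Properties.Semiring.Exp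
import Algebra.Properties.Semiring.Mult
import Algebra.Properties.CommutativeSemiring.Exp
import Algebra.Properties.CommutativeSemiring.Binomial
import Algebra.Properties.CommutativeMonoid.Sum
import Algebra.Properties.AbelianGroup ℤₚ.+-0-abelianGroup as ℤ-Group
open ℤ using (ℤ; +_; 0ℤ; 1ℤ) renaming (_+_ to _+ᶻ_; _*_ to _*ᶻ_; _-_ to _-ᶻ_; -_ to -ᶻ_; _≤_ to _≤ᶻ_; ∣_∣ to abs)

-- Sums of integer sequences

-- Everything takes place on exponents modulo N = qⁿ - 1, and the sequences that matter have period
-- Q: whether Tr gᵏ vanishes and, for m ∣ Q, whether gᵏ is m-free do not change when gᵏ is
-- multiplied by an element of F_q*, that is, by a power of g^Q. This periodicity absorbs the
-- scalars in the autocorrelation of κ and turns squaring into doubling modulo the odd number Q.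
-- Grouping the characters by their order costs nothing: with f = Σ χ and E = Σ Λ(χ) χ over the φ(d)
-- characters of order d, Cauchy-Schwarz for N Λ(f) = Σ f E gives the bound that the triangle
-- inequality would give from the modulus of each Λ(χ). To stay within the integers, the indicator
-- of the m-free elements is scaled by the radical of m, and an estimate |x| ≤ a √B is kept as x² ≤
-- a² B. The constant 2 W(m) is an upper bound for 1 + W(m): W(m) products of Ramanujan sums, and
-- one unit for the replacement of qⁿ - 1 by qⁿ in the main term.

sumTo : ℕ → (ℕ → ℤ) → ℤ
sumTo zero    f = 0ℤ
sumTo (suc n) f = f n +ᶻ sumTo n f

infix 5 sumTo
syntax sumTo n (λ i → e) = ∑[ i < n ] e

sum-cong-< : ∀ n {f g : ℕ → ℤ} → (∀ i → i < n → f i ≡ g i) → sumTo n f ≡ sumTo n g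
sum-cong-< zero    eq = refl
sum-cong-< (suc n) eq =
  cong₂ _+ᶻ_ (eq n (ℕₚ.n<1+n n)) (sum-cong-< n λ i i<n → eq i (ℕₚ.m<n⇒m<1+n i<n))

sum-cong : ∀ n {f g : ℕ → ℤ} → (∀ i → f i ≡ g i) → sumTo n f ≡ sumTo n g
sum-cong n eq = sum-cong-< n λ i _ → eq i

sum-+ : ∀ n (f g : ℕ → ℤ) → ∑[ i < n ] (f i +ᶻ g i) ≡ sumTo n f +ᶻ sumTo n g
sum-+ zero    f g = refl
sum-+ (suc n) f g =
  trans (cong (f n +ᶻ g n +ᶻ_) (sum-+ n f g)) (rearrange (f n) (g n) (sumTo n f) (sumTo n g))
  where
  rearrange : ∀ a b c d → (a +ᶻ b) +ᶻ (c +ᶻ d) ≡ (a +ᶻ c) +ᶻ (b +ᶻ d)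
  rearrange = ℤ-Solver.solve-∀

sum-*ˡ : ∀ n c (f : ℕ → ℤ) → ∑[ i < n ] (c *ᶻ f i) ≡ c *ᶻ sumTo n f
sum-*ˡ zero    c f = sym (ℤₚ.*-zeroʳ c)
sum-*ˡ (suc n) c f =
  trans (cong (c *ᶻ f n +ᶻ_) (sum-*ˡ n c f)) (sym (ℤₚ.*-distribˡ-+ c (f n) (sumTo n f)))

sum-*ʳ : ∀ n c (f : ℕ → ℤ) → ∑[ i < n ] (f i *ᶻ c) ≡ sumTo n f *ᶻ c
sum-*ʳ n c f =
  trans (sum-cong n λ i → ℤₚ.*-comm (f i) c) (trans (sum-*ˡ n c f) (ℤₚ.*-comm c (sumTo n f)))

sum-linear₂ : ∀ n a b (f g : ℕ → ℤ) →
  ∑[ i < n ] (a *ᶻ f i +ᶻ b *ᶻ g i) ≡ a *ᶻ sumTo n f +ᶻ b *ᶻ sumTo n g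
sum-linear₂ n a b f g =
  trans (sum-+ n (λ i → a *ᶻ f i) (λ i → b *ᶻ g i)) (cong₂ _+ᶻ_ (sum-*ˡ n a f) (sum-*ˡ n b g))

sum-linear₃ : ∀ n a b c (f g h : ℕ → ℤ) →
  ∑[ i < n ] (a *ᶻ f i +ᶻ b *ᶻ g i +ᶻ c *ᶻ h i) ≡ a *ᶻ sumTo n f +ᶻ b *ᶻ sumTo n g +ᶻ c *ᶻ sumTo n h
sum-linear₃ n a b c f g h =
  trans (sum-+ n (λ i → a *ᶻ f i +ᶻ b *ᶻ g i) (λ i → c *ᶻ h i))
        (cong₂ _+ᶻ_ (sum-linear₂ n a b f g) (sum-*ˡ n c h))

sum-const : ∀ n c → ∑[ i < n ] c ≡ + n *ᶻ c
sum-const zero    c = sym (ℤₚ.*-zeroˡ c)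
sum-const (suc n) c = trans (cong (c +ᶻ_) (sum-const n c)) (sym (ℤₚ.suc-* (+ n) c))

sum-0 : ∀ n {f : ℕ → ℤ} → (∀ i → i < n → f i ≡ 0ℤ) → sumTo n f ≡ 0ℤ
sum-0 n eq = trans (sum-cong-< n eq) (trans (sum-const n 0ℤ) (ℤₚ.*-zeroʳ (+ n)))

sum-swap : ∀ m n (f : ℕ → ℕ → ℤ) → ∑[ i < m ] ∑[ j < n ] f i j ≡ ∑[ j < n ] ∑[ i < m ] f i j
sum-swap zero    n f = sym (sum-0 n λ _ _ → refl)
sum-swap (suc m) n f =
  trans (cong (sumTo n (f m) +ᶻ_) (sum-swap m n f)) (sym (sum-+ n (f m) λ j → ∑[ i < m ] f i j))

sum-nonneg : ∀ n {f : ℕ → ℤ} → (∀ i → 0ℤ ≤ᶻ f i) → 0ℤ ≤ᶻ sumTo n f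
sum-nonneg zero    f≥0 = ℤₚ.≤-refl
sum-nonneg (suc n) f≥0 = ℤₚ.+-mono-≤ (f≥0 n) (sum-nonneg n f≥0)

sum-first : ∀ n (f : ℕ → ℤ) → sumTo (suc n) f ≡ f 0 +ᶻ (∑[ i < n ] f (suc i))
sum-first zero    f = refl
sum-first (suc n) f =
  trans (cong (f (suc n) +ᶻ_) (sum-first n f)) (rearrange (f (suc n)) (f 0) _)
  where
  rearrange : ∀ a b c → a +ᶻ (b +ᶻ c) ≡ b +ᶻ (a +ᶻ c)
  rearrange = ℤ-Solver.solve-∀

sum-single : ∀ n {f : ℕ → ℤ} k → k < n → (∀ i → i < n → i ≢ k → f i ≡ 0ℤ) → sumTo n f ≡ f k
sum-single (suc n) {f} k k<1+n vanish with k ℕₚ.≟ n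
... | yes refl =
  trans (cong (f n +ᶻ_) (sum-0 n λ i i<n → vanish i (ℕₚ.m<n⇒m<1+n i<n) (ℕₚ.<⇒≢ i<n)))
        (ℤₚ.+-identityʳ (f n))
... | no k≢n =
  trans (cong₂ _+ᶻ_ (vanish n (ℕₚ.n<1+n n) λ n≡k → k≢n (sym n≡k))
                    (sum-single n k (ℕₚ.≤∧≢⇒< (ℕₚ.≤-pred k<1+n) k≢n)
                       λ i i<n → vanish i (ℕₚ.m<n⇒m<1+n i<n)))
        (ℤₚ.+-identityˡ (f k))

sum-concat : ∀ m n (f : ℕ → ℤ) → sumTo (m + n) f ≡ (∑[ i < m ] f (i + n)) +ᶻ sumTo n f
sum-concat zero    n f = sym (ℤₚ.+-identityˡ (sumTo n f))
sum-concat (suc m) n f =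
  trans (cong (f (m + n) +ᶻ_) (sum-concat m n f)) (sym (ℤₚ.+-assoc (f (m + n)) _ _))

sum-double : ∀ n (f : ℕ → ℤ) → sumTo (n + n) f ≡ (∑[ i < n ] f (i + i)) +ᶻ (∑[ i < n ] f (suc (i + i)))
sum-double zero    f = refl
sum-double (suc n) f = begin
  f (n + suc n) +ᶻ sumTo (n + suc n) f
    ≡⟨ cong (λ k → f k +ᶻ sumTo k f) (ℕₚ.+-suc n n) ⟩
  f (suc (n + n)) +ᶻ (f (n + n) +ᶻ sumTo (n + n) f)
    ≡⟨ cong (λ x → f (suc (n + n)) +ᶻ (f (n + n) +ᶻ x)) (sum-double n f) ⟩
  f (suc (n + n)) +ᶻ (f (n + n) +ᶻ (sumTo n (λ i → f (i + i)) +ᶻ sumTo n (λ i → f (suc (i + i)))))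
    ≡⟨ rearrange (f (suc (n + n))) (f (n + n)) _ _ ⟩
  f (n + n) +ᶻ sumTo n (λ i → f (i + i)) +ᶻ (f (suc (n + n)) +ᶻ sumTo n (λ i → f (suc (i + i)))) ∎
  where
  open ≡-Reasoning
  rearrange : ∀ a b c d → a +ᶻ (b +ᶻ (c +ᶻ d)) ≡ (b +ᶻ c) +ᶻ (a +ᶻ d)
  rearrange = ℤ-Solver.solve-∀

i*i≡+∣i∣*∣i∣ : ∀ i → i *ᶻ i ≡ + (abs i * abs i)
i*i≡+∣i∣*∣i∣ (+ n)         = sym (ℤₚ.pos-* n n)
i*i≡+∣i∣*∣i∣ (ℤ.-[1+ n ]) = refl

0≤i*i : ∀ i → 0ℤ ≤ᶻ i *ᶻ i
0≤i*i i = subst (0ℤ ≤ᶻ_) (sym (i*i≡+∣i∣*∣i∣ i)) (ℤ.+≤+ z≤n)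

-- Lagrange's identity: Σᵢⱼ (fᵢ gⱼ - fⱼ gᵢ)² is twice the deficit.
cauchy-schwarz : ∀ n (f g : ℕ → ℤ) →
  (∑[ i < n ] f i *ᶻ g i) *ᶻ (∑[ i < n ] f i *ᶻ g i) ≤ᶻ
  (∑[ i < n ] f i *ᶻ f i) *ᶻ (∑[ i < n ] g i *ᶻ g i)
cauchy-schwarz n f g =
  ℤₚ.0≤i-j⇒j≤i (ℤₚ.*-cancelˡ-≤-pos 0ℤ (A *ᶻ B -ᶻ C *ᶻ C) (+ 2)
    (subst (0ℤ ≤ᶻ_) deficit (sum-nonneg n λ i → sum-nonneg n λ j → 0≤i*i (minor i j))))
  where
  open ≡-Reasoning
  A = ∑[ i < n ] f i *ᶻ f i
  B = ∑[ i < n ] g i *ᶻ g i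
  C = ∑[ i < n ] f i *ᶻ g i
  minor : ℕ → ℕ → ℤ
  minor i j = f i *ᶻ g j -ᶻ f j *ᶻ g i
  expand : ∀ a b x y → (a *ᶻ y -ᶻ x *ᶻ b) *ᶻ (a *ᶻ y -ᶻ x *ᶻ b) ≡
           (a *ᶻ a) *ᶻ (y *ᶻ y) +ᶻ (-ᶻ (+ 2) *ᶻ (a *ᶻ b)) *ᶻ (x *ᶻ y) +ᶻ (b *ᶻ b) *ᶻ (x *ᶻ x)
  expand = ℤ-Solver.solve-∀
  reorder : ∀ a b c u v w →
    u *ᶻ b +ᶻ (-ᶻ (+ 2) *ᶻ v) *ᶻ c +ᶻ w *ᶻ a ≡ b *ᶻ u +ᶻ (-ᶻ (+ 2) *ᶻ c) *ᶻ v +ᶻ a *ᶻ w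
  reorder = ℤ-Solver.solve-∀
  collect : ∀ a b c → b *ᶻ a +ᶻ (-ᶻ (+ 2) *ᶻ c) *ᶻ c +ᶻ a *ᶻ b ≡ + 2 *ᶻ (a *ᶻ b -ᶻ c *ᶻ c)
  collect = ℤ-Solver.solve-∀
  deficit : ∑[ i < n ] ∑[ j < n ] minor i j *ᶻ minor i j ≡ + 2 *ᶻ (A *ᶻ B -ᶻ C *ᶻ C)
  deficit = begin
    ∑[ i < n ] ∑[ j < n ] minor i j *ᶻ minor i j
      ≡⟨ sum-cong n (λ i → trans (sum-cong n λ j → expand (f i) (g i) (f j) (g j))
           (sum-linear₃ n (f i *ᶻ f i) (-ᶻ (+ 2) *ᶻ (f i *ᶻ g i)) (g i *ᶻ g i)
              (λ j → g j *ᶻ g j) (λ j → f j *ᶻ g j) (λ j → f j *ᶻ f j))) ⟩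
    ∑[ i < n ] ((f i *ᶻ f i) *ᶻ B +ᶻ (-ᶻ (+ 2) *ᶻ (f i *ᶻ g i)) *ᶻ C +ᶻ (g i *ᶻ g i) *ᶻ A)
      ≡⟨ sum-cong n (λ i → reorder A B C (f i *ᶻ f i) (f i *ᶻ g i) (g i *ᶻ g i)) ⟩
    ∑[ i < n ] (B *ᶻ (f i *ᶻ f i) +ᶻ (-ᶻ (+ 2) *ᶻ C) *ᶻ (f i *ᶻ g i) +ᶻ A *ᶻ (g i *ᶻ g i))
      ≡⟨ sum-linear₃ n B (-ᶻ (+ 2) *ᶻ C) A (λ i → f i *ᶻ f i) (λ i → f i *ᶻ g i) (λ i → g i *ᶻ g i) ⟩
    B *ᶻ A +ᶻ (-ᶻ (+ 2) *ᶻ C) *ᶻ C +ᶻ A *ᶻ B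
      ≡⟨ collect A B C ⟩
    + 2 *ᶻ (A *ᶻ B -ᶻ C *ᶻ C) ∎

-- Periodic sequences

Periodic : ℕ → (ℕ → ℤ) → Set
Periodic d f = ∀ i → f (i + d) ≡ f i

periodic-* : ∀ {d f} c → Periodic d f → Periodic (c * d) f
periodic-* {f = f} zero per i = cong f (ℕₚ.+-identityʳ i)
periodic-* {d} {f} (suc c) per i =
  trans (cong f (sym (ℕₚ.+-assoc i d (c * d)))) (trans (periodic-* c per (i + d)) (per i))

periodic-*′ : ∀ {d f} c → Periodic d f → Periodic (d * c) f
periodic-*′ {d} {f} c per = subst (λ e → Periodic e f) (ℕₚ.*-comm c d) (periodic-* c per)

periodic-∣ : ∀ {d e f} → d ∣ e → Periodic d f → Periodic e f
periodic-∣ (divides c refl) per = periodic-* c per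

periodic-shift : ∀ {d f} k → Periodic d f → Periodic d (λ i → f (i + k))
periodic-shift {d} {f} k per i = trans (cong f (swap i d k)) (per (i + k))
  where
  swap : ∀ i d k → i + d + k ≡ i + k + d
  swap = ℕ-Solver.solve-∀

periodic-· : ∀ {d f g} → Periodic d f → Periodic d g → Periodic d (λ i → f i *ᶻ g i)
periodic-· perf perg i = cong₂ _*ᶻ_ (perf i) (perg i)

sum-shift : ∀ {n f} → Periodic n f → ∀ k → ∑[ i < n ] f (i + k) ≡ sumTo n f
sum-shift {n} {f} per zero    = sum-cong n λ i → cong f (ℕₚ.+-identityʳ i)
sum-shift {n} {f} per (suc k) = begin
  ∑[ i < n ] f (i + suc k)  ≡⟨ sum-cong n (λ i → cong f (ℕₚ.+-suc i k)) ⟩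
  -- The sum of n + 1 terms is peeled at either end; the two end terms agree by periodicity and
  -- cancel.
  ∑[ i < n ] h (suc i)      ≡⟨ ℤ-Group.∙-cancelˡ (h 0) _ _ (trans (sym (sum-first n h)) (cong (_+ᶻ sumTo n h) wrap)) ⟩
  ∑[ i < n ] f (i + k)      ≡⟨ sum-shift per k ⟩
  sumTo n f                 ∎
  where
  open ≡-Reasoning
  h : ℕ → ℤ
  h i = f (i + k)
  wrap : h n ≡ h 0
  wrap = periodic-shift k per 0

sum-periods : ∀ {d f} c → Periodic d f → sumTo (c * d) f ≡ + c *ᶻ sumTo d f
sum-periods {d} {f} zero    per = sym (ℤₚ.*-zeroˡ (sumTo d f))
sum-periods {d} {f} (suc c) per = begin
  sumTo (d + c * d) f                              ≡⟨ sum-concat d (c * d) f ⟩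
  (∑[ i < d ] f (i + c * d)) +ᶻ sumTo (c * d) f   ≡⟨ cong₂ _+ᶻ_ (sum-shift per (c * d)) (sum-periods c per) ⟩
  sumTo d f +ᶻ + c *ᶻ sumTo d f                   ≡⟨ ℤₚ.suc-* (+ c) (sumTo d f) ⟨
  + suc c *ᶻ sumTo d f                             ∎
  where open ≡-Reasoning

-- Doubling permutes the residues modulo 2h + 1, with inverse multiplication by h + 1.
sum-dilate₂ : ∀ {n f} c h → n ≡ c * suc (h + h) → Periodic (suc (h + h)) f →
  ∑[ i < n ] f (i + i) ≡ sumTo n f
sum-dilate₂ {n} {f} c h refl per = ℤₚ.*-cancelˡ-≡ (+ 2) _ _ (begin
  + 2 *ᶻ evens                       ≡⟨ twice evens ⟩
  evens +ᶻ evens                     ≡⟨ cong (evens +ᶻ_) (sym odds≡evens) ⟩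
  evens +ᶻ (∑[ i < n ] f (suc (i + i)))  ≡⟨ sum-double n f ⟨
  sumTo (n + n) f                    ≡⟨ sum-concat n n f ⟩
  (∑[ i < n ] f (i + n)) +ᶻ sumTo n f  ≡⟨ cong (_+ᶻ sumTo n f) (sum-cong n pern) ⟩
  sumTo n f +ᶻ sumTo n f             ≡⟨ twice (sumTo n f) ⟨
  + 2 *ᶻ sumTo n f                   ∎)
  where
  open ≡-Reasoning
  evens = ∑[ i < n ] f (i + i)
  pern : Periodic n f
  pern = periodic-* c per
  twice : ∀ x → + 2 *ᶻ x ≡ x +ᶻ x
  twice = ℤ-Solver.solve-∀
  shifted : ∀ i h → suc (i + i) + suc (h + h) ≡ (i + suc h) + (i + suc h)
  shifted = ℕ-Solver.solve-∀
  assoc₂ : ∀ i n → (i + n) + (i + n) ≡ (i + i) + n + n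
  assoc₂ = ℕ-Solver.solve-∀
  -- Adding the odd period to 2i + 1 gives the even index 2(i + h + 1), so the odd indices
  -- contribute a shift of what the even ones contribute. Together they make up 2n consecutive
  -- terms, which is twice the full sum.
  odds≡evens : ∑[ i < n ] f (suc (i + i)) ≡ evens
  odds≡evens =
    trans (sum-cong n λ i → trans (sym (per (suc (i + i)))) (cong f (shifted i h)))
          (sum-shift {f = λ i → f (i + i)}
             (λ i → trans (cong f (assoc₂ i n)) (trans (pern _) (pern _))) (suc h))

-- Indicators of decidable propositions

ι : ∀ {p} {P : Set p} → Dec P → ℤ
ι (yes _) = 1ℤ
ι (no  _) = 0ℤ

ι-cong : ∀ {p q} {P : Set p} {Q : Set q} → (P → Q) → (Q → P) → (d : Dec P) (e : Dec Q) → ι d ≡ ι e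
ι-cong to from (yes p) (yes q) = refl
ι-cong to from (yes p) (no ¬q) = ⊥-elim (¬q (to p))
ι-cong to from (no ¬p) (yes q) = ⊥-elim (¬p (from q))
ι-cong to from (no ¬p) (no ¬q) = refl

ι-yes : ∀ {p} {P : Set p} (d : Dec P) → P → ι d ≡ 1ℤ
ι-yes d p = ι-cong (λ _ → p) (λ x → x) d (yes p)

ι-no : ∀ {p} {P : Set p} (d : Dec P) → ¬ P → ι d ≡ 0ℤ
ι-no d ¬p = ι-cong (λ x → x) (λ x → x) d (no ¬p)

-- Independence of coprime periods

∣+*-cancel : ∀ {p} i k → p ∣ i + p * k → p ∣ i
∣+*-cancel {p} i k p∣ = ∣.∣m+n∣m⇒∣n (subst (p ∣_) (ℕₚ.+-comm i (p * k)) p∣) (∣.m∣m*n k)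

∣+*-weaken : ∀ {p} i k → p ∣ i → p ∣ i + p * k
∣+*-weaken i k p∣ = ∣.∣m∣n⇒∣m+n p∣ (∣.m∣m*n k)

periodic-ι∣ : ∀ p → Periodic p (λ i → ι (p ∣? i))
periodic-ι∣ p i = ι-cong
  (λ p∣ → ∣.∣m+n∣m⇒∣n (subst (p ∣_) (ℕₚ.+-comm i p) p∣) ∣.∣-refl)
  (λ p∣ → ∣.∣m∣n⇒∣m+n p∣ ∣.∣-refl) (p ∣? (i + p)) (p ∣? i)

∑ι∣≡1 : ∀ p → .{{NonZero p}} → ∑[ i < p ] ι (p ∣? i) ≡ 1ℤ
∑ι∣≡1 (suc p) = trans
  (sum-single (suc p) {λ i → ι (suc p ∣? i)} 0 z<s λ
    { zero    _   0≢0 → ⊥-elim (0≢0 refl)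
    ; (suc i) i<p _   → ι-no (suc p ∣? suc i) (∣.>⇒∤ i<p) })
  (ι-yes (suc p ∣? 0) (suc p ∣.∣0))

-- The multiples of p on both sides express a congruence modulo p without subtraction.
multiple≡1-mod : ∀ {d} p → .{{NonZero p}} → Coprime d p →
  ∃ λ x → ∃ λ a → ∃ λ b → x * d + p * a ≡ 1 + p * b
multiple≡1-mod {d} (suc p) coprime with coprime-Bézout coprime
... | Bézout.+- x y eq = x , 0 , y , (begin
  x * d + suc p * 0  ≡⟨ cong (_+ suc p * 0) (sym eq) ⟩
  1 + y * suc p + suc p * 0 ≡⟨ rearrange y p ⟩
  1 + suc p * y      ∎)
  where
  open ≡-Reasoning
  rearrange : ∀ y p → 1 + y * (1 + p) + (1 + p) * 0 ≡ 1 + (1 + p) * y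
  rearrange = ℕ-Solver.solve-∀
-- Here x inverts d only up to sign. The modulus is `suc p`, so `p` stands for -1 and `p * x`
-- corrects the sign.
... | Bézout.-+ x y eq = p * x , 1 , p * y , (begin
  p * x * d + suc p * 1   ≡⟨ expand p x d ⟩
  1 + p * (1 + x * d)     ≡⟨ cong (λ z → 1 + p * z) eq ⟩
  1 + p * (y * suc p)     ≡⟨ collect p y ⟩
  1 + suc p * (p * y)     ∎)
  where
  open ≡-Reasoning
  expand : ∀ p x d → p * x * d + (1 + p) * 1 ≡ 1 + p * (1 + x * d)
  expand = ℕ-Solver.solve-∀
  collect : ∀ p y → 1 + p * (y * (1 + p)) ≡ 1 + (1 + p) * (p * y)
  collect = ℕ-Solver.solve-∀

-- Shifting by a multiple of d that is 1 modulo p moves k through all residues modulo p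
-- without changing u.
equidistribution : ∀ {N d u} p → .{{NonZero p}} → Coprime d p → p ∣ N →
  Periodic N u → Periodic d u → ∀ k →
  + p *ᶻ (∑[ i < N ] u i *ᶻ ι (p ∣? (i + k))) ≡ sumTo N u
equidistribution {N} {d} {u} p coprime p∣N perN perd k with multiple≡1-mod p coprime
... | x , a , b , x*d≡1 = begin
  + p *ᶻ (∑[ i < N ] u i *ᶻ ι (p ∣? (i + k)))
    ≡⟨ sum-const p _ ⟨
  ∑[ s < p ] ∑[ i < N ] u i *ᶻ ι (p ∣? (i + k))
    ≡⟨ sum-cong p shift ⟩
  ∑[ s < p ] ∑[ i < N ] u i *ᶻ ι (p ∣? (s + (i + k)))
    ≡⟨ sum-swap p N (λ s i → u i *ᶻ ι (p ∣? (s + (i + k)))) ⟩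
  ∑[ i < N ] ∑[ s < p ] u i *ᶻ ι (p ∣? (s + (i + k)))
    ≡⟨ sum-cong N (λ i → trans (sum-*ˡ p (u i) (λ s → ι (p ∣? (s + (i + k))))) (trans
         (cong (u i *ᶻ_) (trans (sum-shift (periodic-ι∣ p) (i + k)) (∑ι∣≡1 p)))
         (ℤₚ.*-identityʳ (u i)))) ⟩
  sumTo N u ∎
  where
  open ≡-Reasoning
  congruent : ∀ i k s → i + x * d * s + k + p * (a * s) ≡ s + (i + k) + p * (b * s)
  congruent i k s = trans (left i k s (x * d) p a) (trans (cong (λ z → i + k + z * s) x*d≡1) (right i k s p b))
    where
    left : ∀ i k s y p a → i + y * s + k + p * (a * s) ≡ i + k + (y + p * a) * s
    left = ℕ-Solver.solve-∀
    right : ∀ i k s p b → i + k + (1 + p * b) * s ≡ s + (i + k) + p * (b * s)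
    right = ℕ-Solver.solve-∀
  summand : ℕ → ℤ
  summand i = u i *ᶻ ι (p ∣? (i + k))
  shift : ∀ s → sumTo N summand ≡ ∑[ i < N ] u i *ᶻ ι (p ∣? (s + (i + k)))
  shift s = begin
    sumTo N summand
      ≡⟨ sum-shift {f = summand} (periodic-· perN
           (periodic-∣ p∣N (periodic-shift {f = λ i → ι (p ∣? i)} k (periodic-ι∣ p)))) (x * d * s) ⟨
    ∑[ i < N ] summand (i + x * d * s)
      ≡⟨ sum-cong N (λ i → cong₂ _*ᶻ_
           (periodic-∣ (∣.∣-trans (∣.n∣m*n x) (∣.m∣m*n s)) perd i)
           (ι-cong
              (λ p∣ → ∣+*-cancel (s + (i + k)) (b * s)
                 (subst (p ∣_) (congruent i k s) (∣+*-weaken (i + x * d * s + k) (a * s) p∣)))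
              (λ p∣ → ∣+*-cancel (i + x * d * s + k) (a * s)
                 (subst (p ∣_) (sym (congruent i k s)) (∣+*-weaken (s + (i + k)) (b * s) p∣)))
              (p ∣? (i + x * d * s + k)) (p ∣? (s + (i + k))))) ⟩
    ∑[ i < N ] u i *ᶻ ι (p ∣? (s + (i + k))) ∎

-- Ramanujan sums and the sieve

-- Ramanujan sum c_p(i): the sum of the characters of exact order p.
ramanujan : ℕ → ℕ → ℤ
ramanujan p i = + p *ᶻ ι (p ∣? i) -ᶻ 1ℤ

periodic-ramanujan : ∀ p → Periodic p (ramanujan p)
periodic-ramanujan p i = cong (λ x → + p *ᶻ x -ᶻ 1ℤ) (periodic-ι∣ p i)

-- As a sum of characters, f is idempotent for convolution up to the factor N.
SelfCorrelated : ℕ → (ℕ → ℤ) → Set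
SelfCorrelated N f = ∀ k → ∑[ i < N ] f i *ᶻ f (i + k) ≡ + N *ᶻ f k

ι∣-* : ∀ p i k → ι (p ∣? i) *ᶻ ι (p ∣? (i + k)) ≡ ι (p ∣? i) *ᶻ ι (p ∣? k)
ι∣-* p i k with p ∣? i
... | no  _   = refl
... | yes p∣i = cong (1ℤ *ᶻ_) (ι-cong (λ p∣ → ∣.∣m+n∣m⇒∣n p∣ p∣i) (∣.∣m∣n⇒∣m+n p∣i) (p ∣? (i + k)) (p ∣? k))

-- Write δ for the indicator of p ∣ i. In the expanded product of the two Ramanujan sums δ(i) δ(i +
-- k) collapses to δ(i) δ(k), and the remaining sums weighted by δ are 1/p of the unweighted one,
-- because f(i) f(i + k) has a period prime to p. What is left is c_p(k) times the correlation of f.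
selfCorrelated-ramanujan : ∀ {N d f} p → .{{NonZero p}} → Coprime d p → p ∣ N →
  Periodic N f → Periodic d f → SelfCorrelated N f → SelfCorrelated N (λ i → f i *ᶻ ramanujan p i)
selfCorrelated-ramanujan {N} {d} {f} p coprime p∣N perN perd self k = begin
  ∑[ i < N ] f i *ᶻ ramanujan p i *ᶻ (f (i + k) *ᶻ ramanujan p (i + k))
    ≡⟨ sum-cong N (λ i → trans (expand (f i) (f (i + k)) (+ p) (ι (p ∣? i)) (ι (p ∣? (i + k))))
         (trans (cong (λ x → + p *ᶻ + p *ᶻ (u i *ᶻ x) +ᶻ (-ᶻ (+ p) *ᶻ (u i *ᶻ ι (p ∣? i)) +ᶻ
            (-ᶻ (+ p) *ᶻ (u i *ᶻ ι (p ∣? (i + k))) +ᶻ u i))) (ι∣-* p i k))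
          (regroup (u i) (+ p) (ι (p ∣? i)) (ι (p ∣? k)) (ι (p ∣? (i + k)))))) ⟩
  ∑[ i < N ] (c *ᶻ (u i *ᶻ ι (p ∣? i)) +ᶻ -ᶻ (+ p) *ᶻ (u i *ᶻ ι (p ∣? (i + k))) +ᶻ 1ℤ *ᶻ u i)
    ≡⟨ sum-linear₃ N c (-ᶻ (+ p)) 1ℤ (λ i → u i *ᶻ ι (p ∣? i)) (λ i → u i *ᶻ ι (p ∣? (i + k))) u ⟩
  c *ᶻ U₀ +ᶻ -ᶻ (+ p) *ᶻ U₁ +ᶻ 1ℤ *ᶻ U
    ≡⟨ factor (+ p) (ι (p ∣? k)) U₀ U₁ U ⟩
  (+ p *ᶻ ι (p ∣? k) -ᶻ 1ℤ) *ᶻ (+ p *ᶻ U₀) -ᶻ (+ p *ᶻ U₁) +ᶻ U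
    ≡⟨ cong₂ (λ x y → ramanujan p k *ᶻ x -ᶻ y +ᶻ U) U₀-eq (equidistribution p coprime p∣N peruN perud k) ⟩
  ramanujan p k *ᶻ U -ᶻ U +ᶻ U
    ≡⟨ cancel (ramanujan p k *ᶻ U) U ⟩
  ramanujan p k *ᶻ U
    ≡⟨ cong (ramanujan p k *ᶻ_) (self k) ⟩
  ramanujan p k *ᶻ (+ N *ᶻ f k)
    ≡⟨ final (ramanujan p k) (+ N) (f k) ⟩
  + N *ᶻ (f k *ᶻ ramanujan p k) ∎
  where
  open ≡-Reasoning
  u : ℕ → ℤ
  u i = f i *ᶻ f (i + k)
  c = + p *ᶻ + p *ᶻ ι (p ∣? k) -ᶻ + p
  U = sumTo N u
  U₀ = ∑[ i < N ] u i *ᶻ ι (p ∣? i)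
  U₁ = ∑[ i < N ] u i *ᶻ ι (p ∣? (i + k))
  peruN : Periodic N u
  peruN = periodic-· perN (periodic-shift {f = f} k perN)
  perud : Periodic d u
  perud = periodic-· perd (periodic-shift {f = f} k perd)
  U₀-eq : + p *ᶻ U₀ ≡ U
  U₀-eq = trans
    (cong (+ p *ᶻ_) (sum-cong N λ i → cong (λ j → u i *ᶻ ι (p ∣? j)) (sym (ℕₚ.+-identityʳ i))))
    (equidistribution p coprime p∣N peruN perud 0)
  expand : ∀ x y p s t → x *ᶻ (p *ᶻ s -ᶻ 1ℤ) *ᶻ (y *ᶻ (p *ᶻ t -ᶻ 1ℤ)) ≡
    p *ᶻ p *ᶻ (x *ᶻ y *ᶻ (s *ᶻ t)) +ᶻ (-ᶻ p *ᶻ (x *ᶻ y *ᶻ s) +ᶻ (-ᶻ p *ᶻ (x *ᶻ y *ᶻ t) +ᶻ x *ᶻ y))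
  expand = ℤ-Solver.solve-∀
  regroup : ∀ u p s e t →
    p *ᶻ p *ᶻ (u *ᶻ (s *ᶻ e)) +ᶻ (-ᶻ p *ᶻ (u *ᶻ s) +ᶻ (-ᶻ p *ᶻ (u *ᶻ t) +ᶻ u)) ≡
    (p *ᶻ p *ᶻ e -ᶻ p) *ᶻ (u *ᶻ s) +ᶻ -ᶻ p *ᶻ (u *ᶻ t) +ᶻ 1ℤ *ᶻ u
  regroup = ℤ-Solver.solve-∀
  factor : ∀ p e u₀ u₁ u → (p *ᶻ p *ᶻ e -ᶻ p) *ᶻ u₀ +ᶻ -ᶻ p *ᶻ u₁ +ᶻ 1ℤ *ᶻ u ≡
    (p *ᶻ e -ᶻ 1ℤ) *ᶻ (p *ᶻ u₀) -ᶻ (p *ᶻ u₁) +ᶻ u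
  factor = ℤ-Solver.solve-∀
  cancel : ∀ a b → a -ᶻ b +ᶻ b ≡ a
  cancel = ℤ-Solver.solve-∀
  final : ∀ r n x → r *ᶻ (n *ᶻ x) ≡ n *ᶻ (x *ᶻ r)
  final = ℤ-Solver.solve-∀

-- Each factor is p times the indicator of p ∤ i, and equally (p - 1) - c_p(i). The first form
-- detects coprimality, the second expands into characters.
sieve : List ℕ → ℕ → ℤ
sieve []       i = 1ℤ
sieve (p ∷ ps) i = (+ p -ᶻ + p *ᶻ ι (p ∣? i)) *ᶻ sieve ps i

-- For distinct primes this is φ of their product.
totient : List ℕ → ℕ
totient []       = 1
totient (p ∷ ps) = (p ∸ 1) * totient ps

-- Passing from d to d * p makes the primes of the list distinct.
data Independent (Q : ℕ) : ℕ → List ℕ → Set where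
  []  : ∀ {d} → Independent Q d []
  ind : ∀ {d p ps} → Prime p → p ∣ Q → ¬ p ∣ d → Independent Q (d * p) ps → Independent Q d (p ∷ ps)

prime∤⇒coprime : ∀ {p d} → Prime p → ¬ p ∣ d → Coprime d p
prime∤⇒coprime pr p∤d (i∣d , i∣p) with prime⇒irreducible pr i∣p
... | inj₁ i≡1  = i≡1
... | inj₂ refl = ⊥-elim (p∤d i∣d)

+[p∸1] : ∀ p → .{{NonZero p}} → + (p ∸ 1) ≡ + p -ᶻ 1ℤ
+[p∸1] (suc p) = refl

-- Since p is prime to the period d of the weight u, the factor p - p ι(p ∣ i) multiplies the sum of
-- u by its own mean p - 1. It then joins the weight, whose period becomes `d * p`.
sum-sieve : ∀ {N d ps} u → Independent N d ps → Periodic N u → Periodic d u →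
  ∑[ i < N ] u i *ᶻ sieve ps i ≡ + totient ps *ᶻ sumTo N u
sum-sieve {N} u [] perN perd =
  trans (sum-cong N λ i → ℤₚ.*-identityʳ (u i)) (sym (ℤₚ.*-identityˡ (sumTo N u)))
sum-sieve {N} {d} {p ∷ ps} u (ind pr p∣N p∤d rest) perN perd = begin
  ∑[ i < N ] u i *ᶻ ((+ p -ᶻ + p *ᶻ ι (p ∣? i)) *ᶻ sieve ps i)
    ≡⟨ sum-cong N (λ i → ℤₚ.*-assoc (u i) (+ p -ᶻ + p *ᶻ ι (p ∣? i)) (sieve ps i)) ⟨
  ∑[ i < N ] v i *ᶻ sieve ps i
    ≡⟨ sum-sieve v rest perNv perdv ⟩
  + totient ps *ᶻ sumTo N v
    ≡⟨ cong (+ totient ps *ᶻ_) sum-v ⟩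
  + totient ps *ᶻ (+ (p ∸ 1) *ᶻ sumTo N u)
    ≡⟨ reorder (+ totient ps) (+ (p ∸ 1)) (sumTo N u) ⟩
  + (p ∸ 1) *ᶻ + totient ps *ᶻ sumTo N u
    ≡⟨ cong (_*ᶻ sumTo N u) (ℤₚ.pos-* (p ∸ 1) (totient ps)) ⟨
  + totient (p ∷ ps) *ᶻ sumTo N u ∎
  where
  open ≡-Reasoning
  instance _ = prime⇒nonZero pr
  v : ℕ → ℤ
  v i = u i *ᶻ (+ p -ᶻ + p *ᶻ ι (p ∣? i))
  reorder : ∀ a b c → a *ᶻ (b *ᶻ c) ≡ b *ᶻ a *ᶻ c
  reorder = ℤ-Solver.solve-∀
  perp : Periodic p (λ i → + p -ᶻ + p *ᶻ ι (p ∣? i))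
  perp i = cong (λ x → + p -ᶻ + p *ᶻ x) (periodic-ι∣ p i)
  perNv : Periodic N v
  perNv = periodic-· perN (periodic-∣ p∣N perp)
  perdv : Periodic (d * p) v
  perdv = periodic-· (periodic-*′ p perd) (periodic-* d perp)
  distribute : ∀ u p e → u *ᶻ (p -ᶻ p *ᶻ e) ≡ p *ᶻ u +ᶻ -ᶻ p *ᶻ (u *ᶻ e)
  distribute = ℤ-Solver.solve-∀
  factor : ∀ p x y → p *ᶻ x +ᶻ -ᶻ p *ᶻ y ≡ p *ᶻ x -ᶻ p *ᶻ y
  factor = ℤ-Solver.solve-∀
  factor′ : ∀ p x → p *ᶻ x -ᶻ x ≡ (p -ᶻ 1ℤ) *ᶻ x
  factor′ = ℤ-Solver.solve-∀
  sum-v : sumTo N v ≡ + (p ∸ 1) *ᶻ sumTo N u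
  sum-v = begin
    sumTo N v
      ≡⟨ sum-cong N (λ i → distribute (u i) (+ p) (ι (p ∣? i))) ⟩
    ∑[ i < N ] (+ p *ᶻ u i +ᶻ -ᶻ (+ p) *ᶻ (u i *ᶻ ι (p ∣? i)))
      ≡⟨ sum-linear₂ N (+ p) (-ᶻ (+ p)) u (λ i → u i *ᶻ ι (p ∣? i)) ⟩
    + p *ᶻ sumTo N u +ᶻ -ᶻ (+ p) *ᶻ (∑[ i < N ] u i *ᶻ ι (p ∣? i))
      ≡⟨ factor (+ p) (sumTo N u) (∑[ i < N ] u i *ᶻ ι (p ∣? i)) ⟩
    + p *ᶻ sumTo N u -ᶻ + p *ᶻ (∑[ i < N ] u i *ᶻ ι (p ∣? i))
      ≡⟨ cong (λ x → + p *ᶻ sumTo N u -ᶻ + p *ᶻ x)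
           (sum-cong N λ i → cong (λ j → u i *ᶻ ι (p ∣? j)) (sym (ℕₚ.+-identityʳ i))) ⟩
    + p *ᶻ sumTo N u -ᶻ + p *ᶻ (∑[ i < N ] u i *ᶻ ι (p ∣? (i + 0)))
      ≡⟨ cong (λ x → + p *ᶻ sumTo N u -ᶻ x) (equidistribution p (prime∤⇒coprime pr p∤d) p∣N perN perd 0) ⟩
    + p *ᶻ sumTo N u -ᶻ sumTo N u
      ≡⟨ factor′ (+ p) (sumTo N u) ⟩
    (+ p -ᶻ 1ℤ) *ᶻ sumTo N u
      ≡⟨ cong (_*ᶻ sumTo N u) (+[p∸1] p) ⟨
    + (p ∸ 1) *ᶻ sumTo N u ∎

-- Quadratic bounds

square-cancel-≤ : ∀ {m n} → m * m ≤ n * n → m ≤ n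
square-cancel-≤ {m} {n} m²≤n² with ℕₚ.≤-<-connex m n
... | inj₁ m≤n = m≤n
... | inj₂ n<m = ⊥-elim (ℕₚ.<⇒≱ (ℕₚ.*-mono-< n<m n<m) m²≤n²)

-- x is at most a √B in absolute value.
record Bounded (B : ℕ) (x : ℤ) (a : ℕ) : Set where
  constructor bounded
  field square≤ : abs x * abs x ≤ a * a * B

bounded-+ : ∀ {B x y a b} → Bounded B x a → Bounded B y b → Bounded B (x +ᶻ y) (a + b)
bounded-+ {B} {x} {y} {a} {b} (bounded bx) (bounded by) = bounded (begin
  abs (x +ᶻ y) * abs (x +ᶻ y)                     ≤⟨ ℕₚ.*-mono-≤ (ℤₚ.∣i+j∣≤∣i∣+∣j∣ x y) (ℤₚ.∣i+j∣≤∣i∣+∣j∣ x y) ⟩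
  (abs x + abs y) * (abs x + abs y)           ≡⟨ expand (abs x) (abs y) ⟩
  abs x * abs x + abs y * abs y + 2 * (abs x * abs y)
    ≤⟨ ℕₚ.+-mono-≤ (ℕₚ.+-mono-≤ bx by) (ℕₚ.*-monoʳ-≤ 2 cross) ⟩
  a * a * B + b * b * B + 2 * (a * b * B)      ≡⟨ collect a b B ⟩
  (a + b) * (a + b) * B                        ∎)
  where
  open ℕₚ.≤-Reasoning
  expand : ∀ u v → (u + v) * (u + v) ≡ u * u + v * v + 2 * (u * v)
  expand = ℕ-Solver.solve-∀
  collect : ∀ a b B → a * a * B + b * b * B + 2 * (a * b * B) ≡ (a + b) * (a + b) * B
  collect = ℕ-Solver.solve-∀
  mix : ∀ u v → u * v * (u * v) ≡ u * u * (v * v)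
  mix = ℕ-Solver.solve-∀
  mixB : ∀ a b B → a * a * B * (b * b * B) ≡ a * b * B * (a * b * B)
  mixB = ℕ-Solver.solve-∀
  -- The square of the cross term is bounded by the product of the two hypotheses, which is a
  -- perfect square.
  cross : abs x * abs y ≤ a * b * B
  cross = square-cancel-≤ (begin
    abs x * abs y * (abs x * abs y)  ≡⟨ mix (abs x) (abs y) ⟩
    abs x * abs x * (abs y * abs y)  ≤⟨ ℕₚ.*-mono-≤ bx by ⟩
    a * a * B * (b * b * B)          ≡⟨ mixB a b B ⟩
    a * b * B * (a * b * B)          ∎)

bounded-neg : ∀ {B x a} → Bounded B x a → Bounded B (-ᶻ x) a
bounded-neg {B} {x} {a} (bounded bx) = bounded (subst (λ z → z * z ≤ a * a * B) (sym (ℤₚ.∣-i∣≡∣i∣ x)) bx)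

bounded-scale : ∀ {B x a} c → Bounded B x a → Bounded B (+ c *ᶻ x) (c * a)
bounded-scale {B} {x} {a} c (bounded bx) = bounded (begin
  abs (+ c *ᶻ x) * abs (+ c *ᶻ x)  ≡⟨ cong (λ z → z * z) (ℤₚ.abs-* (+ c) x) ⟩
  c * abs x * (c * abs x)      ≡⟨ left c (abs x) ⟩
  c * c * (abs x * abs x)      ≤⟨ ℕₚ.*-monoʳ-≤ (c * c) bx ⟩
  c * c * (a * a * B)          ≡⟨ right c a B ⟩
  c * a * (c * a) * B          ∎)
  where
  open ℕₚ.≤-Reasoning
  left : ∀ c x → c * x * (c * x) ≡ c * c * (x * x)
  left = ℕ-Solver.solve-∀
  right : ∀ c a B → c * c * (a * a * B) ≡ c * a * (c * a) * B
  right = ℕ-Solver.solve-∀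

-- The hypothesis on κ says that its Fourier coefficients at the nontrivial characters trivial on Q
-- all have the same modulus, as Gauss sums do.
module Spectral (N Q : ℕ) .{{_ : NonZero N}} (Q∣N : Q ∣ N) (κ : ℕ → ℤ) (perκ : Periodic N κ) (B C : ℕ)
  (correlation : ∀ f → Periodic Q f →
    ∑[ t < N ] f t *ᶻ (∑[ z < N ] κ z *ᶻ κ (z + t)) ≡ + B *ᶻ f 0 -ᶻ + C *ᶻ sumTo N f) where

  open ≡-Reasoning

  Λ : (ℕ → ℤ) → ℤ
  Λ f = ∑[ i < N ] κ i *ᶻ f i

  instance
    +N-positive : ℤ.Positive (+ N)
    +N-positive = ℤ.positive (ℤ.+<+ (>-nonZero⁻¹ N))

  module _ {f : ℕ → ℤ} (perQ : Periodic Q f) (self : SelfCorrelated N f) where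

    private
      perN : Periodic N f
      perN = periodic-∣ Q∣N perQ

      -- If f is a sum of characters χ, this is Σ Λ(χ) χ: the part of κ carried by those characters,
      -- up to conjugation and the factor N.
      E : ℕ → ℤ
      E i = ∑[ z < N ] κ z *ᶻ f (z + i)

      pull : ∀ a b c → a *ᶻ (b *ᶻ c) ≡ b *ᶻ (a *ᶻ c)
      pull = ℤ-Solver.solve-∀

    sum-f*E : ∑[ i < N ] f i *ᶻ E i ≡ + N *ᶻ Λ f
    sum-f*E = begin
      ∑[ i < N ] f i *ᶻ E i
        ≡⟨ sum-cong N (λ i → trans (sym (sum-*ˡ N (f i) λ z → κ z *ᶻ f (z + i)))
             (sum-cong N λ z → trans (pull (f i) (κ z) (f (z + i)))
               (cong (λ j → κ z *ᶻ (f i *ᶻ f j)) (ℕₚ.+-comm z i)))) ⟩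
      ∑[ i < N ] ∑[ z < N ] κ z *ᶻ (f i *ᶻ f (i + z))
        ≡⟨ sum-swap N N (λ i z → κ z *ᶻ (f i *ᶻ f (i + z))) ⟩
      ∑[ z < N ] ∑[ i < N ] κ z *ᶻ (f i *ᶻ f (i + z))
        ≡⟨ sum-cong N (λ z → trans (sum-*ˡ N (κ z) λ i → f i *ᶻ f (i + z))
             (trans (cong (κ z *ᶻ_) (self z)) (pull (κ z) (+ N) (f z)))) ⟩
      ∑[ z < N ] + N *ᶻ (κ z *ᶻ f z)
        ≡⟨ sum-*ˡ N (+ N) (λ z → κ z *ᶻ f z) ⟩
      + N *ᶻ Λ f ∎

    sum-f*f : ∑[ i < N ] f i *ᶻ f i ≡ + N *ᶻ f 0
    sum-f*f = trans (sum-cong N λ i → cong (λ j → f i *ᶻ f j) (sym (ℕₚ.+-identityʳ i))) (self 0)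

    -- Once the second copy of κ is indexed relative to the first, by z + t, the sum over i only
    -- meets the self-correlation of f, and the sum over z only the autocorrelation of κ, to which
    -- the hypothesis of the module applies.
    sum-E*E : ∑[ i < N ] E i *ᶻ E i ≡ + N *ᶻ (+ B *ᶻ f 0 -ᶻ + C *ᶻ sumTo N f)
    sum-E*E = begin
      ∑[ i < N ] E i *ᶻ E i
        ≡⟨ sum-cong N square ⟩
      ∑[ i < N ] ∑[ z < N ] ∑[ t < N ] (κ z *ᶻ κ (z + t)) *ᶻ h t (i + z)
        ≡⟨ sum-swap N N (λ i z → ∑[ t < N ] (κ z *ᶻ κ (z + t)) *ᶻ h t (i + z)) ⟩
      ∑[ z < N ] ∑[ i < N ] ∑[ t < N ] (κ z *ᶻ κ (z + t)) *ᶻ h t (i + z)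
        ≡⟨ sum-cong N (λ z → trans (sum-swap N N λ i t → (κ z *ᶻ κ (z + t)) *ᶻ h t (i + z))
             (sum-cong N λ t → trans (sum-*ˡ N (κ z *ᶻ κ (z + t)) λ i → h t (i + z))
               (cong (κ z *ᶻ κ (z + t) *ᶻ_) (trans (sum-shift (perh t) z) (self t))))) ⟩
      ∑[ z < N ] ∑[ t < N ] (κ z *ᶻ κ (z + t)) *ᶻ (+ N *ᶻ f t)
        ≡⟨ sum-swap N N (λ z t → (κ z *ᶻ κ (z + t)) *ᶻ (+ N *ᶻ f t)) ⟩
      ∑[ t < N ] ∑[ z < N ] (κ z *ᶻ κ (z + t)) *ᶻ (+ N *ᶻ f t)
        ≡⟨ sum-cong N (λ t → trans (sum-*ʳ N (+ N *ᶻ f t) λ z → κ z *ᶻ κ (z + t))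
             (out (∑[ z < N ] κ z *ᶻ κ (z + t)) (+ N) (f t))) ⟩
      ∑[ t < N ] + N *ᶻ (f t *ᶻ (∑[ z < N ] κ z *ᶻ κ (z + t)))
        ≡⟨ sum-*ˡ N (+ N) (λ t → f t *ᶻ (∑[ z < N ] κ z *ᶻ κ (z + t))) ⟩
      + N *ᶻ (∑[ t < N ] f t *ᶻ (∑[ z < N ] κ z *ᶻ κ (z + t)))
        ≡⟨ cong (+ N *ᶻ_) (correlation f perQ) ⟩
      + N *ᶻ (+ B *ᶻ f 0 -ᶻ + C *ᶻ sumTo N f) ∎
      where
      h : ℕ → ℕ → ℤ
      h t i = f i *ᶻ f (i + t)
      perh : ∀ t → Periodic N (h t)
      perh t = periodic-· perN (periodic-shift {f = f} t perN)
      out : ∀ a b c → a *ᶻ (b *ᶻ c) ≡ b *ᶻ (c *ᶻ a)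
      out = ℤ-Solver.solve-∀
      arrange : ∀ a b c d → a *ᶻ b *ᶻ (c *ᶻ d) ≡ a *ᶻ c *ᶻ (b *ᶻ d)
      arrange = ℤ-Solver.solve-∀
      index : ∀ t z i → t + z + i ≡ i + z + t
      index = ℕ-Solver.solve-∀
      square : ∀ i → E i *ᶻ E i ≡ ∑[ z < N ] ∑[ t < N ] (κ z *ᶻ κ (z + t)) *ᶻ h t (i + z)
      square i = begin
        E i *ᶻ E i
          ≡⟨ sum-*ʳ N (E i) (λ z → κ z *ᶻ f (z + i)) ⟨
        ∑[ z < N ] κ z *ᶻ f (z + i) *ᶻ E i
          ≡⟨ sum-cong N (λ z → cong (κ z *ᶻ f (z + i) *ᶻ_)
               (sym (sum-shift {f = λ y → κ y *ᶻ f (y + i)}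
                  (periodic-· perκ (periodic-shift {f = f} i perN)) z))) ⟩
        ∑[ z < N ] κ z *ᶻ f (z + i) *ᶻ (∑[ t < N ] κ (t + z) *ᶻ f (t + z + i))
          ≡⟨ sum-cong N (λ z → trans
               (sym (sum-*ˡ N (κ z *ᶻ f (z + i)) λ t → κ (t + z) *ᶻ f (t + z + i)))
               (sum-cong N λ t → trans (arrange (κ z) (f (z + i)) (κ (t + z)) (f (t + z + i)))
                 (cong₂ _*ᶻ_ (cong (λ j → κ z *ᶻ κ j) (ℕₚ.+-comm t z))
                   (cong₂ (λ j k → f j *ᶻ f k) (ℕₚ.+-comm z i) (index t z i))))) ⟩
        ∑[ z < N ] ∑[ t < N ] (κ z *ᶻ κ (z + t)) *ᶻ h t (i + z) ∎

    -- N Σf = (Σf)².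
    sum-f≥0 : 0ℤ ≤ᶻ sumTo N f
    sum-f≥0 = ℤₚ.*-cancelˡ-≤-pos 0ℤ (sumTo N f) (+ N)
      (subst (_≤ᶻ + N *ᶻ sumTo N f) (sym (ℤₚ.*-zeroʳ (+ N)))
        (subst (0ℤ ≤ᶻ_) square (0≤i*i (sumTo N f))))
      where
      square : sumTo N f *ᶻ sumTo N f ≡ + N *ᶻ sumTo N f
      square = begin
        sumTo N f *ᶻ sumTo N f
          ≡⟨ sum-*ʳ N (sumTo N f) f ⟨
        ∑[ i < N ] f i *ᶻ sumTo N f
          ≡⟨ sum-cong N (λ i → trans (cong (f i *ᶻ_) (sym (sum-shift perN i)))
               (trans (sym (sum-*ˡ N (f i) λ k → f (k + i)))
                 (sum-cong N λ k → cong (λ j → f i *ᶻ f j) (ℕₚ.+-comm k i)))) ⟩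
        ∑[ i < N ] ∑[ k < N ] f i *ᶻ f (i + k)
          ≡⟨ sum-swap N N (λ i k → f i *ᶻ f (i + k)) ⟩
        ∑[ k < N ] ∑[ i < N ] f i *ᶻ f (i + k)
          ≡⟨ sum-cong N self ⟩
        ∑[ k < N ] + N *ᶻ f k
          ≡⟨ sum-*ˡ N (+ N) f ⟩
        + N *ᶻ sumTo N f ∎

    -- Cauchy-Schwarz applied to N Λ(f) = Σ f E.
    Λ-selfCorrelated : ∀ {a} → f 0 ≡ + a → Bounded B (Λ f) a
    Λ-selfCorrelated {a} f0≡a = bounded (ℤₚ.drop‿+≤+ (subst (_≤ᶻ + (a * a * B)) (i*i≡+∣i∣*∣i∣ (Λ f))
      (ℤₚ.*-cancelˡ-≤-pos _ _ (+ N) (ℤₚ.*-cancelˡ-≤-pos _ _ (+ N) scaled))))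
      where
      S = sumTo N f
      ass : ∀ n x → n *ᶻ x *ᶻ (n *ᶻ x) ≡ n *ᶻ (n *ᶻ (x *ᶻ x))
      ass = ℤ-Solver.solve-∀
      ass′ : ∀ n a b c s → n *ᶻ a *ᶻ (n *ᶻ (b *ᶻ a -ᶻ c *ᶻ s)) ≡ n *ᶻ (n *ᶻ (a *ᶻ a *ᶻ b -ᶻ a *ᶻ c *ᶻ s))
      ass′ = ℤ-Solver.solve-∀
      -- The term with C can be discarded because Σf ≥ 0.
      drop : + a *ᶻ + a *ᶻ + B -ᶻ + a *ᶻ + C *ᶻ S ≤ᶻ + (a * a * B)
      drop = subst (+ a *ᶻ + a *ᶻ + B -ᶻ + a *ᶻ + C *ᶻ S ≤ᶻ_)
        (trans (ℤₚ.+-identityʳ (+ a *ᶻ + a *ᶻ + B))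
          (trans (cong (_*ᶻ + B) (sym (ℤₚ.pos-* a a))) (sym (ℤₚ.pos-* (a * a) B))))
        (ℤₚ.+-monoʳ-≤ (+ a *ᶻ + a *ᶻ + B) (ℤₚ.neg-mono-≤
          (subst (λ x → 0ℤ ≤ᶻ x *ᶻ S) (ℤₚ.pos-* a C)
            (subst (_≤ᶻ + (a * C) *ᶻ S) (ℤₚ.*-zeroʳ (+ (a * C)))
              (ℤₚ.*-monoˡ-≤-nonNeg (+ (a * C)) sum-f≥0)))))
      scaled : + N *ᶻ (+ N *ᶻ (Λ f *ᶻ Λ f)) ≤ᶻ + N *ᶻ (+ N *ᶻ + (a * a * B))
      scaled = ℤₚ.≤-trans
        (subst (λ x → x ≤ᶻ + N *ᶻ (+ N *ᶻ (+ a *ᶻ + a *ᶻ + B -ᶻ + a *ᶻ + C *ᶻ S)))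
          (trans (cong (λ x → x *ᶻ x) sum-f*E) (ass (+ N) (Λ f)))
          (subst ((∑[ i < N ] f i *ᶻ E i) *ᶻ (∑[ i < N ] f i *ᶻ E i) ≤ᶻ_)
            (trans (cong₂ _*ᶻ_ sum-f*f sum-E*E)
              (trans (cong (λ x → + N *ᶻ x *ᶻ (+ N *ᶻ (+ B *ᶻ x -ᶻ + C *ᶻ S))) f0≡a)
                (ass′ (+ N) (+ a) (+ B) (+ C) S)))
            (cauchy-schwarz N f E)))
        (ℤₚ.*-monoˡ-≤-nonNeg (+ N) (ℤₚ.*-monoˡ-≤-nonNeg (+ N) drop))

  -- Writing the first factor as (p - 1) - c_p gives two branches: one keeps f with coefficient p -
  -- 1, the other replaces f by f c_p, whose value at 0 is p - 1 times that of f. Both cost the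
  -- same, hence one factor 2 for each prime. When the list is exhausted, f is still self-correlated
  -- and `Λ-selfCorrelated` applies.
  Λ-sieve : ∀ {d ps f a} → Independent Q d ps → Periodic Q f → Periodic d f → SelfCorrelated N f →
    f 0 ≡ + a → Bounded B (Λ λ i → f i *ᶻ sieve ps i) (a * totient ps * 2 ^ length ps)
  Λ-sieve {d} {[]} {f} {a} [] perQ perd self f0≡a =
    subst (λ x → Bounded B x (a * 1 * 1)) (sum-cong N λ i → cong (κ i *ᶻ_) (sym (ℤₚ.*-identityʳ (f i))))
      (subst (Bounded B (Λ f)) (sym (trans (ℕₚ.*-identityʳ (a * 1)) (ℕₚ.*-identityʳ a)))
        (Λ-selfCorrelated perQ self f0≡a))
  Λ-sieve {d} {p ∷ ps} {f} {a} (ind pr p∣Q p∤d rest) perQ perd self f0≡a =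
    subst (λ x → Bounded B x (a * totient (p ∷ ps) * 2 ^ length (p ∷ ps))) (sym split)
      (subst (Bounded B _) (total (p ∸ 1) a (totient ps) (2 ^ length ps))
        (bounded-+
          (bounded-scale (p ∸ 1) (Λ-sieve (weaken rest) perQ perd self f0≡a))
          (bounded-neg (Λ-sieve rest perfrQ perfrd
              (selfCorrelated-ramanujan p (prime∤⇒coprime pr p∤d) (∣.∣-trans p∣Q Q∣N) (periodic-∣ Q∣N perQ) perd self)
              fr0))))
    where
    instance _ = prime⇒nonZero pr
    fr : ℕ → ℤ
    fr i = f i *ᶻ ramanujan p i
    perfrQ : Periodic Q fr
    perfrQ = periodic-· perQ (periodic-∣ p∣Q (periodic-ramanujan p))
    perfrd : Periodic (d * p) fr
    perfrd = periodic-· (periodic-*′ p perd) (periodic-* d (periodic-ramanujan p))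
    -- The branch that keeps f also keeps its period d, so the remaining primes have to be
    -- independent relative to d alone.
    weaken : ∀ {d p qs} → Independent Q (d * p) qs → Independent Q d qs
    weaken [] = []
    weaken {d} {p} (ind {p = r} {ps = qs} pr r∣Q r∤dp rest) =
      ind pr r∣Q (λ r∣d → r∤dp (∣.∣m⇒∣m*n p r∣d)) (weaken (subst (λ e → Independent Q e qs) (swap d p r) rest))
      where
      swap : ∀ d p r → d * p * r ≡ d * r * p
      swap = ℕ-Solver.solve-∀
    fr0 : fr 0 ≡ + (a * (p ∸ 1))
    fr0 = begin
      f 0 *ᶻ (+ p *ᶻ ι (p ∣? 0) -ᶻ 1ℤ)  ≡⟨ cong₂ (λ x y → x *ᶻ (+ p *ᶻ y -ᶻ 1ℤ)) f0≡a (ι-yes (p ∣? 0) (p ∣.∣0)) ⟩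
      + a *ᶻ (+ p *ᶻ 1ℤ -ᶻ 1ℤ)          ≡⟨ cong (λ x → + a *ᶻ (x -ᶻ 1ℤ)) (ℤₚ.*-identityʳ (+ p)) ⟩
      + a *ᶻ (+ p -ᶻ 1ℤ)                 ≡⟨ cong (+ a *ᶻ_) (+[p∸1] p) ⟨
      + a *ᶻ + (p ∸ 1)                   ≡⟨ ℤₚ.pos-* a (p ∸ 1) ⟨
      + (a * (p ∸ 1))                    ∎
    total : ∀ r a t w → r * (a * t * w) + a * r * t * w ≡ a * (r * t) * (2 * w)
    total = ℕ-Solver.solve-∀
    expand : ∀ k f p e s → k *ᶻ (f *ᶻ ((p -ᶻ p *ᶻ e) *ᶻ s)) ≡
      (p -ᶻ 1ℤ) *ᶻ (k *ᶻ (f *ᶻ s)) +ᶻ -ᶻ 1ℤ *ᶻ (k *ᶻ (f *ᶻ (p *ᶻ e -ᶻ 1ℤ) *ᶻ s))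
    expand = ℤ-Solver.solve-∀
    split : Λ (λ i → f i *ᶻ sieve (p ∷ ps) i) ≡
      + (p ∸ 1) *ᶻ Λ (λ i → f i *ᶻ sieve ps i) +ᶻ -ᶻ Λ (λ i → fr i *ᶻ sieve ps i)
    split = begin
      Λ (λ i → f i *ᶻ sieve (p ∷ ps) i)
        ≡⟨ sum-cong N (λ i → expand (κ i) (f i) (+ p) (ι (p ∣? i)) (sieve ps i)) ⟩
      ∑[ i < N ] ((+ p -ᶻ 1ℤ) *ᶻ (κ i *ᶻ (f i *ᶻ sieve ps i)) +ᶻ -ᶻ 1ℤ *ᶻ (κ i *ᶻ (fr i *ᶻ sieve ps i)))
        ≡⟨ sum-linear₂ N (+ p -ᶻ 1ℤ) (-ᶻ 1ℤ) (λ i → κ i *ᶻ (f i *ᶻ sieve ps i)) (λ i → κ i *ᶻ (fr i *ᶻ sieve ps i)) ⟩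
      (+ p -ᶻ 1ℤ) *ᶻ Λ (λ i → f i *ᶻ sieve ps i) +ᶻ -ᶻ 1ℤ *ᶻ Λ (λ i → fr i *ᶻ sieve ps i)
        ≡⟨ cong₂ (λ x y → x *ᶻ Λ (λ i → f i *ᶻ sieve ps i) +ᶻ y) (sym (+[p∸1] p)) (ℤₚ.-1*i≡-i _) ⟩
      + (p ∸ 1) *ᶻ Λ (λ i → f i *ᶻ sieve ps i) +ᶻ -ᶻ Λ (λ i → fr i *ᶻ sieve ps i) ∎

-- Divisibility

prime-divisor : ∀ n → .{{NonZero n}} → n ≢ 1 → ∃ λ p → Prime p × p ∣ n
prime-divisor n n≢1 with factorise n
... | record { factors = []     ; isFactorisation = n≡1 } = contradiction n≡1 n≢1
... | record { factors = p ∷ ps ; isFactorisation = eq ; factorsPrime = pr ∷ _ } =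
  p , pr , subst (p ∣_) (sym eq) (∣.m∣m*n _)

prime>1 : ∀ {p} → Prime p → 1 < p
prime>1 {p} pr = nonTrivial⇒n>1 p {{prime⇒nonTrivial pr}}

extract-power : ∀ {p} → Prime p → ∀ e → .{{NonZero e}} → ∃ λ i → ∃ λ e′ → e ≡ p ^ i * e′ × ¬ p ∣ e′
extract-power {p} pr = <-rec _ step
  where
  step : ∀ e → (∀ {d} → d < e → .{{NonZero d}} → ∃ λ i → ∃ λ d′ → d ≡ p ^ i * d′ × ¬ p ∣ d′) →
         .{{NonZero e}} → ∃ λ i → ∃ λ e′ → e ≡ p ^ i * e′ × ¬ p ∣ e′
  step e rec with p ∣? e
  ... | no  p∤e = 0 , e , sym (ℕₚ.*-identityˡ e) , p∤e
  ... | yes (divides d refl) with rec (ℕₚ.m<m*n d p {{ℕₚ.m*n≢0⇒m≢0 d}} (prime>1 pr)) {{ℕₚ.m*n≢0⇒m≢0 d}}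
  ...   | i , e′ , refl , p∤e′ = suc i , e′ , rearrange (p ^ i) e′ p , p∤e′
    where
    rearrange : ∀ a b c → a * b * c ≡ c * a * b
    rearrange = ℕ-Solver.solve-∀

^-monoʳ-∣ : ∀ p {i j} → i ≤ j → p ^ i ∣ p ^ j
^-monoʳ-∣ p {i} i≤j with ℕₚ.m≤n⇒∃[o]m+o≡n i≤j
... | k , refl = subst (p ^ i ∣_) (sym (ℕₚ.^-distribˡ-+-* p i k)) (∣.m∣m*n (p ^ k))

-- A prime at which the valuation of d exceeds that of e.
∤⇒prime-power : ∀ d e → .{{NonZero d}} → .{{NonZero e}} → ¬ d ∣ e →
  ∃ λ p → ∃ λ i → ∃ λ e′ → Prime p × e ≡ p ^ i * e′ × ¬ p ∣ e′ × p ^ suc i ∣ d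
∤⇒prime-power d e {{d≢0}} d∤e with gcd[m,n]∣m d e
... | divides k d≡kh = go (prime-divisor k {{ℕₚ.m*n≢0⇒m≢0 k {{subst NonZero d≡kh d≢0}}}} k≢1)
  where
  k≢1 : k ≢ 1
  k≢1 refl = d∤e (subst (_∣ e) (sym (trans d≡kh (ℕₚ.*-identityˡ (gcd d e)))) (gcd[m,n]∣n d e))
  go : (∃ λ p → Prime p × p ∣ k) →
    ∃ λ p → ∃ λ i → ∃ λ e′ → Prime p × e ≡ p ^ i * e′ × ¬ p ∣ e′ × p ^ suc i ∣ d
  go (p , pr , p∣k) with extract-power pr e | extract-power pr d
  ... | i , e′ , e≡ , p∤e′ | j , d′ , d≡ , p∤d′ with ℕₚ.≤-<-connex j i
  ...   | inj₂ i<j = p , i , e′ , pr , e≡ , p∤e′ ,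
    subst (p ^ suc i ∣_) (sym d≡) (∣.∣m⇒∣m*n d′ (^-monoʳ-∣ p i<j))
  ...   | inj₁ j≤i = contradiction p∣d′ p∤d′
    where
    instance
      p^j≢0 : NonZero (p ^ j)
      p^j≢0 = ℕₚ.m^n≢0 p j {{prime⇒nonZero pr}}
    p^j∣h : p ^ j ∣ gcd d e
    p^j∣h = gcd-greatest (subst (p ^ j ∣_) (sym d≡) (∣.m∣m*n d′))
      (subst (p ^ j ∣_) (sym e≡) (∣.∣m⇒∣m*n e′ (^-monoʳ-∣ p j≤i)))
    p∣d′ : p ∣ d′
    p∣d′ = ∣.*-cancelʳ-∣ (p ^ j) (subst (p * p ^ j ∣_)
      (trans (sym d≡kh) (trans d≡ (ℕₚ.*-comm (p ^ j) d′))) (∣.*-pres-∣ p∣k p^j∣h))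

coprime-^ˡ : ∀ {p e} → Prime p → ¬ p ∣ e → ∀ i → Coprime (p ^ i) e
coprime-^ˡ pr p∤e zero = Coprimality.1-coprimeTo _
coprime-^ˡ {p} {e} pr p∤e (suc i) {d} (d∣pp^i , d∣e) = coprime-^ˡ pr p∤e i
  (coprime-divisor (λ (x∣d , x∣p) → prime∤⇒coprime pr p∤e (∣.∣-trans x∣d d∣e , x∣p)) d∣pp^i , d∣e)

coprime-*∣ : ∀ {m n o} → Coprime m n → m ∣ o → n ∣ o → m * n ∣ o
coprime-*∣ {m} {n} coprime m∣o (divides k refl) =
  subst (_∣ k * n) (ℕₚ.*-comm n m) (subst (n * m ∣_) (ℕₚ.*-comm n k)
    (∣.*-monoʳ-∣ n (coprime-divisor coprime (subst (m ∣_) (ℕₚ.*-comm k n) m∣o))))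

least : ∀ {ℓ} {P : ℕ → Set ℓ} → (∀ n → Dec (P n)) → ∀ n → P n → ∃ λ m → P m × (∀ j → j < m → ¬ P j)
least {P = P} P? = <-rec _ step
  where
  step : ∀ n → (∀ {m} → m < n → P m → ∃ λ m → P m × (∀ j → j < m → ¬ P j)) →
         P n → ∃ λ m → P m × (∀ j → j < m → ¬ P j)
  step n rec Pn with ℕₚ.anyUpTo? P? n
  ... | yes (m , m<n , Pm) = rec m<n Pm
  ... | no ¬any            = n , Pn , λ j j<n Pj → ¬any (j , j<n , Pj)

-- Counts as integer sums

module ℤ-Sum = Algebra.Properties.CommutativeMonoid.Sum ℤₚ.+-0-commutativeMonoid

sum-toℕ : ∀ n (f : ℕ → ℤ) → ℤ-Sum.sum {n} (λ i → f (toℕ i)) ≡ sumTo n f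
sum-toℕ zero    f = refl
sum-toℕ (suc n) f = trans (cong (f 0 +ᶻ_) (sum-toℕ n (λ i → f (suc i)))) (sym (sum-first n f))

count-tabulate : ∀ {a p} {A : Set a} {P : A → Set p} (P? : ∀ x → Dec (P x)) n (f : Fin n → A) →
  + count P? (tabulate f) ≡ ℤ-Sum.sum (λ i → ι (P? (f i)))
count-tabulate P? zero    f = refl
count-tabulate P? (suc n) f with P? (f Fin.zero)
... | yes _ = cong (1ℤ +ᶻ_) (count-tabulate P? n (λ i → f (Fin.suc i)))
... | no  _ = trans (count-tabulate P? n (λ i → f (Fin.suc i))) (sym (ℤₚ.+-identityˡ _))

-- Binomial coefficients modulo a prime

prime∤! : ∀ {p} → Prime p → ∀ j → j < p → ¬ p ∣ j !
prime∤! pr zero    _   p∣1 = ℕₚ.<⇒≢ (prime>1 pr) (sym (∣.∣1⇒≡1 p∣1))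
prime∤! pr (suc j) j<p p∣ with euclidsLemma (suc j) (j !) pr p∣
... | inj₁ p∣1+j = ∣.>⇒∤ j<p p∣1+j
... | inj₂ p∣j!  = prime∤! pr j (ℕₚ.<-trans (ℕₚ.n<1+n j) j<p) p∣j!

prime∣C : ∀ {p k} → Prime p → 0 < k → k < p → p ∣ p choose k
prime∣C {p@(suc p′)} {k} pr 0<k k<p with euclidsLemma (p choose k) (k ! * (p ∸ k) !) pr (subst (p ∣_) p!≡ (∣.m∣m*n (p′ !)))
  where
  instance _ = k !* (p ∸ k) !≢0
  p!≡ : p ! ≡ (p choose k) * (k ! * (p ∸ k) !)
  p!≡ = sym (trans (cong (_* (k ! * (p ∸ k) !)) (nCk≡n!/k![n-k]! (ℕₚ.<⇒≤ k<p)))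
                   (m/n*n≡m (k![n∸k]!∣n! (ℕₚ.<⇒≤ k<p))))
... | inj₁ p∣C = p∣C
... | inj₂ p∣k!l! with euclidsLemma (k !) ((p ∸ k) !) pr p∣k!l!
...   | inj₁ p∣k! = contradiction p∣k! (prime∤! pr k k<p)
...   | inj₂ p∣l! = contradiction p∣l! (prime∤! pr (p ∸ k) (ℕₚ.∸-monoʳ-< 0<k (ℕₚ.<⇒≤ k<p)))
prime∣C {zero} pr _ ()

sum-swap-Fin : ∀ m {n} (f : ℕ → Fin n → ℤ) →
  ∑[ j < m ] ℤ-Sum.sum (f j) ≡ ℤ-Sum.sum (λ i → ∑[ j < m ] f j i)
sum-swap-Fin zero    {n} f = sym (ℤ-Sum.sum-replicate-zero n)
sum-swap-Fin (suc m) f = trans (cong (ℤ-Sum.sum (f m) +ᶻ_) (sum-swap-Fin m f))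
  (sym (ℤ-Sum.∑-distrib-+ (f m) (λ i → ∑[ j < m ] f j i)))

-- Coprime residues

coprimeTo : ℕ → ℕ → ℤ
coprimeTo m k = ι (gcd k m ℕₚ.≟ 1)

coprimeTo-cong : ∀ m {j k} → (∀ {d} → d ∣ m → d ∣ j → d ∣ k) → (∀ {d} → d ∣ m → d ∣ k → d ∣ j) →
  coprimeTo m j ≡ coprimeTo m k
coprimeTo-cong m {j} {k} to from = ι-cong
  (λ eq → coprime⇒gcd≡1 λ (d∣k , d∣m) → gcd≡1⇒coprime eq (from d∣m d∣k , d∣m))
  (λ eq → coprime⇒gcd≡1 λ (d∣j , d∣m) → gcd≡1⇒coprime eq (to d∣m d∣j , d∣m))
  (gcd j m ℕₚ.≟ 1) (gcd k m ℕₚ.≟ 1)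

coprimeTo-periodic : ∀ m → Periodic m (coprimeTo m)
coprimeTo-periodic m k = coprimeTo-cong m {k + m} {k}
  (λ {d} d∣m d∣k+m → ∣.∣m+n∣m⇒∣n (subst (d ∣_) (ℕₚ.+-comm k m) d∣k+m) d∣m)
  (λ d∣m d∣k → ∣.∣m∣n⇒∣m+n d∣k d∣m)

coprimeTo-double : ∀ {m} → ¬ 2 ∣ m → ∀ k → coprimeTo m (k + k) ≡ coprimeTo m k
coprimeTo-double {m} 2∤m k = coprimeTo-cong m {k + k} {k}
  (λ {d} d∣m d∣2k → coprime-divisor (λ (x∣d , x∣2) → prime∤⇒coprime prime[2] 2∤m (∣.∣-trans x∣d d∣m , x∣2))
    (subst (d ∣_) (cong (_+_ k) (sym (ℕₚ.+-identityʳ k))) d∣2k))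
  (λ d∣m d∣k → ∣.∣m∣n⇒∣m+n d∣k d∣k)

count-applyUpTo : ∀ {p} {P : ℕ → Set p} (P? : ∀ x → Dec (P x)) (f : ℕ → ℕ) n →
  + count P? (applyUpTo f n) ≡ ∑[ i < n ] ι (P? (f i))
count-applyUpTo P? f zero    = refl
count-applyUpTo P? f (suc n) = trans head (sym (sum-first n (λ i → ι (P? (f i)))))
  where
  head : + count P? (applyUpTo f (suc n)) ≡ ι (P? (f 0)) +ᶻ (∑[ i < n ] ι (P? (f (suc i))))
  head with P? (f 0)
  ... | yes _ = cong (1ℤ +ᶻ_) (count-applyUpTo P? (λ i → f (suc i)) n)
  ... | no  _ = trans (count-applyUpTo P? (λ i → f (suc i)) n) (sym (ℤₚ.+-identityˡ _))

-- `φ` counts over 1, ..., m and `sumTo` runs over 0, ..., m - 1; periodicity makes the shift by one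
-- harmless.
φ-sum : ∀ m → + φ m ≡ sumTo m (coprimeTo m)
φ-sum m = begin
  + φ m                                        ≡⟨ cong (λ ks → + count (λ k → gcd k m ℕₚ.≟ 1) ks) (map-upTo suc m) ⟩
  + count (λ k → gcd k m ℕₚ.≟ 1) (applyUpTo suc m)  ≡⟨ count-applyUpTo (λ k → gcd k m ℕₚ.≟ 1) suc m ⟩
  ∑[ k < m ] coprimeTo m (suc k)               ≡⟨ sum-cong m (λ k → cong (coprimeTo m) (ℕₚ.+-comm 1 k)) ⟩
  ∑[ k < m ] coprimeTo m (k + 1)               ≡⟨ sum-shift (coprimeTo-periodic m) 1 ⟩
  sumTo m (coprimeTo m)                        ∎
  where open ≡-Reasoning

primesOf : ℕ → List ℕ
primesOf m = filter (λ p → prime? p ×-dec (p ∣? m)) (upTo (suc m))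

primesOf⁻ : ∀ m → All (λ p → Prime p × p ∣ m) (primesOf m)
primesOf⁻ m = All.all-filter (λ p → prime? p ×-dec (p ∣? m)) (upTo (suc m))

primesOf⁺ : ∀ {m p} → .{{NonZero m}} → Prime p → p ∣ m → p ∈ primesOf m
primesOf⁺ {m} pr p∣m = ∈-filter⁺ (λ p → prime? p ×-dec (p ∣? m)) (∈-upTo⁺ (s≤s (∣.∣⇒≤ p∣m))) (pr , p∣m)

distinct-primes : ∀ {p r} → Prime p → Prime r → p ≢ r → ¬ r ∣ p
distinct-primes pp pr p≢r r∣p with prime⇒irreducible pp r∣p
... | inj₁ refl = ℕₚ.<⇒≢ (prime>1 pr) refl
... | inj₂ refl = p≢r refl

independent : ∀ {Q d ps} → All (λ p → Prime p × p ∣ Q) ps → All (λ p → ¬ p ∣ d) ps → Unique ps → Independent Q d ps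
independent [] [] [] = []
independent {Q} {d} {p ∷ ps} ((pr , p∣Q) ∷ prs) (p∤d ∷ ∤d) (p≢ ∷ uniq) =
  ind pr p∣Q p∤d (independent prs (All.zipWith combine (prs , All.zip (∤d , p≢))) uniq)
  where
  combine : ∀ {r} → (Prime r × r ∣ Q) × (¬ r ∣ d) × p ≢ r → ¬ r ∣ d * p
  combine ((prr , _) , r∤d , p≢r) r∣dp with euclidsLemma d p prr r∣dp
  ... | inj₁ r∣d = r∤d r∣d
  ... | inj₂ r∣p = distinct-primes pr prr p≢r r∣p

primesOf-independent : ∀ {m Q} → m ∣ Q → Independent Q 1 (primesOf m)
primesOf-independent {m} m∣Q = independent
  (All.map (λ (pr , p∣m) → pr , ∣.∣-trans p∣m m∣Q) (primesOf⁻ m))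
  (All.map (λ (pr , _) p∣1 → ℕₚ.<⇒≢ (prime>1 pr) (sym (∣.∣1⇒≡1 p∣1))) (primesOf⁻ m))
  (Unique.filter⁺ (λ p → prime? p ×-dec (p ∣? m)) (Unique.upTo⁺ (suc m)))

sieve-none : ∀ {k} ps → All (λ p → ¬ p ∣ k) ps → sieve ps k ≡ + product ps
sieve-none []       []           = refl
sieve-none {k} (p ∷ ps) (p∤k ∷ ∤k) = begin
  (+ p -ᶻ + p *ᶻ ι (p ∣? k)) *ᶻ sieve ps k  ≡⟨ cong₂ (λ x y → (+ p -ᶻ + p *ᶻ x) *ᶻ y) (ι-no (p ∣? k) p∤k) (sieve-none ps ∤k) ⟩
  (+ p -ᶻ + p *ᶻ 0ℤ) *ᶻ + product ps        ≡⟨ simplify (+ p) (+ product ps) ⟩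
  + p *ᶻ + product ps                       ≡⟨ ℤₚ.pos-* p (product ps) ⟨
  + (p * product ps)                        ∎
  where
  open ≡-Reasoning
  simplify : ∀ p x → (p -ᶻ p *ᶻ 0ℤ) *ᶻ x ≡ p *ᶻ x
  simplify = ℤ-Solver.solve-∀

sieve-some : ∀ {k p} ps → p ∈ ps → p ∣ k → sieve ps k ≡ 0ℤ
sieve-some {k} {p} (p ∷ ps) (here refl) p∣k =
  trans (cong (λ x → (+ p -ᶻ + p *ᶻ x) *ᶻ sieve ps k) (ι-yes (p ∣? k) p∣k)) (simplify (+ p) (sieve ps k))
  where
  simplify : ∀ p x → (p -ᶻ p *ᶻ 1ℤ) *ᶻ x ≡ 0ℤ
  simplify = ℤ-Solver.solve-∀
sieve-some {k} (r ∷ ps) (there p∈ps) p∣k =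
  trans (cong ((+ r -ᶻ + r *ᶻ ι (r ∣? k)) *ᶻ_) (sieve-some ps p∈ps p∣k)) (ℤₚ.*-zeroʳ (+ r -ᶻ + r *ᶻ ι (r ∣? k)))

-- One prime of m dividing k annihilates the product; if none does, what remains is the product of
-- the primes, the radical of m.
sieve-coprimeTo : ∀ m → .{{NonZero m}} → ∀ k → sieve (primesOf m) k ≡ + product (primesOf m) *ᶻ coprimeTo m k
sieve-coprimeTo m {{m≢0}} k with gcd k m ℕₚ.≟ 1
... | yes gcd≡1 = trans (sieve-none (primesOf m) (All.map (λ (pr , p∣m) p∣k → ℕₚ.<⇒≢ (prime>1 pr)
    (sym (gcd≡1⇒coprime gcd≡1 (p∣k , p∣m)))) (primesOf⁻ m))) (sym (ℤₚ.*-identityʳ _))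
... | no gcd≢1 = let p , pr , p∣gcd = prime-divisor (gcd k m) {{gcd≢0}} gcd≢1 in trans
    (sieve-some (primesOf m) (primesOf⁺ pr (∣.∣-trans p∣gcd (gcd[m,n]∣n k m))) (∣.∣-trans p∣gcd (gcd[m,n]∣m k m)))
    (sym (ℤₚ.*-zeroʳ (+ product (primesOf m))))
  where
  gcd≢0 : NonZero (gcd k m)
  gcd≢0 = ≢-nonZero λ gcd≡0 → ≢-nonZero⁻¹ m (∣.0∣⇒≡0 (subst (_∣ m) gcd≡0 (gcd[m,n]∣n k m)))

product≢0 : ∀ m → NonZero (product (primesOf m))
product≢0 m = productOfPrimes≢0 (All.map proj₁ (primesOf⁻ m))

-- Euler's formula φ(m)/m = ∏ (1 - 1/p) cleared of denominators. The sieve is summed over one period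
-- in two ways: as the radical times the indicator of coprimality, and by the independence of its
-- factors.
product*φ : ∀ m → .{{NonZero m}} → product (primesOf m) * φ m ≡ totient (primesOf m) * m
product*φ m = ℤₚ.+-injective (begin
  + (rad * φ m)                                  ≡⟨ ℤₚ.pos-* rad (φ m) ⟩
  + rad *ᶻ + φ m                                 ≡⟨ cong (+ rad *ᶻ_) (φ-sum m) ⟩
  + rad *ᶻ sumTo m (coprimeTo m)                 ≡⟨ sum-*ˡ m (+ rad) (coprimeTo m) ⟨
  ∑[ k < m ] + rad *ᶻ coprimeTo m k              ≡⟨ sum-cong m (λ k → sym (trans (ℤₚ.*-identityˡ _) (sieve-coprimeTo m k))) ⟩
  ∑[ k < m ] 1ℤ *ᶻ sieve (primesOf m) k          ≡⟨ sum-sieve {m} {ps = primesOf m} (λ _ → 1ℤ) (primesOf-independent ∣.∣-refl) (λ _ → refl) (λ _ → refl) ⟩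
  + totient (primesOf m) *ᶻ (∑[ k < m ] 1ℤ)      ≡⟨ cong (+ totient (primesOf m) *ᶻ_) (trans (sum-const m 1ℤ) (ℤₚ.*-identityʳ (+ m))) ⟩
  + totient (primesOf m) *ᶻ + m                  ≡⟨ ℤₚ.pos-* (totient (primesOf m)) m ⟨
  + (totient (primesOf m) * m)                   ∎)
  where
  open ≡-Reasoning
  rad = product (primesOf m)

φ>0 : ∀ m → .{{NonZero m}} → 0 < φ m
φ>0 m = ℕₚ.n≢0⇒n>0 λ φ≡0 → ≢-nonZero⁻¹ (totient (primesOf m) * m)
  {{ℕₚ.m*n≢0 (totient (primesOf m)) m {{totient≢0 (All.map proj₁ (primesOf⁻ m))}}}}
  (trans (sym (product*φ m)) (trans (cong (product (primesOf m) *_) φ≡0) (ℕₚ.*-zeroʳ (product (primesOf m)))))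
  where
  totient≢0 : ∀ {ps} → All Prime ps → NonZero (totient ps)
  totient≢0 []                  = _
  totient≢0 {p ∷ ps} (pr ∷ prs) = ℕₚ.m*n≢0 (p ∸ 1) (totient ps)
    {{>-nonZero (ℕₚ.m<n⇒0<n∸m (prime>1 pr))}} {{totient≢0 prs}}

-- Take for j the product of the primes up to N that do not divide k.
coprime-lift : ∀ {k Q} N → .{{NonZero N}} → Coprime k Q → ∃ λ j → gcd (k + j * Q) N ≡ 1
coprime-lift {k} {Q} N {{N≢0}} coprime = j , decidable-stable (gcd (k + j * Q) N ℕₚ.≟ 1) λ gcd≢1 →
  let p , pr , p∣gcd = prime-divisor (gcd (k + j * Q) N) {{gcd≢0}} gcd≢1 in
  impossible pr (∣.∣-trans p∣gcd (gcd[m,n]∣m (k + j * Q) N)) (∣.∣-trans p∣gcd (gcd[m,n]∣n (k + j * Q) N))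
  where
  P? : ∀ p → Dec (Prime p × ¬ p ∣ k)
  P? p = prime? p ×-dec ¬? (p ∣? k)
  ps = filter P? (upTo (suc N))
  j = product ps
  gcd≢0 : NonZero (gcd (k + j * Q) N)
  gcd≢0 = ≢-nonZero λ gcd≡0 → ≢-nonZero⁻¹ N (∣.0∣⇒≡0 (subst (_∣ N) gcd≡0 (gcd[m,n]∣n (k + j * Q) N)))
  -- A prime factor p of N and of k + jQ that does not divide k divides j, hence divides k after
  -- all. If it divides k, it divides jQ, but neither Q, by coprimality, nor j, by the choice of j.
  impossible : ∀ {p} → Prime p → p ∣ k + j * Q → p ∣ N → ⊥
  impossible {p} pr p∣ p∣N with p ∣? k
  ... | no  p∤k = p∤k (∣.∣m+n∣m⇒∣n (subst (p ∣_) (ℕₚ.+-comm k (j * Q)) p∣)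
    (∣.∣m⇒∣m*n Q (∈⇒∣product (∈-filter⁺ P? (∈-upTo⁺ (s≤s (∣.∣⇒≤ p∣N))) (pr , p∤k)))))
  ... | yes p∣k with euclidsLemma j Q pr (∣.∣m+n∣m⇒∣n p∣ p∣k)
  ...   | inj₂ p∣Q = ℕₚ.<⇒≢ (prime>1 pr) (sym (coprime (p∣k , p∣Q)))
  ...   | inj₁ p∣j = proj₂ (proj₂ (∈-filter⁻ P? {xs = upTo (suc N)} (factorisationHasAllPrimeFactors pr p∣j
    (All.map proj₁ (All.all-filter P? (upTo (suc N))))))) p∣k

sum≢0⇒∃≢0 : ∀ n (f : ℕ → ℤ) → sumTo n f ≢ 0ℤ → ∃ λ i → f i ≢ 0ℤ
sum≢0⇒∃≢0 zero    f sum≢0 = contradiction refl sum≢0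
sum≢0⇒∃≢0 (suc n) f sum≢0 with f n ℤₚ.≟ 0ℤ
... | no  fn≢0 = n , fn≢0
... | yes fn≡0 = sum≢0⇒∃≢0 n f λ sum≡0 → sum≢0 (cong₂ _+ᶻ_ fn≡0 sum≡0)

m∸n≤∣m-n∣ : ∀ m n → m ∸ n ≤ abs (+ m -ᶻ + n)
m∸n≤∣m-n∣ m n with ℕₚ.≤-total n m
... | inj₁ n≤m = ℕₚ.≤-reflexive (sym (cong abs (trans (ℤₚ.m-n≡m⊖n m n) (ℤₚ.⊖-≥ n≤m))))
... | inj₂ m≤n = subst (_≤ abs (+ m -ᶻ + n)) (sym (ℕₚ.m≤n⇒m∸n≡0 m≤n)) z≤n

bounded-cancel : ∀ {B x a} c → .{{NonZero c}} → Bounded B (+ c *ᶻ x) (c * a) → Bounded B x a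
bounded-cancel {B} {x} {a} c (bounded b) = bounded (ℕₚ.*-cancelˡ-≤ (c * c) {{ℕₚ.m*n≢0 c c}} (begin
  c * c * (abs x * abs x)            ≡⟨ left c (abs x) ⟩
  c * abs x * (c * abs x)            ≡⟨ cong (λ z → z * z) (ℤₚ.abs-* (+ c) x) ⟨
  abs (+ c *ᶻ x) * abs (+ c *ᶻ x)    ≤⟨ b ⟩
  c * a * (c * a) * B                ≡⟨ right c a B ⟩
  c * c * (a * a * B)                ∎))
  where
  open ℕₚ.≤-Reasoning
  left : ∀ c x → c * c * (x * x) ≡ c * x * (c * x)
  left = ℕ-Solver.solve-∀
  right : ∀ c a B → c * a * (c * a) * B ≡ c * c * (a * a * B)
  right = ℕ-Solver.solve-∀

bounded-weaken : ∀ {B x a b} → a ≤ b → Bounded B x a → Bounded B x b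
bounded-weaken {B} a≤b (bounded bx) = bounded (ℕₚ.≤-trans bx (ℕₚ.*-monoˡ-≤ B (ℕₚ.*-mono-≤ a≤b a≤b)))

-- The cofactor (qⁿ - 1)/(q - 1)

geometric : ℕ → ℕ → ℕ
geometric q zero    = 0
geometric q (suc i) = q ^ i + geometric q i

geometric-sum : ∀ r i → suc (geometric (suc r) i * r) ≡ suc r ^ i
geometric-sum r zero    = refl
geometric-sum r (suc i) = trans (rearrange (suc r ^ i) (geometric (suc r) i) r)
  (trans (cong (λ x → suc r ^ i * r + x) (geometric-sum r i)) (collect (suc r ^ i) r))
  where
  rearrange : ∀ p s r → 1 + (p + s) * r ≡ p * r + (1 + s * r)
  rearrange = ℕ-Solver.solve-∀
  collect : ∀ p r → p * r + p ≡ (1 + r) * p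
  collect = ℕ-Solver.solve-∀

odd-form : ∀ m → ¬ 2 ∣ m → ∃ λ h → m ≡ suc (h + h)
odd-form zero          2∤m = contradiction (2 ∣.∣0) 2∤m
odd-form (suc zero)    2∤m = 0 , refl
odd-form (suc (suc m)) 2∤m with odd-form m (λ 2∣m → 2∤m (∣.∣m∣n⇒∣m+n ∣.∣-refl 2∣m))
... | h , refl = suc h , cong (λ x → suc (suc x)) (sym (ℕₚ.+-suc h h))

odd-power : ∀ {q} → ¬ 2 ∣ q → ∀ i → ¬ 2 ∣ q ^ i
odd-power 2∤q zero    2∣1 = contradiction (∣.∣1⇒≡1 2∣1) λ ()
odd-power {q} 2∤q (suc i) 2∣ with euclidsLemma q (q ^ i) prime[2] 2∣
... | inj₁ 2∣q  = 2∤q 2∣q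
... | inj₂ 2∣q^i = odd-power 2∤q i 2∣q^i

-- Each of the i summands is a power of an odd number, so the sum has the parity of i.
geometric-parity : ∀ {q} → ¬ 2 ∣ q → ∀ i → ∃ λ h → geometric q i ≡ i + 2 * h
geometric-parity 2∤q zero = 0 , refl
geometric-parity {q} 2∤q (suc i) =
  let h , eq = geometric-parity 2∤q i
      k , eq′ = odd-form (q ^ i) (odd-power 2∤q i)
  in h + k , trans (cong₂ _+_ eq′ eq) (rearrange k i h)
  where
  rearrange : ∀ k i h → 1 + (k + k) + (i + 2 * h) ≡ 1 + i + 2 * (h + k)
  rearrange = ℕ-Solver.solve-∀

odd-geometric : ∀ {q n} → ¬ 2 ∣ q → ¬ 2 ∣ n → ¬ 2 ∣ geometric q n
odd-geometric {q} {n} 2∤q 2∤n 2∣ = let h , eq = geometric-parity 2∤q n in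
  2∤n (∣+*-cancel n h (subst (2 ∣_) eq 2∣))

Q≡geometric : ∀ k n → Q (suc (suc k)) n ≡ geometric (suc (suc k)) n
Q≡geometric k n = trans (cong (λ x → (x ∸ 1) / suc k) (sym (geometric-sum (suc k) n)))
  (m*n/n≡m (geometric (suc (suc k)) n) (suc k))

-- Finite fields

module FieldTheory {c ℓ} (F : FiniteField c ℓ) where
  open FiniteField F hiding (zero) renaming
    (_+_ to _+ᶠ_; _*_ to _*ᶠ_; -_ to -ᶠ_; _-_ to _-ᶠ_; refl to ≈-refl; sym to ≈-sym; trans to ≈-trans)
  open Algebra.Properties.Semiring.Exp semiring using (^-congˡ; ^-congʳ; ^-homo-*; ^-assocʳ)
  open Algebra.Properties.CommutativeSemiring.Exp commutativeSemiring using (^-distrib-*)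
  open Algebra.Properties.Semiring.Mult semiring using (×1-homo-*; ×-assoc-*; ×-congʳ; ×-assocˡ) renaming (_×_ to _·_)
  open Algebra.Properties.Group +-group using () renaming
    (∙-cancelˡ to +-cancelˡ; x∙y⁻¹≈ε⇒x≈y to x-y≈0⇒x≈y; x≈y⇒x∙y⁻¹≈ε to x≈y⇒x-y≈0; inverseʳ-unique to -‿unique)
  open Algebra.Properties.Ring ring using (-‿distribʳ-*)
  module ≈-Reasoning = Relation.Binary.Reasoning.Setoid setoid

  solverRing : AlmostCommutativeRing c ℓ
  solverRing = fromCommutativeRing commRing (λ _ → nothing)
  open RingSolver solverRing using (solve; _⊜_; _⊕_; _⊗_)

  *-cancelˡ-nonZero : ∀ {x y z} → ¬ x ≈ 0# → x *ᶠ y ≈ x *ᶠ z → y ≈ z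
  *-cancelˡ-nonZero {x} {y} {z} x≉0 xy≈xz with inverse x x≉0
  ... | x⁻¹ , xx⁻¹≈1 = begin
    y                 ≈⟨ unit y ⟨
    x⁻¹ *ᶠ (x *ᶠ y)   ≈⟨ *-congˡ xy≈xz ⟩
    x⁻¹ *ᶠ (x *ᶠ z)   ≈⟨ unit z ⟩
    z                 ∎
    where
    open ≈-Reasoning
    unit : ∀ y → x⁻¹ *ᶠ (x *ᶠ y) ≈ y
    unit y = begin
      x⁻¹ *ᶠ (x *ᶠ y)  ≈⟨ *-assoc x⁻¹ x y ⟨
      x⁻¹ *ᶠ x *ᶠ y    ≈⟨ *-congʳ (≈-trans (*-comm x⁻¹ x) xx⁻¹≈1) ⟩
      1# *ᶠ y          ≈⟨ *-identityˡ y ⟩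
      y                ∎

  *-nonZero : ∀ {x y} → ¬ x ≈ 0# → ¬ y ≈ 0# → ¬ x *ᶠ y ≈ 0#
  *-nonZero {x} x≉0 y≉0 xy≈0 = y≉0 (*-cancelˡ-nonZero x≉0 (≈-trans xy≈0 (≈-sym (zeroʳ x))))

  ^-nonZero : ∀ {x} → ¬ x ≈ 0# → ∀ k → ¬ x ^ᶠ k ≈ 0#
  ^-nonZero x≉0 zero    = 1≉0
  ^-nonZero x≉0 (suc k) = *-nonZero x≉0 (^-nonZero x≉0 k)

  1^ : ∀ k → 1# ^ᶠ k ≈ 1#
  1^ zero    = ≈-refl
  1^ (suc k) = ≈-trans (*-identityˡ _) (1^ k)

  index : Carrier → Fin size
  index x = proj₁ (enum-surj x)

  enum-index : ∀ x → enum (index x) ≈ x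
  enum-index x = proj₂ (enum-surj x)

  Distinct : ∀ {n} → (Fin n → Carrier) → Set ℓ
  Distinct r = ∀ i j → r i ≈ r j → i ≡ j

  distinct-∷ : ∀ {n x} {r : Fin n → Carrier} → (∀ i → ¬ x ≈ r i) → Distinct r → Distinct (x Vector.∷ r)
  distinct-∷ x≉r dist Fin.zero    Fin.zero    eq = refl
  distinct-∷ x≉r dist Fin.zero    (Fin.suc j) eq = contradiction eq (x≉r j)
  distinct-∷ x≉r dist (Fin.suc i) Fin.zero    eq = contradiction (≈-sym eq) (x≉r i)
  distinct-∷ x≉r dist (Fin.suc i) (Fin.suc j) eq = cong Fin.suc (dist i j eq)

  distinct⇒≤size : ∀ {n} (r : Fin n → Carrier) → Distinct r → n ≤ size
  distinct⇒≤size r dist = Finₚ.injective⇒≤ {f = λ i → index (r i)} λ {i} {j} eq →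
    dist i j (≈-trans (≈-sym (enum-index (r i))) (≈-trans (reflexive (cong enum eq)) (enum-index (r j))))

  -- Polynomial functions

  -- Horner form, indexed by a formal degree and its leading coefficient, which is allowed to be 0#.
  -- The pointwise equations admit every function that agrees extensionally with the polynomial.
  data IsPoly : ℕ → Carrier → (Carrier → Carrier) → Set (c ⊔ ℓ) where
    const  : ∀ {a f} → (∀ x → f x ≈ a) → IsPoly 0 a f
    horner : ∀ {d a f g} → IsPoly d a g → ∀ b → (∀ x → f x ≈ x *ᶠ g x +ᶠ b) → IsPoly (suc d) a f

  poly-resp : ∀ {d a b f} → a ≈ b → IsPoly d a f → IsPoly d b f
  poly-resp a≈b (const eq)      = const λ x → ≈-trans (eq x) a≈b
  poly-resp a≈b (horner g b eq) = horner (poly-resp a≈b g) b eq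

  poly-+ : ∀ {d a b f g} → IsPoly d a f → IsPoly d b g → IsPoly d (a +ᶠ b) (λ x → f x +ᶠ g x)
  poly-+ (const eq) (const eq′) = const λ x → +-cong (eq x) (eq′ x)
  poly-+ (horner {g = f} p a eq) (horner {g = g} q b eq′) = horner (poly-+ p q) (a +ᶠ b) λ x →
    ≈-trans (+-cong (eq x) (eq′ x)) (collect x (f x) (g x) a b)
    where
    collect : ∀ x f g a b → x *ᶠ f +ᶠ a +ᶠ (x *ᶠ g +ᶠ b) ≈ x *ᶠ (f +ᶠ g) +ᶠ (a +ᶠ b)
    collect = solve 5 (λ x f g a b → (x ⊗ f ⊕ a ⊕ (x ⊗ g ⊕ b)) ⊜ (x ⊗ (f ⊕ g) ⊕ (a ⊕ b))) ≈-refl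

  poly-* : ∀ {d a f} k → IsPoly d a f → IsPoly d (k *ᶠ a) (λ x → k *ᶠ f x)
  poly-* k (const eq) = const λ x → *-congˡ (eq x)
  poly-* k (horner {g = g} p b eq) = horner (poly-* k p) (k *ᶠ b) λ x →
    ≈-trans (*-congˡ (eq x)) (collect k x (g x) b)
    where
    collect : ∀ k x g b → k *ᶠ (x *ᶠ g +ᶠ b) ≈ x *ᶠ (k *ᶠ g) +ᶠ k *ᶠ b
    collect = solve 4 (λ k x g b → (k ⊗ (x ⊗ g ⊕ b)) ⊜ (x ⊗ (k ⊗ g) ⊕ k ⊗ b)) ≈-refl

  -- Padding with top coefficients 0# allows `poly-+`, which wants equal formal degrees, to add
  -- polynomials of different degrees.
  poly-raise : ∀ {d a f} → IsPoly d a f → ∀ {e} → d < e → IsPoly e 0# f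
  poly-raise (const {a} eq) {suc zero} z<s =
    horner (const {f = λ _ → 0#} λ x → ≈-refl) a λ x →
      ≈-trans (eq x) (≈-sym (≈-trans (+-congʳ (zeroʳ x)) (+-identityˡ a)))
  poly-raise (const {a} eq) {suc (suc e)} z<s =
    horner (poly-raise (const {f = λ _ → 0#} λ x → ≈-refl) {suc e} z<s) a λ x →
      ≈-trans (eq x) (≈-sym (≈-trans (+-congʳ (zeroʳ x)) (+-identityˡ a)))
  poly-raise (horner p b eq) {suc e} (s≤s d<e) = horner (poly-raise p d<e) b eq

  poly-+-lower : ∀ {d e a b f g} → IsPoly d a f → IsPoly e b g → e < d → IsPoly d a (λ x → f x +ᶠ g x)
  poly-+-lower p q e<d = poly-resp (+-identityʳ _) (poly-+ p (poly-raise q e<d))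

  monomial : ∀ d → IsPoly d 1# (_^ᶠ d)
  monomial zero    = const λ _ → ≈-refl
  monomial (suc d) = horner (monomial d) 0# λ x → ≈-sym (+-identityʳ _)

  -- Synthetic division f(x) - f(r) = (x - r) h(x), with both sides free of subtraction. The
  -- quotient inherits the leading coefficient, as the induction on the number of roots requires.
  poly-divide : ∀ {d a f} → IsPoly (suc d) a f → ∀ r →
    ∃ λ h → IsPoly d a h × (∀ x → f x +ᶠ r *ᶠ h x ≈ x *ᶠ h x +ᶠ f r)
  poly-divide {zero} {a} {f} (horner {g = g} p@(const g≈a) b eq) r = g , p , λ x → begin
    f x +ᶠ r *ᶠ g x                ≈⟨ +-cong (eq x) (*-congˡ (≈-trans (g≈a x) (≈-sym (g≈a r)))) ⟩
    x *ᶠ g x +ᶠ b +ᶠ r *ᶠ g r      ≈⟨ swap (x *ᶠ g x) b (r *ᶠ g r) ⟩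
    x *ᶠ g x +ᶠ (r *ᶠ g r +ᶠ b)    ≈⟨ +-congˡ (eq r) ⟨
    x *ᶠ g x +ᶠ f r                ∎
    where
    open ≈-Reasoning
    swap : ∀ a b c → a +ᶠ b +ᶠ c ≈ a +ᶠ (c +ᶠ b)
    swap = solve 3 (λ a b c → (a ⊕ b ⊕ c) ⊜ (a ⊕ (c ⊕ b))) ≈-refl
  poly-divide {suc d} {a} {f} (horner {g = g} p b eq) r with poly-divide p r
  ... | h , q , div = (λ x → g x +ᶠ r *ᶠ h x) , poly-+-lower p (poly-* r q) (ℕₚ.n<1+n d) , λ x → begin
    f x +ᶠ r *ᶠ (g x +ᶠ r *ᶠ h x)               ≈⟨ +-cong (eq x) (*-congˡ (div x)) ⟩
    x *ᶠ g x +ᶠ b +ᶠ r *ᶠ (x *ᶠ h x +ᶠ g r)     ≈⟨ collect x (g x) b r (h x) (g r) ⟩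
    x *ᶠ (g x +ᶠ r *ᶠ h x) +ᶠ (r *ᶠ g r +ᶠ b)   ≈⟨ +-congˡ (eq r) ⟨
    x *ᶠ (g x +ᶠ r *ᶠ h x) +ᶠ f r               ∎
    where
    open ≈-Reasoning
    collect : ∀ x g b r h k → x *ᶠ g +ᶠ b +ᶠ r *ᶠ (x *ᶠ h +ᶠ k) ≈ x *ᶠ (g +ᶠ r *ᶠ h) +ᶠ (r *ᶠ k +ᶠ b)
    collect = solve 6 (λ x g b r h k →
      (x ⊗ g ⊕ b ⊕ r ⊗ (x ⊗ h ⊕ k)) ⊜ (x ⊗ (g ⊕ r ⊗ h) ⊕ (r ⊗ k ⊕ b))) ≈-refl

  too-many-roots : ∀ {d a f} → IsPoly d a f → ¬ a ≈ 0# →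
    (r : Fin (suc d) → Carrier) → Distinct r → ¬ (∀ i → f (r i) ≈ 0#)
  too-many-roots (const eq) a≉0 r dist roots =
    a≉0 (≈-trans (≈-sym (eq (r Fin.zero))) (roots Fin.zero))
  too-many-roots {suc d} {a} {f} p a≉0 r dist roots with poly-divide p (r Fin.zero)
  ... | h , q , div = too-many-roots q a≉0 (λ i → r (Fin.suc i))
    (λ i j eq → Finₚ.suc-injective (dist (Fin.suc i) (Fin.suc j) eq))
    -- At a second root s the division identity becomes r h(s) = s h(s), where r is the first root;
    -- if h(s) were nonzero, it would cancel and identify the two roots.
    (λ i → decidable-stable (h (r (Fin.suc i)) ≈? 0#) λ h≉0 →
      Finₚ.0≢1+n (dist Fin.zero (Fin.suc i) (*-cancelˡ-nonZero h≉0 (begin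
        h (r (Fin.suc i)) *ᶠ r Fin.zero          ≈⟨ *-comm _ _ ⟩
        r Fin.zero *ᶠ h (r (Fin.suc i))          ≈⟨ +-identityˡ _ ⟨
        0# +ᶠ r Fin.zero *ᶠ h (r (Fin.suc i))    ≈⟨ +-congʳ (roots (Fin.suc i)) ⟨
        f (r (Fin.suc i)) +ᶠ r Fin.zero *ᶠ h (r (Fin.suc i))  ≈⟨ div (r (Fin.suc i)) ⟩
        r (Fin.suc i) *ᶠ h (r (Fin.suc i)) +ᶠ f (r Fin.zero)  ≈⟨ +-congˡ (roots Fin.zero) ⟩
        r (Fin.suc i) *ᶠ h (r (Fin.suc i)) +ᶠ 0#  ≈⟨ +-identityʳ _ ⟩
        r (Fin.suc i) *ᶠ h (r (Fin.suc i))        ≈⟨ *-comm _ _ ⟩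
        h (r (Fin.suc i)) *ᶠ r (Fin.suc i)        ∎))))
    where open ≈-Reasoning

  non-root : ∀ {d a f} → IsPoly d a f → ¬ a ≈ 0# → d < size → ∃ λ x → ¬ f x ≈ 0#
  non-root {d} {a} {f} p a≉0 d<size with Finₚ.any? (λ i → ¬? (f (enum i) ≈? 0#))
  ... | yes (i , fi≉0) = enum i , fi≉0
  ... | no ¬any = contradiction
    (λ i → decidable-stable (f (enum (inject≤ i d<size)) ≈? 0#) λ f≉0 → ¬any (_ , f≉0))
    (too-many-roots p a≉0 (λ i → enum (inject≤ i d<size))
      λ i j eq → Finₚ.inject≤-injective d<size d<size i j (enum-inj _ _ eq))

  -- Multiplicative orders

  ^-zero : ∀ {x k} → 0 < k → x ≈ 0# → x ^ᶠ k ≈ 0#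
  ^-zero {k = suc k} _ x≈0 = ≈-trans (*-congʳ x≈0) (zeroˡ _)

  ^-quotient : ∀ {x j k} → ¬ x ≈ 0# → j ≤ k → x ^ᶠ j ≈ x ^ᶠ k → x ^ᶠ (k ∸ j) ≈ 1#
  ^-quotient {x} {j} {k} x≉0 j≤k eq = ≈-sym (*-cancelˡ-nonZero (^-nonZero x≉0 j) (begin
    x ^ᶠ j *ᶠ 1#             ≈⟨ *-identityʳ _ ⟩
    x ^ᶠ j                   ≈⟨ eq ⟩
    x ^ᶠ k                   ≈⟨ ^-congʳ x (ℕₚ.m+[n∸m]≡n j≤k) ⟨
    x ^ᶠ (j + (k ∸ j))       ≈⟨ ^-homo-* x j (k ∸ j) ⟩
    x ^ᶠ j *ᶠ x ^ᶠ (k ∸ j)   ∎))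
    where open ≈-Reasoning

  record HasOrder (x : Carrier) (e : ℕ) : Set ℓ where
    field
      positive : 0 < e
      ^-order  : x ^ᶠ e ≈ 1#
      order-∣  : ∀ k → x ^ᶠ k ≈ 1# → e ∣ k

    ^-multiple : ∀ {k} → e ∣ k → x ^ᶠ k ≈ 1#
    ^-multiple (divides j refl) = begin
      x ^ᶠ (j * e)      ≈⟨ ^-congʳ x (ℕₚ.*-comm j e) ⟩
      x ^ᶠ (e * j)      ≈⟨ ^-assocʳ x e j ⟨
      (x ^ᶠ e) ^ᶠ j     ≈⟨ ^-congˡ j ^-order ⟩
      1# ^ᶠ j           ≈⟨ 1^ j ⟩
      1#                ∎
      where open ≈-Reasoning

    nonZero : ¬ x ≈ 0#
    nonZero x≈0 = 1≉0 (≈-trans (≈-sym ^-order) (^-zero positive x≈0))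

    ^-injective : ∀ {j k} → j < e → k < e → x ^ᶠ j ≈ x ^ᶠ k → j ≡ k
    ^-injective {j} {k} j<e k<e eq with ℕₚ.<-cmp j k
    ... | tri≈ _ j≡k _ = j≡k
    ... | tri< j<k _ _ = contradiction
      (∣.∣⇒≤ {{>-nonZero (ℕₚ.m<n⇒0<n∸m j<k)}} (order-∣ (k ∸ j) (^-quotient nonZero (ℕₚ.<⇒≤ j<k) eq)))
      (ℕₚ.<⇒≱ (ℕₚ.≤-<-trans (ℕₚ.m∸n≤m k j) k<e))
    ... | tri> _ _ k<j = contradiction
      (∣.∣⇒≤ {{>-nonZero (ℕₚ.m<n⇒0<n∸m k<j)}} (order-∣ (j ∸ k) (^-quotient nonZero (ℕₚ.<⇒≤ k<j) (≈-sym eq))))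
      (ℕₚ.<⇒≱ (ℕₚ.≤-<-trans (ℕₚ.m∸n≤m j k) j<e))

    powers : Fin e → Carrier
    powers i = x ^ᶠ toℕ i

    powers-distinct : Distinct powers
    powers-distinct i j eq = Finₚ.toℕ-injective (^-injective (Finₚ.toℕ<n i) (Finₚ.toℕ<n j) eq)

    order<size : suc e ≤ size
    order<size = distinct⇒≤size (0# Vector.∷ powers)
      (distinct-∷ (λ i eq → ^-nonZero nonZero (toℕ i) (≈-sym eq)) powers-distinct)

  order-exists : ∀ {x} → ¬ x ≈ 0# → ∃ (HasOrder x)
  order-exists {x} x≉0 with Finₚ.pigeonhole (ℕₚ.n<1+n size) (λ i → index (x ^ᶠ toℕ i))
  -- Exponents are searched in the form `suc k`, so that the least one is positive; the coincidence
  -- of two powers supplies a candidate.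
  ... | i , j , i<j , same with least (λ k → (x ^ᶠ suc k) ≈? 1#) (toℕ j ∸ suc (toℕ i)) returns
    where
    x^i≈x^j : x ^ᶠ toℕ i ≈ x ^ᶠ toℕ j
    x^i≈x^j = ≈-trans (≈-sym (enum-index _)) (≈-trans (reflexive (cong enum same)) (enum-index _))
    returns : x ^ᶠ suc (toℕ j ∸ suc (toℕ i)) ≈ 1#
    returns = ≈-trans (^-congʳ x (sym (ℕₚ.+-∸-assoc 1 i<j))) (^-quotient x≉0 (ℕₚ.<⇒≤ i<j) x^i≈x^j)
  ... | m , x^e≈1 , minimal = e , record { positive = z<s ; ^-order = x^e≈1 ; order-∣ = order-∣ }
    where
    open ≈-Reasoning
    e = suc m
    order-∣ : ∀ k → x ^ᶠ k ≈ 1# → e ∣ k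
    order-∣ k x^k≈1 with k % e in k%e≡r
    ... | zero  = ∣.m%n≡0⇒n∣m k e k%e≡r
    ... | suc r = contradiction (begin
      x ^ᶠ suc r                                    ≈⟨ *-identityʳ _ ⟨
      x ^ᶠ suc r *ᶠ 1#                              ≈⟨ *-congˡ (1^ (k / e)) ⟨
      x ^ᶠ suc r *ᶠ 1# ^ᶠ (k / e)                   ≈⟨ *-congˡ (^-congˡ (k / e) x^e≈1) ⟨
      x ^ᶠ suc r *ᶠ (x ^ᶠ e) ^ᶠ (k / e)             ≈⟨ *-congˡ (^-assocʳ x e (k / e)) ⟩
      x ^ᶠ suc r *ᶠ x ^ᶠ (e * (k / e))              ≈⟨ ^-homo-* x (suc r) (e * (k / e)) ⟨
      x ^ᶠ (suc r + e * (k / e))                    ≈⟨ ^-congʳ x k≡ ⟨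
      x ^ᶠ k                                        ≈⟨ x^k≈1 ⟩
      1#                                            ∎)
      (minimal r (ℕₚ.≤-pred (subst (_< e) k%e≡r (m%n<n k e))))
      where
      k≡ : k ≡ suc r + e * (k / e)
      k≡ = trans (m≡m%n+[m/n]*n k e) (cong₂ _+_ k%e≡r (ℕₚ.*-comm (k / e) e))

  order-power : ∀ {x} a b → HasOrder x (a * b) → HasOrder (x ^ᶠ a) b
  order-power {x} a b ord = record
    { positive = ℕₚ.n≢0⇒n>0 λ { refl → ℕₚ.<⇒≢ positive (sym (ℕₚ.*-zeroʳ a)) }
    ; ^-order  = ≈-trans (^-assocʳ x a b) ^-order
    ; order-∣  = λ k eq → ∣.*-cancelˡ-∣ a {{a≢0}} (order-∣ (a * k) (≈-trans (≈-sym (^-assocʳ x a k)) eq))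
    }
    where
    open HasOrder ord
    a≢0 : NonZero a
    a≢0 = ℕₚ.m*n≢0⇒m≢0 a {{>-nonZero positive}}

  order-* : ∀ {x y a b} → Coprime a b → HasOrder x a → HasOrder y b → HasOrder (x *ᶠ y) (a * b)
  order-* {x} {y} {a} {b} coprime ordx ordy = record
    { positive = ℕₚ.*-mono-< X.positive Y.positive
    ; ^-order  = begin
        (x *ᶠ y) ^ᶠ (a * b)               ≈⟨ ^-distrib-* x y (a * b) ⟩
        x ^ᶠ (a * b) *ᶠ y ^ᶠ (a * b)      ≈⟨ *-cong (X.^-multiple (∣.m∣m*n b)) (Y.^-multiple (∣.n∣m*n a)) ⟩
        1# *ᶠ 1#                          ≈⟨ *-identityˡ 1# ⟩
        1#                                ∎
    ; order-∣  = λ k eq → coprime-*∣ coprime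
        (coprime-divisor coprime (X.order-∣ (b * k) (left k eq)))
        (coprime-divisor (Coprimality.sym coprime) (Y.order-∣ (a * k) (right k eq)))
    }
    where
    open ≈-Reasoning
    module X = HasOrder ordx
    module Y = HasOrder ordy
    power : ∀ j k → (x *ᶠ y) ^ᶠ k ≈ 1# → x ^ᶠ (j * k) *ᶠ y ^ᶠ (j * k) ≈ 1#
    power j k eq = begin
      x ^ᶠ (j * k) *ᶠ y ^ᶠ (j * k)  ≈⟨ ^-distrib-* x y (j * k) ⟨
      (x *ᶠ y) ^ᶠ (j * k)           ≈⟨ ^-congʳ (x *ᶠ y) (ℕₚ.*-comm j k) ⟩
      (x *ᶠ y) ^ᶠ (k * j)           ≈⟨ ^-assocʳ (x *ᶠ y) k j ⟨
      ((x *ᶠ y) ^ᶠ k) ^ᶠ j          ≈⟨ ^-congˡ j eq ⟩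
      1# ^ᶠ j                       ≈⟨ 1^ j ⟩
      1#                            ∎
    left : ∀ k → (x *ᶠ y) ^ᶠ k ≈ 1# → x ^ᶠ (b * k) ≈ 1#
    left k eq = begin
      x ^ᶠ (b * k)                  ≈⟨ *-identityʳ _ ⟨
      x ^ᶠ (b * k) *ᶠ 1#            ≈⟨ *-congˡ (Y.^-multiple (∣.m∣m*n k)) ⟨
      x ^ᶠ (b * k) *ᶠ y ^ᶠ (b * k)  ≈⟨ power b k eq ⟩
      1#                            ∎
    right : ∀ k → (x *ᶠ y) ^ᶠ k ≈ 1# → y ^ᶠ (a * k) ≈ 1#
    right k eq = begin
      y ^ᶠ (a * k)                  ≈⟨ *-identityˡ _ ⟨
      1# *ᶠ y ^ᶠ (a * k)            ≈⟨ *-congʳ (X.^-multiple (∣.m∣m*n k)) ⟨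
      x ^ᶠ (a * k) *ᶠ y ^ᶠ (a * k)  ≈⟨ power a k eq ⟩
      1#                            ∎

  -- The order d of x does not divide e, so some prime p occurs in d to a higher power than in e =
  -- pⁱ e′. A power of x of order pⁱ⁺¹ times the power g^(pⁱ), of order e′ prime to p, has order p
  -- e.
  larger-order : ∀ {g e x} → HasOrder g e → ¬ x ≈ 0# → ¬ x ^ᶠ e ≈ 1# → ∃ λ g′ → ∃ λ e′ → HasOrder g′ e′ × e < e′
  larger-order {g} {e} {x} ordg x≉0 x^e≉1 with order-exists x≉0
  ... | d , ordx with ∤⇒prime-power d e {{>-nonZero (HasOrder.positive ordx)}} {{>-nonZero (HasOrder.positive ordg)}}
                        (λ d∣e → x^e≉1 (HasOrder.^-multiple ordx d∣e))
  ... | p , i , e′ , pr , refl , p∤e′ , divides k refl =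
    x ^ᶠ k *ᶠ g ^ᶠ (p ^ i) , p ^ suc i * e′ ,
    order-* (coprime-^ˡ pr p∤e′ (suc i)) (order-power k (p ^ suc i) ordx) (order-power (p ^ i) e′ ordg) ,
    subst (p ^ i * e′ <_) (trans (ℕₚ.*-comm (p ^ i * e′) p) (sym (ℕₚ.*-assoc p (p ^ i) e′)))
      (ℕₚ.m<m*n (p ^ i * e′) p {{>-nonZero (HasOrder.positive ordg)}} (prime>1 pr))

  all-roots? : ∀ e → (∀ x → ¬ x ≈ 0# → x ^ᶠ e ≈ 1#) ⊎ (∃ λ x → ¬ x ≈ 0# × ¬ x ^ᶠ e ≈ 1#)
  all-roots? e with Finₚ.any? (λ i → ¬? (enum i ≈? 0#) ×-dec ¬? ((enum i ^ᶠ e) ≈? 1#))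
  ... | yes (i , escapes) = inj₂ (enum i , escapes)
  ... | no ¬any = inj₁ λ x x≉0 → decidable-stable ((x ^ᶠ e) ≈? 1#) λ x^e≉1 → ¬any (index x ,
    (λ ≈0 → x≉0 (≈-trans (≈-sym (enum-index x)) ≈0)) ,
    (λ ≈1 → x^e≉1 (≈-trans (^-congˡ e (≈-sym (enum-index x))) ≈1)))

  UniversalOrder : Set (c ⊔ ℓ)
  UniversalOrder = ∃ λ g → ∃ λ e → HasOrder g e × (∀ x → ¬ x ≈ 0# → x ^ᶠ e ≈ 1#)

  -- Every order is smaller than `size`, so the fuel bounds the number of strict increases still
  -- possible.
  Climb : ℕ → Set (c ⊔ ℓ)
  Climb fuel = ∀ g e → HasOrder g e → size ≤ e + fuel → UniversalOrder

  climb-step : ∀ {fuel} → Climb fuel → Climb (suc fuel)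
  climb-step {fuel} climb g e ord size≤ = continue (all-roots? e)
    where
    restart : (∃ λ g′ → ∃ λ e′ → HasOrder g′ e′ × e < e′) → UniversalOrder
    restart (g′ , e′ , ord′ , e<e′) = climb g′ e′ ord′
      (ℕₚ.≤-trans size≤ (subst (_≤ e′ + fuel) (sym (ℕₚ.+-suc e fuel)) (ℕₚ.+-monoˡ-≤ fuel e<e′)))
    continue : (∀ x → ¬ x ≈ 0# → x ^ᶠ e ≈ 1#) ⊎ (∃ λ x → ¬ x ≈ 0# × ¬ x ^ᶠ e ≈ 1#) → UniversalOrder
    continue (inj₁ all)               = g , e , ord , all
    continue (inj₂ (x , x≉0 , x^e≉1)) = restart (larger-order ord x≉0 x^e≉1)

  climb : ∀ fuel → Climb fuel
  climb zero g e ord size≤e = contradiction (HasOrder.order<size ord)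
    (ℕₚ.≤⇒≯ (subst (size ≤_) (ℕₚ.+-identityʳ e) size≤e))
  climb (suc fuel) = climb-step (climb fuel)

  universal-order : UniversalOrder
  universal-order = climb size 1# 1
    (record { positive = z<s ; ^-order = *-identityˡ 1# ; order-∣ = λ k _ → ∣.1∣ k }) (ℕₚ.m≤n+m size 1)

  -- The order e of `universal-order` is at most N because 0# and the powers of g are distinct, and
  -- at least N because a monic polynomial of degree e + 1 < `size` cannot vanish on the whole
  -- field.
  primitive-root : ∀ {N} → size ≡ suc N → ∃ λ g → HasOrder g N
  primitive-root {N} size≡ with universal-order
  ... | g , e , ord , all = g , subst (HasOrder g) (ℕₚ.≤-antisym e≤N N≤e) ord
    where
    e≤N : e ≤ N
    e≤N = ℕₚ.≤-pred (subst (suc e ≤_) size≡ (HasOrder.order<size ord))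
    -- X^{e+1} - X vanishes identically.
    vanishing : IsPoly (suc e) 1# (λ x → x ^ᶠ suc e +ᶠ -ᶠ 1# *ᶠ x ^ᶠ 1)
    vanishing = poly-+-lower (monomial (suc e)) (poly-* (-ᶠ 1#) (monomial 1)) (s≤s (HasOrder.positive ord))
    ^-suc-order : ∀ x → x ^ᶠ suc e ≈ x
    ^-suc-order x with x ≈? 0#
    ... | yes x≈0 = ≈-trans (^-zero {k = suc e} z<s x≈0) (≈-sym x≈0)
    ... | no  x≉0 = ≈-trans (*-congˡ (all x x≉0)) (*-identityʳ x)
    root : ∀ x → x ^ᶠ suc e +ᶠ -ᶠ 1# *ᶠ x ^ᶠ 1 ≈ 0#
    root x = begin
      x ^ᶠ suc e +ᶠ -ᶠ 1# *ᶠ x ^ᶠ 1   ≈⟨ +-cong (^-suc-order x) (*-congˡ (*-identityʳ x)) ⟩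
      x +ᶠ -ᶠ 1# *ᶠ x                 ≈⟨ +-congʳ (*-identityˡ x) ⟨
      1# *ᶠ x +ᶠ -ᶠ 1# *ᶠ x           ≈⟨ distribʳ x 1# (-ᶠ 1#) ⟨
      (1# +ᶠ -ᶠ 1#) *ᶠ x              ≈⟨ *-congʳ (-‿inverseʳ 1#) ⟩
      0# *ᶠ x                         ≈⟨ zeroˡ x ⟩
      0#                              ∎
      where open ≈-Reasoning
    N≤e : N ≤ e
    N≤e with ℕₚ.≤-<-connex N e
    ... | inj₁ N≤e = N≤e
    ... | inj₂ e<N with non-root vanishing 1≉0 (subst (suc e <_) (sym size≡) (s≤s e<N))
    ...   | x , x≉ = contradiction (root x) x≉

  -- Otherwise 0#, x and the N powers of g would be N + 2 distinct elements.
  discrete-log : ∀ {g N} → size ≡ suc N → HasOrder g N → ∀ x → ¬ x ≈ 0# → ∃ λ k → k < N × x ≈ g ^ᶠ k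
  discrete-log {g} {N} size≡ ord x x≉0 with Finₚ.any? (λ i → x ≈? HasOrder.powers ord i)
  ... | yes (i , x≈g^i) = toℕ i , Finₚ.toℕ<n i , x≈g^i
  ... | no ¬any = contradiction
    (distinct⇒≤size (0# Vector.∷ (x Vector.∷ powers)) (distinct-∷ 0≉ (distinct-∷ (λ i x≈ → ¬any (i , x≈)) powers-distinct)))
    (ℕₚ.<⇒≱ (subst (_< suc (suc N)) (sym size≡) (ℕₚ.n<1+n (suc N))))
    where
    open HasOrder ord
    0≉ : ∀ i → ¬ 0# ≈ (x Vector.∷ powers) i
    0≉ Fin.zero    eq = x≉0 (≈-sym eq)
    0≉ (Fin.suc i) eq = ^-nonZero nonZero (toℕ i) (≈-sym eq)

  -- Sums over the field

  module SumOver {a b} (M : CommutativeMonoid a b) where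
    private module M = CommutativeMonoid M
    open Algebra.Properties.CommutativeMonoid.Sum M public

    sum-enumeration : ∀ {n} (r : Fin n → Carrier) → Distinct r → (∀ x → ∃ λ i → r i ≈ x) →
      (h : Carrier → M.Carrier) → (∀ {x y} → x ≈ y → h x M.≈ h y) → sum (λ i → h (r i)) M.≈ sum (λ i → h (enum i))
    sum-enumeration r dist surj h resp =
      M.sym (M.trans (sum-permute (λ i → h (enum i)) π) (sum-cong-≋ λ i → resp (enum-index (r i))))
      where
      π : Permutation _ size
      π = permutation (λ i → index (r i)) (λ j → proj₁ (surj (enum j)))
        (λ j → enum-inj _ _ (≈-trans (enum-index _) (proj₂ (surj (enum j)))))
        (λ i → dist _ _ (≈-trans (proj₂ (surj (enum (index (r i))))) (enum-index (r i))))

    sum-translate : ∀ u (h : Carrier → M.Carrier) → (∀ {x y} → x ≈ y → h x M.≈ h y) →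
      sum (λ i → h (u +ᶠ enum i)) M.≈ sum (λ i → h (enum i))
    sum-translate u = sum-enumeration (λ i → u +ᶠ enum i)
      (λ i j eq → enum-inj i j (+-cancelˡ u _ _ eq))
      (λ x → index (-ᶠ u +ᶠ x) , ≈-trans (+-congˡ (enum-index _))
        (≈-trans (≈-sym (+-assoc u (-ᶠ u) x)) (≈-trans (+-congʳ (-‿inverseʳ u)) (+-identityˡ x))))

  module ℤSumOver = SumOver ℤₚ.+-0-commutativeMonoid

  sum-log : ∀ {g N} → size ≡ suc N → HasOrder g N → (h : Carrier → ℤ) → (∀ {x y} → x ≈ y → h x ≡ h y) →
    ℤ-Sum.sum (λ i → h (enum i)) ≡ h 0# +ᶻ (∑[ k < N ] h (g ^ᶠ k))
  sum-log {g} {N} size≡ ord h resp = sym (trans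
    (cong (h 0# +ᶻ_) (sym (sum-toℕ N (λ k → h (g ^ᶠ k)))))
    (ℤSumOver.sum-enumeration (0# Vector.∷ powers)
      (distinct-∷ (λ i eq → ^-nonZero nonZero (toℕ i) (≈-sym eq)) powers-distinct) surj h resp))
    where
    open HasOrder ord
    surj : ∀ x → ∃ λ i → (0# Vector.∷ powers) i ≈ x
    surj x with x ≈? 0#
    ... | yes x≈0 = Fin.zero , ≈-sym x≈0
    ... | no  x≉0 = let k , k<N , x≈g^k = discrete-log size≡ ord x x≉0 in Fin.suc (fromℕ< k<N) ,
      ≈-trans (^-congʳ g (Finₚ.toℕ-fromℕ< k<N)) (≈-sym x≈g^k)

  -- Characteristic and Frobenius

  -- Translation by 1# permutes the field, so adding 1# to every element leaves the total unchanged.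
  size·1≈0 : size · 1# ≈ 0#
  size·1≈0 = ≈-sym (+-cancelˡ (sum enum) _ _ (begin
    sum enum +ᶠ 0#                        ≈⟨ +-identityʳ _ ⟩
    sum enum                              ≈⟨ sum-translate 1# (λ x → x) (λ eq → eq) ⟨
    sum (λ i → 1# +ᶠ enum i)              ≈⟨ ∑-distrib-+ (λ _ → 1#) enum ⟩
    sum {size} (λ _ → 1#) +ᶠ sum enum     ≈⟨ +-congʳ (sum-replicate size) ⟩
    size · 1# +ᶠ sum enum                 ≈⟨ +-comm _ _ ⟩
    sum enum +ᶠ size · 1#                 ∎))
    where
    open ≈-Reasoning
    open SumOver +-commutativeMonoid

  ^·1 : ∀ p k → (p ^ k) · 1# ≈ (p · 1#) ^ᶠ k
  ^·1 p zero    = +-identityʳ 1#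
  ^·1 p (suc k) = ≈-trans (×1-homo-* p (p ^ k)) (*-congˡ (^·1 p k))

  -- The k-th power of p · 1# is `size` · 1#, which vanishes, and a field has no nilpotents.
  characteristic : ∀ {p} k → size ≡ p ^ k → p · 1# ≈ 0#
  characteristic {p} k size≡ = decidable-stable ((p · 1#) ≈? 0#) λ p≉0 →
    ^-nonZero p≉0 k (≈-trans (≈-sym (^·1 p k)) (≈-trans (reflexive (cong (_· 1#) (sym size≡))) size·1≈0))

  Additive : ℕ → Set (c ⊔ ℓ)
  Additive e = ∀ x y → (x +ᶠ y) ^ᶠ e ≈ x ^ᶠ e +ᶠ y ^ᶠ e

  multiple·≈0 : ∀ {p m} → p · 1# ≈ 0# → p ∣ m → ∀ x → m · x ≈ 0#
  multiple·≈0 {p} p≈0 (divides k refl) x = begin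
    (k * p) · x            ≈⟨ reflexive (cong (_· x) (ℕₚ.*-comm k p)) ⟩
    (p * k) · x            ≈⟨ ×-assocˡ x p k ⟨
    p · (k · x)            ≈⟨ ×-congʳ p (*-identityˡ (k · x)) ⟨
    p · (1# *ᶠ (k · x))    ≈⟨ ×-assoc-* p 1# (k · x) ⟨
    (p · 1#) *ᶠ (k · x)    ≈⟨ *-congʳ p≈0 ⟩
    0# *ᶠ (k · x)          ≈⟨ zeroˡ _ ⟩
    0#                     ∎
    where open ≈-Reasoning

  frobenius : ∀ {p} → Prime p → p · 1# ≈ 0# → Additive p
  frobenius {zero}  pr p≈0 x y = contradiction (prime>1 pr) λ ()
  frobenius {suc p} pr p≈0 x y = begin
    (x +ᶠ y) ^ᶠ suc p
      ≈⟨ theorem (suc p) x y ⟩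
    term Fin.zero +ᶠ sum (λ i → term (Fin.suc i))
      ≈⟨ +-cong first (sum-init-last (λ i → term (Fin.suc i))) ⟩
    y ^ᶠ suc p +ᶠ (sum (λ i → term (Fin.suc (Fin.inject₁ i))) +ᶠ term (Fin.suc (Fin.fromℕ p)))
      ≈⟨ +-congˡ (+-cong (≈-trans (sum-cong-≋ middle) (sum-replicate-zero p)) last) ⟩
    y ^ᶠ suc p +ᶠ (0# +ᶠ x ^ᶠ suc p)
      ≈⟨ +-congˡ (+-identityˡ _) ⟩
    y ^ᶠ suc p +ᶠ x ^ᶠ suc p
      ≈⟨ +-comm _ _ ⟩
    x ^ᶠ suc p +ᶠ y ^ᶠ suc p ∎
    where
    open ≈-Reasoning
    open Algebra.Properties.CommutativeSemiring.Binomial commutativeSemiring using (theorem; binomialTerm)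
    open SumOver +-commutativeMonoid
    term : Fin (suc (suc p)) → Carrier
    term = binomialTerm x y (suc p)
    1·_ : ∀ z → 1 · z ≈ z
    1·_ z = +-identityʳ z
    first : term Fin.zero ≈ y ^ᶠ suc p
    first = ≈-trans (1· _) (*-identityˡ _)
    last : term (Fin.suc (Fin.fromℕ p)) ≈ x ^ᶠ suc p
    last = begin
      (suc p choose suc (toℕ (Fin.fromℕ p))) · (x ^ᶠ suc (toℕ (Fin.fromℕ p)) *ᶠ y ^ᶠ (p ∸ toℕ (Fin.fromℕ p)))
        ≈⟨ reflexive (cong (λ k → (suc p choose suc k) · (x ^ᶠ suc k *ᶠ y ^ᶠ (p ∸ k))) (Finₚ.toℕ-fromℕ p)) ⟩
      (suc p choose suc p) · (x ^ᶠ suc p *ᶠ y ^ᶠ (p ∸ p))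
        ≈⟨ reflexive (cong₂ (λ j k → j · (x ^ᶠ suc p *ᶠ y ^ᶠ k)) (nCn≡1 (suc p)) (ℕₚ.n∸n≡0 p)) ⟩
      1 · (x ^ᶠ suc p *ᶠ 1#)
        ≈⟨ ≈-trans (1· _) (*-identityʳ _) ⟩
      x ^ᶠ suc p ∎
    middle : ∀ i → term (Fin.suc (Fin.inject₁ i)) ≈ 0#
    middle i = multiple·≈0 p≈0 (prime∣C pr z<s
      (s≤s (subst (_< p) (sym (Finₚ.toℕ-inject₁ i)) (Finₚ.toℕ<n i)))) _

  additive-* : ∀ {d e} → Additive d → Additive e → Additive (d * e)
  additive-* {d} {e} addd adde x y = begin
    (x +ᶠ y) ^ᶠ (d * e)             ≈⟨ ^-assocʳ (x +ᶠ y) d e ⟨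
    ((x +ᶠ y) ^ᶠ d) ^ᶠ e            ≈⟨ ^-congˡ e (addd x y) ⟩
    (x ^ᶠ d +ᶠ y ^ᶠ d) ^ᶠ e         ≈⟨ adde (x ^ᶠ d) (y ^ᶠ d) ⟩
    (x ^ᶠ d) ^ᶠ e +ᶠ (y ^ᶠ d) ^ᶠ e  ≈⟨ +-cong (^-assocʳ x d e) (^-assocʳ y d e) ⟩
    x ^ᶠ (d * e) +ᶠ y ^ᶠ (d * e)    ∎
    where open ≈-Reasoning

  additive-^ : ∀ {e} → Additive e → ∀ i → Additive (e ^ i)
  additive-^ add zero    x y = ≈-trans (*-identityʳ _) (+-cong (≈-sym (*-identityʳ x)) (≈-sym (*-identityʳ y)))
  additive-^ {e} add (suc i) = additive-* {e} {e ^ i} add (additive-^ add i)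

  -- The trace form

  Tr-cong : ∀ q i {x y} → x ≈ y → Tr F q i x ≈ Tr F q i y
  Tr-cong q zero    x≈y = ≈-refl
  Tr-cong q (suc i) x≈y = +-cong (^-congˡ (q ^ i) x≈y) (Tr-cong q i x≈y)

  Tr-+ : ∀ {q} → Additive q → ∀ i x y → Tr F q i (x +ᶠ y) ≈ Tr F q i x +ᶠ Tr F q i y
  Tr-+ add zero    x y = ≈-sym (+-identityˡ 0#)
  Tr-+ {q} add (suc i) x y = ≈-trans (+-cong (additive-^ {q} add i x y) (Tr-+ add i x y)) (swap _ _ _ _)
    where
    swap : ∀ a b c d → (a +ᶠ b) +ᶠ (c +ᶠ d) ≈ (a +ᶠ c) +ᶠ (b +ᶠ d)
    swap = solve 4 (λ a b c d → ((a ⊕ b) ⊕ (c ⊕ d)) ⊜ ((a ⊕ c) ⊕ (b ⊕ d))) ≈-refl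

  Tr-scale : ∀ {q s} → s ^ᶠ q ≈ s → ∀ i x → Tr F q i (s *ᶠ x) ≈ s *ᶠ Tr F q i x
  Tr-scale fixed zero    x = ≈-sym (zeroʳ _)
  Tr-scale {q} {s} fixed (suc i) x = begin
    (s *ᶠ x) ^ᶠ (q ^ i) +ᶠ Tr F q i (s *ᶠ x)        ≈⟨ +-cong (^-distrib-* s x (q ^ i)) (Tr-scale fixed i x) ⟩
    s ^ᶠ (q ^ i) *ᶠ x ^ᶠ (q ^ i) +ᶠ s *ᶠ Tr F q i x  ≈⟨ +-congʳ (*-congʳ (iterate i)) ⟩
    s *ᶠ x ^ᶠ (q ^ i) +ᶠ s *ᶠ Tr F q i x            ≈⟨ distribˡ s _ _ ⟨
    s *ᶠ (x ^ᶠ (q ^ i) +ᶠ Tr F q i x)               ∎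
    where
    open ≈-Reasoning
    iterate : ∀ i → s ^ᶠ (q ^ i) ≈ s
    iterate zero    = *-identityʳ s
    iterate (suc i) = ≈-trans (≈-sym (^-assocʳ s q (q ^ i))) (≈-trans (^-congˡ (q ^ i) fixed) (iterate i))

  -- Raising a partial trace to the power q moves each term to the next, so the difference
  -- telescopes. For i = n the two end terms coincide and the trace is seen to lie in F_q.
  Tr-frobenius : ∀ {q} → 0 < q → Additive q → ∀ i x →
    Tr F q i x ^ᶠ q +ᶠ x ≈ x ^ᶠ (q ^ i) +ᶠ Tr F q i x
  Tr-frobenius {q} 0<q add zero x = begin
    0# ^ᶠ q +ᶠ x        ≈⟨ +-congʳ (^-zero 0<q ≈-refl) ⟩
    0# +ᶠ x             ≈⟨ +-comm 0# x ⟩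
    x +ᶠ 0#             ≈⟨ +-congʳ (*-identityʳ x) ⟨
    x ^ᶠ 1 +ᶠ 0#        ∎
    where open ≈-Reasoning
  Tr-frobenius {q} 0<q add (suc i) x = begin
    (x ^ᶠ (q ^ i) +ᶠ T) ^ᶠ q +ᶠ x           ≈⟨ +-congʳ (add (x ^ᶠ (q ^ i)) T) ⟩
    (x ^ᶠ (q ^ i)) ^ᶠ q +ᶠ T ^ᶠ q +ᶠ x      ≈⟨ +-assoc _ _ _ ⟩
    (x ^ᶠ (q ^ i)) ^ᶠ q +ᶠ (T ^ᶠ q +ᶠ x)
      ≈⟨ +-cong (≈-trans (^-assocʳ x (q ^ i) q) (^-congʳ x (ℕₚ.*-comm (q ^ i) q))) (Tr-frobenius 0<q add i x) ⟩
    x ^ᶠ (q ^ suc i) +ᶠ (x ^ᶠ (q ^ i) +ᶠ T) ∎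
    where
    open ≈-Reasoning
    T = Tr F q i x

  -- The highest power of x occurs only once, so the polynomial is monic. At i = n - 1 its degree is
  -- below qⁿ, which prevents the trace from vanishing identically.
  Tr-poly : ∀ {q} → 1 < q → ∀ i → IsPoly (q ^ i) 1# (Tr F q (suc i))
  Tr-poly {q} 1<q zero    = poly-+-lower (monomial 1) (const λ _ → ≈-refl) z<s
  Tr-poly {q} 1<q (suc i) = poly-+-lower (monomial (q ^ suc i)) (Tr-poly 1<q i) (ℕₚ.^-monoʳ-< q 1<q (ℕₚ.n<1+n i))

  -- The parameters r = q - 1, l = n - 1 and N = qⁿ - 1 replace truncated subtractions.
  module TraceForm (r l N Q : ℕ) (r>0 : 0 < r) (additive : Additive (suc r)) (size≡ : size ≡ suc N)
    (1+N≡ : suc N ≡ suc r ^ suc l) (N≡r*Q : N ≡ r * Q) (g : Carrier) (ord : HasOrder g N) where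

    open HasOrder ord

    q n : ℕ
    q = suc r
    n = suc l

    tr : Carrier → Carrier
    tr = Tr F q n

    tr-cong : ∀ {x y} → x ≈ y → tr x ≈ tr y
    tr-cong = Tr-cong q n

    instance
      r≢0 : NonZero r
      r≢0 = >-nonZero r>0
      Q≢0 : NonZero Q
      Q≢0 = ℕₚ.m*n≢0⇒n≢0 r {{>-nonZero (subst (0 <_) N≡r*Q positive)}}

    ^N≈1 : ∀ x → ¬ x ≈ 0# → x ^ᶠ N ≈ 1#
    ^N≈1 x x≉0 = let k , _ , x≈g^k = discrete-log size≡ ord x x≉0 in
      ≈-trans (^-congˡ N x≈g^k) (≈-trans (^-assocʳ g k N) (^-multiple (∣.n∣m*n k)))

    ^qⁿ≈id : ∀ x → x ^ᶠ (q ^ n) ≈ x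
    ^qⁿ≈id x with x ≈? 0#
    ... | yes x≈0 = ≈-trans (^-zero (subst (0 <_) 1+N≡ z<s) x≈0) (≈-sym x≈0)
    ... | no  x≉0 = ≈-trans (^-congʳ x (sym 1+N≡)) (≈-trans (*-congˡ (^N≈1 x x≉0)) (*-identityʳ x))

    tr-fixed : ∀ x → tr x ^ᶠ q ≈ tr x
    tr-fixed x = +-cancelˡ x _ _ (begin
      x +ᶠ tr x ^ᶠ q         ≈⟨ +-comm _ _ ⟩
      tr x ^ᶠ q +ᶠ x         ≈⟨ Tr-frobenius z<s additive n x ⟩
      x ^ᶠ (q ^ n) +ᶠ tr x   ≈⟨ +-congʳ (^qⁿ≈id x) ⟩
      x +ᶠ tr x              ∎)
      where open ≈-Reasoning

    tr-0 : tr 0# ≈ 0#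
    tr-0 = ≈-sym (+-cancelˡ (tr 0#) _ _
      (≈-trans (+-identityʳ _) (≈-trans (tr-cong (≈-sym (+-identityˡ 0#))) (Tr-+ additive n 0# 0#))))

    tr-neg : ∀ x → tr (-ᶠ x) ≈ -ᶠ tr x
    tr-neg x = -‿unique (tr x) (tr (-ᶠ x))
      (≈-trans (≈-sym (Tr-+ additive n x (-ᶠ x))) (≈-trans (tr-cong (-‿inverseʳ x)) tr-0))

    tr-nonzero : ∃ λ u → ¬ tr u ≈ 0#
    tr-nonzero = non-root (Tr-poly (s≤s r>0) l) 1≉0
      (subst (q ^ l <_) (trans (sym 1+N≡) (sym size≡)) (ℕₚ.^-monoʳ-< q (s≤s r>0) (ℕₚ.n<1+n l)))

    -- The nonzero elements of the subfield of q elements are the scalar j, j < q - 1.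
    scalar : ℕ → Carrier
    scalar j = g ^ᶠ (j * Q)

    scalar≉0 : ∀ j → ¬ scalar j ≈ 0#
    scalar≉0 j = ^-nonZero nonZero (j * Q)

    scalar-fixed : ∀ j → scalar j ^ᶠ q ≈ scalar j
    scalar-fixed j = ≈-trans (*-congˡ (≈-trans (^-assocʳ g (j * Q) r) (^-multiple (divides j multiple)))) (*-identityʳ _)
      where
      multiple : j * Q * r ≡ j * N
      multiple = trans (ℕₚ.*-assoc j Q r) (cong (j *_) (trans (ℕₚ.*-comm Q r) (sym N≡r*Q)))

    -- From x^q = x follows x^r = 1, so for x = gᵏ the order N = r Q divides r k, and Q divides k.
    fixed⇒scalar : ∀ x → ¬ x ≈ 0# → x ^ᶠ q ≈ x → ∃ λ j → j < r × x ≈ scalar j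
    fixed⇒scalar x x≉0 fixed = scalar-of (discrete-log size≡ ord x x≉0)
      where
      scalar-of : (∃ λ k → k < N × x ≈ g ^ᶠ k) → ∃ λ j → j < r × x ≈ scalar j
      scalar-of (k , k<N , x≈g^k) with ∣.*-cancelˡ-∣ r (subst (_∣ r * k) N≡r*Q (order-∣ (r * k) g^rk≈1))
        where
        x^r≈1 : x ^ᶠ r ≈ 1#
        x^r≈1 = *-cancelˡ-nonZero x≉0 (≈-trans fixed (≈-sym (*-identityʳ x)))
        g^rk≈1 : g ^ᶠ (r * k) ≈ 1#
        g^rk≈1 = ≈-trans (^-congʳ g (ℕₚ.*-comm r k))
          (≈-trans (≈-sym (^-assocʳ g k r)) (≈-trans (^-congˡ r (≈-sym x≈g^k)) x^r≈1))
      ... | divides j refl = j , ℕₚ.*-cancelʳ-< Q j r (subst (j * Q <_) N≡r*Q k<N) , x≈g^k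

    scalar-injective : ∀ {i j} → i < r → j < r → scalar i ≈ scalar j → i ≡ j
    scalar-injective {i} {j} i<r j<r eq = ℕₚ.*-cancelʳ-≡ i j Q (^-injective (bound i<r) (bound j<r) eq)
      where
      bound : ∀ {i} → i < r → i * Q < N
      bound i<r = subst (_ <_) (sym N≡r*Q) (ℕₚ.*-monoˡ-< Q i<r)

    tr-scalar : ∀ j x → tr (scalar j *ᶠ x) ≈ scalar j *ᶠ tr x
    tr-scalar j = Tr-scale (scalar-fixed j) n

    tr-difference : ∀ b s a → s ^ᶠ q ≈ s → tr (b -ᶠ s *ᶠ a) ≈ tr b -ᶠ s *ᶠ tr a
    tr-difference b s a fixed = ≈-trans (Tr-+ additive n b (-ᶠ (s *ᶠ a)))
      (+-congˡ (≈-trans (tr-neg (s *ᶠ a)) (-‿cong (Tr-scale fixed n a))))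

    -- K = Σ_{s ∈ F_q*} ψ(s ·) for a nontrivial additive character ψ.
    K : Carrier → ℤ
    K x = + q *ᶻ ι (tr x ≈? 0#) -ᶻ 1ℤ

    K-cong-tr : ∀ {x y} → (tr x ≈ 0# → tr y ≈ 0#) → (tr y ≈ 0# → tr x ≈ 0#) → K x ≡ K y
    K-cong-tr {x} {y} to from = cong (λ z → + q *ᶻ z -ᶻ 1ℤ) (ι-cong to from (tr x ≈? 0#) (tr y ≈? 0#))

    K-cong : ∀ {x y} → x ≈ y → K x ≡ K y
    K-cong x≈y = K-cong-tr (≈-trans (tr-cong (≈-sym x≈y))) (≈-trans (tr-cong x≈y))

    K-zero : ∀ {x} → tr x ≈ 0# → K x ≡ + r
    K-zero {x} tr≈0 = trans (cong (λ z → + q *ᶻ z -ᶻ 1ℤ) (ι-yes (tr x ≈? 0#) tr≈0))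
      (cong (_-ᶻ 1ℤ) (ℤₚ.*-identityʳ (+ q)))

    K-nonzero : ∀ {x} → ¬ tr x ≈ 0# → K x ≡ -ᶻ 1ℤ
    K-nonzero {x} tr≉0 = trans (cong (λ z → + q *ᶻ z -ᶻ 1ℤ) (ι-no (tr x ≈? 0#) tr≉0))
      (cong (_-ᶻ 1ℤ) (ℤₚ.*-zeroʳ (+ q)))

    K-scalar : ∀ j x → K (scalar j *ᶠ x) ≡ K x
    K-scalar j x = K-cong-tr
      (λ eq → decidable-stable (tr x ≈? 0#) λ tr≉0 →
        *-nonZero (scalar≉0 j) tr≉0 (≈-trans (≈-sym (tr-scalar j x)) eq))
      (λ eq → ≈-trans (tr-scalar j x) (≈-trans (*-congˡ eq) (zeroʳ _)))

    private
      K-differences : ∀ a b {c} → ∑[ j < r ] ι (tr (b -ᶠ scalar j *ᶠ a) ≈? 0#) ≡ c →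
        ∑[ j < r ] K (b -ᶠ scalar j *ᶠ a) ≡ + q *ᶻ c -ᶻ + r
      K-differences a b {c} eq = begin
        ∑[ j < r ] (+ q *ᶻ χ j -ᶻ 1ℤ)                   ≡⟨ sum-+ r (λ j → + q *ᶻ χ j) (λ _ → -ᶻ 1ℤ) ⟩
        (∑[ j < r ] + q *ᶻ χ j) +ᶻ (∑[ j < r ] -ᶻ 1ℤ)    ≡⟨ cong₂ _+ᶻ_ (sum-*ˡ r (+ q) χ) (sum-const r (-ᶻ 1ℤ)) ⟩
        + q *ᶻ sumTo r χ +ᶻ + r *ᶻ -ᶻ 1ℤ                 ≡⟨ cong₂ (λ x y → + q *ᶻ x +ᶻ y) eq (-1* (+ r)) ⟩
        + q *ᶻ c -ᶻ + r                                  ∎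
        where
        open ≡-Reasoning
        χ : ℕ → ℤ
        χ j = ι (tr (b -ᶠ scalar j *ᶠ a) ≈? 0#)
        -1* : ∀ x → x *ᶻ -ᶻ 1ℤ ≡ -ᶻ x
        -1* = ℤ-Solver.solve-∀

    -- In terms of ψ the product is Σ ψ(s a + t b) over s, t in F_q*, and the substitution s = -t u
    -- turns it into Σ K(b - u a) over u. The proof merely counts the u in F_q* with Tr b = u Tr a:
    -- all if both traces vanish, none if exactly one does, and a single one otherwise.
    K-product : ∀ a b → K a *ᶻ K b ≡ ∑[ j < r ] K (b -ᶠ scalar j *ᶠ a)
    K-product a b = by-cases (tr a ≈? 0#) (tr b ≈? 0#)
      where
      open ≡-Reasoning
      same : ∀ j → tr (b -ᶠ scalar j *ᶠ a) ≈ tr b -ᶠ scalar j *ᶠ tr a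
      same j = tr-difference b (scalar j) a (scalar-fixed j)
      vanish⇒ : ∀ j → tr (b -ᶠ scalar j *ᶠ a) ≈ 0# → tr b ≈ scalar j *ᶠ tr a
      vanish⇒ j eq = x-y≈0⇒x≈y _ _ (≈-trans (≈-sym (same j)) eq)
      ⇒vanish : ∀ j → tr b ≈ scalar j *ᶠ tr a → tr (b -ᶠ scalar j *ᶠ a) ≈ 0#
      ⇒vanish j eq = ≈-trans (same j) (x≈y⇒x-y≈0 eq)
      by-cases : Dec (tr a ≈ 0#) → Dec (tr b ≈ 0#) → K a *ᶻ K b ≡ ∑[ j < r ] K (b -ᶠ scalar j *ᶠ a)
      by-cases (yes a≈0) _ = begin
        K a *ᶻ K b                          ≡⟨ cong (_*ᶻ K b) (K-zero a≈0) ⟩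
        + r *ᶻ K b                          ≡⟨ sum-const r (K b) ⟨
        ∑[ j < r ] K b                      ≡⟨ sum-cong r (λ j → K-cong-tr
          (λ b≈0 → ⇒vanish j (≈-trans b≈0 (≈-sym (s*a≈0 j)))) (λ eq → ≈-trans (vanish⇒ j eq) (s*a≈0 j))) ⟩
        ∑[ j < r ] K (b -ᶠ scalar j *ᶠ a)   ∎
        where
        s*a≈0 : ∀ j → scalar j *ᶠ tr a ≈ 0#
        s*a≈0 j = ≈-trans (*-congˡ a≈0) (zeroʳ _)
      by-cases (no a≉0) (yes b≈0) = begin
        K a *ᶻ K b                          ≡⟨ cong₂ _*ᶻ_ (K-nonzero a≉0) (K-zero b≈0) ⟩
        -ᶻ 1ℤ *ᶻ + r                        ≡⟨ ring₁ (+ q) (+ r) ⟩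
        + q *ᶻ 0ℤ -ᶻ + r                    ≡⟨ K-differences a b (sum-0 r λ j _ → ι-no (tr (b -ᶠ scalar j *ᶠ a) ≈? 0#) λ eq →
          *-nonZero (scalar≉0 j) a≉0 (≈-trans (≈-sym (vanish⇒ j eq)) b≈0)) ⟨
        ∑[ j < r ] K (b -ᶠ scalar j *ᶠ a)   ∎
        where
        ring₁ : ∀ x y → -ᶻ 1ℤ *ᶻ y ≡ x *ᶻ 0ℤ -ᶻ y
        ring₁ = ℤ-Solver.solve-∀
      by-cases (no a≉0) (no b≉0) = begin
        K a *ᶻ K b                          ≡⟨ cong₂ _*ᶻ_ (K-nonzero a≉0) (K-nonzero b≉0) ⟩
        1ℤ                                  ≡⟨ ring₂ (+ r) ⟩
        (1ℤ +ᶻ + r) *ᶻ 1ℤ -ᶻ + r            ≡⟨ K-differences a b unique ⟨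
        ∑[ j < r ] K (b -ᶠ scalar j *ᶠ a)   ∎
        where
        ring₂ : ∀ x → 1ℤ ≡ (1ℤ +ᶻ x) *ᶻ 1ℤ -ᶻ x
        ring₂ = ℤ-Solver.solve-∀
        a⁻¹ = proj₁ (inverse (tr a) a≉0)
        v = tr b *ᶠ a⁻¹
        v*a≈b : v *ᶠ tr a ≈ tr b
        v*a≈b = ≈-trans (*-assoc _ _ _) (≈-trans
          (*-congˡ (≈-trans (*-comm _ _) (proj₂ (inverse (tr a) a≉0)))) (*-identityʳ _))
        v≉0 : ¬ v ≈ 0#
        v≉0 v≈0 = b≉0 (≈-trans (≈-sym v*a≈b) (≈-trans (*-congʳ v≈0) (zeroˡ _)))
        a*_ : ∀ {x y} → x *ᶠ tr a ≈ y *ᶠ tr a → x ≈ y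
        a*_ eq = *-cancelˡ-nonZero a≉0 (≈-trans (*-comm _ _) (≈-trans eq (*-comm _ _)))
        -- The q-th power fixes both traces and therefore their quotient v, so `fixed⇒scalar` finds
        -- v among the scalars.
        v-fixed : v ^ᶠ q ≈ v
        v-fixed = a* (≈-trans (*-congˡ (≈-sym (tr-fixed a))) (≈-trans (≈-sym (^-distrib-* v (tr a) q))
          (≈-trans (^-congˡ q v*a≈b) (≈-trans (tr-fixed b) (≈-sym v*a≈b)))))
        unique : ∑[ j < r ] ι (tr (b -ᶠ scalar j *ᶠ a) ≈? 0#) ≡ 1ℤ
        unique = let j , j<r , v≈s = fixed⇒scalar v v≉0 v-fixed in trans
          (sum-single r {λ j → ι (tr (b -ᶠ scalar j *ᶠ a) ≈? 0#)} j j<r λ i i<r i≢j →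
            ι-no (tr (b -ᶠ scalar i *ᶠ a) ≈? 0#) λ eq → i≢j (scalar-injective i<r j<r
              (≈-trans (a* (≈-trans (≈-sym (vanish⇒ i eq)) (≈-sym v*a≈b))) v≈s)))
          (ι-yes (tr (b -ᶠ scalar j *ᶠ a) ≈? 0#) (⇒vanish j (≈-trans (≈-sym v*a≈b) (*-congʳ v≈s))))

    -- Averaging over the translations by F_q* u with Tr u ≠ 0.
    sum-K : ℤ-Sum.sum (λ i → K (enum i)) ≡ 0ℤ
    sum-K = ℤₚ.*-cancelˡ-≡ (+ q) T 0ℤ (begin
      + q *ᶻ T                      ≡⟨ ℤₚ.suc-* (+ r) T ⟩
      T +ᶻ + r *ᶻ T                 ≡⟨ cong (T +ᶻ_) average ⟩
      T +ᶻ -ᶻ T                     ≡⟨ ℤₚ.+-inverseʳ T ⟩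
      0ℤ                            ≡⟨ ℤₚ.*-zeroʳ (+ q) ⟨
      + q *ᶻ 0ℤ                     ∎)
      where
      open ≡-Reasoning
      T = ℤ-Sum.sum (λ i → K (enum i))
      u = proj₁ tr-nonzero
      shifted : ℕ → Fin size → ℤ
      shifted j i = K (-ᶠ (scalar j *ᶠ u) +ᶠ enum i)
      pointwise : ∀ i → ∑[ j < r ] shifted j i ≡ -ᶻ K (enum i)
      pointwise i = begin
        ∑[ j < r ] shifted j i                    ≡⟨ sum-cong r (λ j → K-cong (+-comm _ _)) ⟩
        ∑[ j < r ] K (enum i -ᶠ scalar j *ᶠ u)    ≡⟨ K-product u (enum i) ⟨
        K u *ᶻ K (enum i)                         ≡⟨ cong (_*ᶻ K (enum i)) (K-nonzero (proj₂ tr-nonzero)) ⟩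
        -ᶻ 1ℤ *ᶻ K (enum i)                       ≡⟨ ℤₚ.-1*i≡-i (K (enum i)) ⟩
        -ᶻ K (enum i)                             ∎
      average : + r *ᶻ T ≡ -ᶻ T
      average = begin
        + r *ᶻ T                                   ≡⟨ sum-const r T ⟨
        ∑[ j < r ] T                               ≡⟨ sum-cong r (λ j → sym (ℤSumOver.sum-translate (-ᶠ (scalar j *ᶠ u)) K K-cong)) ⟩
        ∑[ j < r ] ℤ-Sum.sum (shifted j)           ≡⟨ sum-swap-Fin r shifted ⟩
        ℤ-Sum.sum (λ i → ∑[ j < r ] shifted j i)   ≡⟨ ℤ-Sum.sum-cong-≋ pointwise ⟩
        ℤ-Sum.sum (λ i → -ᶻ K (enum i))            ≡⟨ ℤ-Group.inverseˡ-unique _ _ (trans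
            (sym (ℤ-Sum.∑-distrib-+ (λ i → -ᶻ K (enum i)) (λ i → K (enum i))))
            (trans (ℤ-Sum.sum-cong-≋ (λ i → ℤₚ.+-inverseˡ (K (enum i)))) (ℤ-Sum.sum-replicate-zero size))) ⟩
        -ᶻ T                                       ∎

    κ : ℕ → ℤ
    κ k = K (g ^ᶠ k)

    κ-periodic : Periodic Q κ
    κ-periodic k = trans (K-cong (≈-trans (^-homo-* g k Q)
      (≈-trans (*-comm _ _) (*-congʳ (^-congʳ g (sym (ℕₚ.*-identityˡ Q))))))) (K-scalar 1 (g ^ᶠ k))

    κ-periodicN : Periodic N κ
    κ-periodicN = periodic-∣ (divides r N≡r*Q) κ-periodic

    sum-κ : sumTo N κ ≡ -ᶻ (+ r)
    sum-κ = ℤ-Group.inverseʳ-unique (+ r) (sumTo N κ) (trans (cong (_+ᶻ sumTo N κ) (sym (K-zero tr-0)))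
      (trans (sym (sum-log size≡ ord K K-cong)) sum-K))

    private
      L : Carrier → ℤ
      L y = ∑[ z < N ] K (g ^ᶠ z *ᶠ y)

      L-zero : ∀ {y} → y ≈ 0# → L y ≡ + N *ᶻ + r
      L-zero y≈0 = trans (sum-cong N λ z → K-zero (≈-trans (tr-cong (≈-trans (*-congˡ y≈0) (zeroʳ _))) tr-0))
        (sum-const N (+ r))

      L-nonzero : ∀ {y} → ¬ y ≈ 0# → L y ≡ -ᶻ (+ r)
      L-nonzero {y} y≉0 = let i , _ , y≈g^i = discrete-log size≡ ord y y≉0 in trans
        (sum-cong N λ z → K-cong (≈-trans (*-congˡ y≈g^i) (≈-sym (^-homo-* g z i))))
        (trans (sum-shift κ-periodicN i) sum-κ)

      L-power : ∀ t → t < N → L (g ^ᶠ t -ᶠ 1#) ≡ -ᶻ (+ r) +ᶻ + suc N *ᶻ + r *ᶻ ι (t ℕₚ.≟ 0)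
      L-power zero t<N = trans (L-zero (-‿inverseʳ 1#)) (ring₁ (+ N) (+ r))
        where
        ring₁ : ∀ n r → n *ᶻ r ≡ -ᶻ r +ᶻ (1ℤ +ᶻ n) *ᶻ r *ᶻ 1ℤ
        ring₁ = ℤ-Solver.solve-∀
      L-power (suc t) t<N = trans (L-nonzero λ eq → contradiction (^-injective t<N positive (x-y≈0⇒x≈y _ _ eq)) λ ())
        (ring₁ (+ suc N) (+ r))
        where
        ring₁ : ∀ n r → -ᶻ r ≡ -ᶻ r +ᶻ n *ᶻ r *ᶻ 0ℤ
        ring₁ = ℤ-Solver.solve-∀

      *-distribˡ-difference : ∀ a b c → a *ᶠ b -ᶠ a *ᶠ c ≈ a *ᶠ (b -ᶠ c)
      *-distribˡ-difference a b c = ≈-trans (+-congˡ (-‿distribʳ-* a c)) (≈-sym (distribˡ a b (-ᶠ c)))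

      factor-scalar : ∀ z t j →
        g ^ᶠ z *ᶠ (g ^ᶠ (t + j * Q) -ᶠ scalar j) ≈ scalar j *ᶠ (g ^ᶠ z *ᶠ (g ^ᶠ t -ᶠ 1#))
      factor-scalar z t j = begin
        g ^ᶠ z *ᶠ (g ^ᶠ (t + j * Q) -ᶠ scalar j)
          ≈⟨ *-congˡ (+-cong (≈-trans (^-homo-* g t (j * Q)) (*-comm _ _)) (-‿cong (≈-sym (*-identityʳ _)))) ⟩
        g ^ᶠ z *ᶠ (scalar j *ᶠ g ^ᶠ t -ᶠ scalar j *ᶠ 1#)
          ≈⟨ *-congˡ (*-distribˡ-difference (scalar j) (g ^ᶠ t) 1#) ⟩
        g ^ᶠ z *ᶠ (scalar j *ᶠ (g ^ᶠ t -ᶠ 1#))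
          ≈⟨ ≈-trans (≈-sym (*-assoc _ _ _)) (≈-trans (*-congʳ (*-comm _ _)) (*-assoc _ _ _)) ⟩
        scalar j *ᶠ (g ^ᶠ z *ᶠ (g ^ᶠ t -ᶠ 1#)) ∎
        where open ≈-Reasoning

    -- By `K-product` the inner sum is the sum of L(gᵗ - scalar j) over j. Shifting t by j Q, which
    -- f does not notice, replaces scalar j by 1#, so all r values of j contribute alike. L equals
    -- -r away from 0 and N r at 0, a jump of (N + 1) r that occurs only at t = 0. Hence the
    -- constants r · r (N + 1) and r · r.
    correlation : ∀ f → Periodic Q f →
      ∑[ t < N ] f t *ᶻ (∑[ z < N ] κ z *ᶻ κ (z + t)) ≡ + (r * r * suc N) *ᶻ f 0 -ᶻ + (r * r) *ᶻ sumTo N f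
    correlation f perf = begin
      ∑[ t < N ] f t *ᶻ (∑[ z < N ] κ z *ᶻ κ (z + t))
        ≡⟨ sum-cong N (λ t → trans (cong (f t *ᶻ_) (inner t)) (sym (sum-*ˡ r (f t) (λ j → L (g ^ᶠ t -ᶠ scalar j))))) ⟩
      ∑[ t < N ] ∑[ j < r ] f t *ᶻ L (g ^ᶠ t -ᶠ scalar j)
        ≡⟨ sum-swap N r (λ t j → f t *ᶻ L (g ^ᶠ t -ᶠ scalar j)) ⟩
      ∑[ j < r ] ∑[ t < N ] f t *ᶻ L (g ^ᶠ t -ᶠ scalar j)
        ≡⟨ sum-cong r unscale ⟩
      ∑[ j < r ] ∑[ t < N ] f t *ᶻ L (g ^ᶠ t -ᶠ 1#)
        ≡⟨ sum-const r _ ⟩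
      + r *ᶻ (∑[ t < N ] f t *ᶻ L (g ^ᶠ t -ᶠ 1#))
        ≡⟨ cong (+ r *ᶻ_) diagonal ⟩
      + r *ᶻ (-ᶻ (+ r) *ᶻ sumTo N f +ᶻ + suc N *ᶻ + r *ᶻ f 0)
        ≡⟨ ring₁ (+ r) (+ suc N) (f 0) (sumTo N f) ⟩
      + r *ᶻ + r *ᶻ + suc N *ᶻ f 0 -ᶻ + r *ᶻ + r *ᶻ sumTo N f
        ≡⟨ cong₂ (λ x y → x *ᶻ f 0 -ᶻ y *ᶻ sumTo N f)
             (trans (cong (_*ᶻ + suc N) (sym (ℤₚ.pos-* r r))) (sym (ℤₚ.pos-* (r * r) (suc N))))
             (sym (ℤₚ.pos-* r r)) ⟩
      + (r * r * suc N) *ᶻ f 0 -ᶻ + (r * r) *ᶻ sumTo N f ∎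
      where
      open ≡-Reasoning
      ring₁ : ∀ r n a s → r *ᶻ (-ᶻ r *ᶻ s +ᶻ n *ᶻ r *ᶻ a) ≡ r *ᶻ r *ᶻ n *ᶻ a -ᶻ r *ᶻ r *ᶻ s
      ring₁ = ℤ-Solver.solve-∀
      ring₂ : ∀ a r c e → a *ᶻ (-ᶻ r +ᶻ c *ᶻ e) ≡ -ᶻ r *ᶻ a +ᶻ c *ᶻ (a *ᶻ e)
      ring₂ = ℤ-Solver.solve-∀
      inner : ∀ t → ∑[ z < N ] κ z *ᶻ κ (z + t) ≡ ∑[ j < r ] L (g ^ᶠ t -ᶠ scalar j)
      inner t = trans
        (sum-cong N λ z → trans (K-product (g ^ᶠ z) (g ^ᶠ (z + t))) (sum-cong r λ j → K-cong
          (≈-trans (+-cong (^-homo-* g z t) (-‿cong (*-comm _ _))) (*-distribˡ-difference (g ^ᶠ z) (g ^ᶠ t) (scalar j)))))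
        (sum-swap N r (λ z j → K (g ^ᶠ z *ᶠ (g ^ᶠ t -ᶠ scalar j))))
      unscale : ∀ j → ∑[ t < N ] f t *ᶻ L (g ^ᶠ t -ᶠ scalar j) ≡ ∑[ t < N ] f t *ᶻ L (g ^ᶠ t -ᶠ 1#)
      unscale j = trans
        (sym (sum-shift {f = λ t → f t *ᶻ L (g ^ᶠ t -ᶠ scalar j)}
          (periodic-· (periodic-∣ (divides r N≡r*Q) perf) λ t → sum-cong N λ z → K-cong (*-congˡ (+-congʳ
            (≈-trans (^-homo-* g t N) (≈-trans (*-congˡ ^-order) (*-identityʳ _)))))) (j * Q)))
        (sum-cong N λ t → cong₂ _*ᶻ_ (periodic-* j perf t) (sum-cong N λ z → trans (K-cong (factor-scalar z t j))
          (K-scalar j (g ^ᶠ z *ᶠ (g ^ᶠ t -ᶠ 1#)))))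
      diagonal : ∑[ t < N ] f t *ᶻ L (g ^ᶠ t -ᶠ 1#) ≡ -ᶻ (+ r) *ᶻ sumTo N f +ᶻ + suc N *ᶻ + r *ᶻ f 0
      diagonal = begin
        ∑[ t < N ] f t *ᶻ L (g ^ᶠ t -ᶠ 1#)
          ≡⟨ sum-cong-< N (λ t t<N → trans (cong (f t *ᶻ_) (L-power t t<N))
               (ring₂ (f t) (+ r) (+ suc N *ᶻ + r) (ι (t ℕₚ.≟ 0)))) ⟩
        ∑[ t < N ] (-ᶻ (+ r) *ᶻ f t +ᶻ + suc N *ᶻ + r *ᶻ (f t *ᶻ ι (t ℕₚ.≟ 0)))
          ≡⟨ sum-linear₂ N (-ᶻ (+ r)) (+ suc N *ᶻ + r) f (λ t → f t *ᶻ ι (t ℕₚ.≟ 0)) ⟩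
        -ᶻ (+ r) *ᶻ sumTo N f +ᶻ + suc N *ᶻ + r *ᶻ (∑[ t < N ] f t *ᶻ ι (t ℕₚ.≟ 0))
          ≡⟨ cong (λ x → -ᶻ (+ r) *ᶻ sumTo N f +ᶻ + suc N *ᶻ + r *ᶻ x) (trans
               (sum-single N {λ t → f t *ᶻ ι (t ℕₚ.≟ 0)} 0 positive λ t _ t≢0 →
                 trans (cong (f t *ᶻ_) (ι-no (t ℕₚ.≟ 0) t≢0)) (ℤₚ.*-zeroʳ (f t)))
               (ℤₚ.*-identityʳ (f 0))) ⟩
        -ᶻ (+ r) *ᶻ sumTo N f +ᶻ + suc N *ᶻ + r *ᶻ f 0 ∎

    instance
      N≢0 : NonZero N
      N≢0 = >-nonZero positive

    Q∣N : Q ∣ N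
    Q∣N = divides r N≡r*Q

    -- Counting free elements

    -- Freeness is tested on the divisor d = gcd(k, m) itself, with ζ = g^(k/d).
    free⇒coprime : ∀ m k → Free F m (g ^ᶠ k) → gcd k m ≡ 1
    free⇒coprime m k (_ , free) with gcd[m,n]∣m k m
    ... | divides e k≡e*d = free (gcd k m) (g ^ᶠ e) (^-nonZero nonZero e) (gcd[m,n]∣n k m)
      (≈-trans (^-congʳ g k≡e*d) (≈-sym (^-assocʳ g e (gcd k m))))

    coprime⇒free : ∀ {m} → m ∣ N → ∀ k → gcd k m ≡ 1 → Free F m (g ^ᶠ k)
    coprime⇒free {m} m∣N k gcd≡1 = ^-nonZero nonZero k , λ d ζ ζ≉0 d∣m g^k≈ζ^d →
      gcd≡1⇒coprime gcd≡1 (d∣k ζ≉0 g^k≈ζ^d (∣.∣-trans d∣m m∣N) , d∣m)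
      where
      -- Raising to the power e = N/d turns ζᵈ into 1#, so N = e d divides e k.
      d∣k : ∀ {d ζ} → ¬ ζ ≈ 0# → g ^ᶠ k ≈ ζ ^ᶠ d → d ∣ N → d ∣ k
      d∣k {d} {ζ} ζ≉0 g^k≈ζ^d (divides e N≡e*d) =
        ∣.*-cancelˡ-∣ e {{ℕₚ.m*n≢0⇒m≢0 e {{subst NonZero N≡e*d N≢0}}}} (subst (_∣ e * k) N≡e*d (order-∣ (e * k) (begin
          g ^ᶠ (e * k)     ≈⟨ ^-congʳ g (ℕₚ.*-comm e k) ⟩
          g ^ᶠ (k * e)     ≈⟨ ^-assocʳ g k e ⟨
          (g ^ᶠ k) ^ᶠ e    ≈⟨ ^-congˡ e g^k≈ζ^d ⟩
          (ζ ^ᶠ d) ^ᶠ e    ≈⟨ ^-assocʳ ζ d e ⟩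
          ζ ^ᶠ (d * e)     ≈⟨ ^-congʳ ζ (trans (ℕₚ.*-comm d e) (sym N≡e*d)) ⟩
          ζ ^ᶠ N           ≈⟨ ^N≈1 ζ ζ≉0 ⟩
          1#               ∎)))
        where open ≈-Reasoning

    free-resp : ∀ {m x y} → x ≈ y → Free F m x → Free F m y
    free-resp x≈y (x≉0 , free) =
      (λ y≈0 → x≉0 (≈-trans x≈y y≈0)) , λ d ζ ζ≉0 d∣m y≈ζ^d → free d ζ ζ≉0 d∣m (≈-trans x≈y y≈ζ^d)

    τ : ℕ → ℤ
    τ k = ι (tr (g ^ᶠ k) ≈? 0#)

    τ-periodic : Periodic Q τ
    τ-periodic k = ℤₚ.*-cancelˡ-≡ (+ q) _ _ (ℤ-Group.∙-cancelʳ (-ᶻ 1ℤ) _ _ (κ-periodic k))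

    square≈ : ∀ k → (g ^ᶠ k) ^ᶠ 2 ≈ g ^ᶠ (k + k)
    square≈ k = ≈-trans (*-congˡ (*-identityʳ _)) (≈-sym (^-homo-* g k k))

    N₀-double : ∀ m → .{{NonZero m}} → m ∣ N → + N₀ F q n m ≡ ∑[ k < N ] coprimeTo m k *ᶻ τ (k + k)
    N₀-double m@(suc _) m∣N = begin
      + N₀ F q n m                         ≡⟨ count-tabulate (λ i → P? (enum i)) size (λ i → i) ⟩
      ℤ-Sum.sum (λ i → h (enum i))         ≡⟨ sum-log size≡ ord h h-resp ⟩
      h 0# +ᶻ (∑[ k < N ] h (g ^ᶠ k))      ≡⟨ cong₂ _+ᶻ_ (ι-no (P? 0#) λ ((0≉0 , _) , _) → 0≉0 ≈-refl) (sum-cong N power) ⟩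
      0ℤ +ᶻ (∑[ k < N ] coprimeTo m k *ᶻ τ (k + k))  ≡⟨ ℤₚ.+-identityˡ _ ⟩
      ∑[ k < N ] coprimeTo m k *ᶻ τ (k + k)          ∎
      where
      open ≡-Reasoning
      P? : ∀ x → Dec (Free F m x × tr (x ^ᶠ 2) ≈ 0#)
      P? x = free? F m x ×-dec (tr (x ^ᶠ 2) ≈? 0#)
      h : Carrier → ℤ
      h x = ι (P? x)
      transport : ∀ {x y} → x ≈ y → Free F m x × tr (x ^ᶠ 2) ≈ 0# → Free F m y × tr (y ^ᶠ 2) ≈ 0#
      transport x≈y (free , tr≈0) = free-resp x≈y free , ≈-trans (tr-cong (^-congˡ 2 (≈-sym x≈y))) tr≈0
      h-resp : ∀ {x y} → x ≈ y → h x ≡ h y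
      h-resp {x} {y} x≈y = ι-cong (transport x≈y) (transport (≈-sym x≈y)) (P? x) (P? y)
      ι-× : ∀ {a b} {A : Set a} {B : Set b} (d : Dec A) (e : Dec B) → ι (d ×-dec e) ≡ ι d *ᶻ ι e
      ι-× (yes _) (yes _) = refl
      ι-× (yes _) (no _)  = refl
      ι-× (no _)  (yes _) = refl
      ι-× (no _)  (no _)  = refl
      power : ∀ k → h (g ^ᶠ k) ≡ coprimeTo m k *ᶻ τ (k + k)
      power k = trans
        (ι-cong (λ (free , tr≈0) → free⇒coprime m k free , ≈-trans (tr-cong (≈-sym (square≈ k))) tr≈0)
                (λ (gcd≡1 , tr≈0) → coprime⇒free m∣N k gcd≡1 , ≈-trans (tr-cong (square≈ k)) tr≈0)
                (P? (g ^ᶠ k)) ((gcd k m ℕₚ.≟ 1) ×-dec (tr (g ^ᶠ (k + k)) ≈? 0#)))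
        (ι-× (gcd k m ℕₚ.≟ 1) (tr (g ^ᶠ (k + k)) ≈? 0#))

    -- The lower bound and positivity

    module OddCofactor (h : ℕ) (Q≡ : Q ≡ suc (h + h)) where

      2∤divisor : ∀ {m} → m ∣ Q → ¬ 2 ∣ m
      2∤divisor m∣Q 2∣m = contradiction
        (∣.∣1⇒≡1 (∣.∣m+n∣m⇒∣n (subst (2 ∣_) (trans Q≡ (odd h)) (∣.∣-trans 2∣m m∣Q)) (∣.m∣m*n h))) λ ()
        where
        odd : ∀ h → 1 + (h + h) ≡ 2 * h + 1
        odd = ℕ-Solver.solve-∀

      -- Both factors depend on the exponent modulo Q only, and doubling permutes the residues
      -- modulo the odd number Q; since m is odd too, `coprimeTo m` does not distinguish k from 2k.
      N₀-sum : ∀ m → .{{NonZero m}} → m ∣ Q → + N₀ F q n m ≡ ∑[ k < N ] coprimeTo m k *ᶻ τ k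
      N₀-sum m m∣Q = begin
        + N₀ F q n m                                     ≡⟨ N₀-double m (∣.∣-trans m∣Q Q∣N) ⟩
        ∑[ k < N ] coprimeTo m k *ᶻ τ (k + k)            ≡⟨ sum-cong N (λ k → cong (_*ᶻ τ (k + k)) (sym (coprimeTo-double (2∤divisor m∣Q) k))) ⟩
        ∑[ k < N ] coprimeTo m (k + k) *ᶻ τ (k + k)
          ≡⟨ sum-dilate₂ {f = w} r h (trans N≡r*Q (cong (r *_) Q≡)) (subst (λ Q → Periodic Q w) Q≡
               (periodic-· (periodic-∣ m∣Q (coprimeTo-periodic m)) τ-periodic)) ⟩
        ∑[ k < N ] coprimeTo m k *ᶻ τ k                  ∎
        where
        open ≡-Reasoning
        w : ℕ → ℤ
        w k = coprimeTo m k *ᶻ τ k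

      -- Its square root is (q - 1) q^(n/2): a nontrivial character of order dividing Q pairs with κ
      -- to q - 1 times its Gauss sum.
      B : ℕ
      B = r * r * suc N

      open Spectral N Q Q∣N κ κ-periodicN B (r * r) correlation using (Λ; Λ-sieve)

      Λ-bounded : ∀ {m} → m ∣ Q → Bounded B (Λ (sieve (primesOf m))) (totient (primesOf m) * W m)
      Λ-bounded {m} m∣Q = subst (λ x → Bounded B x (totient (primesOf m) * W m))
        (sum-cong N λ i → cong (κ i *ᶻ_) (ℤₚ.*-identityˡ (sieve (primesOf m) i)))
        (subst (Bounded B _) (cong (_* W m) (ℕₚ.*-identityˡ (totient (primesOf m))))
          (Λ-sieve {f = λ _ → 1ℤ} (primesOf-independent m∣Q) (λ _ → refl) (λ _ → refl) (λ k → sum-const N 1ℤ) refl))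

      -- Substitute κ = q τ - 1: the part with τ counts the m-free exponents of trace zero, the
      -- constant part all e φ(m) of the m-free exponents below N = e m.
      Λ-value : ∀ m → .{{NonZero m}} → m ∣ Q → ∀ e → N ≡ e * m →
        Λ (sieve (primesOf m)) ≡ + product (primesOf m) *ᶻ (+ q *ᶻ + N₀ F q n m -ᶻ + e *ᶻ + φ m)
      Λ-value m m∣Q e N≡e*m = begin
        ∑[ k < N ] κ k *ᶻ sieve (primesOf m) k
          ≡⟨ sum-cong N (λ k → trans (cong (κ k *ᶻ_) (sieve-coprimeTo m k)) (expand (+ q) (τ k) (+ rad) (coprimeTo m k))) ⟩
        ∑[ k < N ] (+ rad *ᶻ + q *ᶻ (coprimeTo m k *ᶻ τ k) +ᶻ -ᶻ (+ rad) *ᶻ coprimeTo m k)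
          ≡⟨ sum-linear₂ N (+ rad *ᶻ + q) (-ᶻ (+ rad)) (λ k → coprimeTo m k *ᶻ τ k) (coprimeTo m) ⟩
        + rad *ᶻ + q *ᶻ (∑[ k < N ] coprimeTo m k *ᶻ τ k) +ᶻ -ᶻ (+ rad) *ᶻ sumTo N (coprimeTo m)
          ≡⟨ cong₂ (λ x y → + rad *ᶻ + q *ᶻ x +ᶻ -ᶻ (+ rad) *ᶻ y) (sym (N₀-sum m m∣Q)) total ⟩
        + rad *ᶻ + q *ᶻ + N₀ F q n m +ᶻ -ᶻ (+ rad) *ᶻ (+ e *ᶻ + φ m)
          ≡⟨ collect (+ rad) (+ q) (+ N₀ F q n m) (+ e *ᶻ + φ m) ⟩
        + rad *ᶻ (+ q *ᶻ + N₀ F q n m -ᶻ + e *ᶻ + φ m) ∎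
        where
        open ≡-Reasoning
        rad = product (primesOf m)
        expand : ∀ q t a c → (q *ᶻ t -ᶻ 1ℤ) *ᶻ (a *ᶻ c) ≡ a *ᶻ q *ᶻ (c *ᶻ t) +ᶻ -ᶻ a *ᶻ c
        expand = ℤ-Solver.solve-∀
        collect : ∀ a q x y → a *ᶻ q *ᶻ x +ᶻ -ᶻ a *ᶻ y ≡ a *ᶻ (q *ᶻ x -ᶻ y)
        collect = ℤ-Solver.solve-∀
        total : sumTo N (coprimeTo m) ≡ + e *ᶻ + φ m
        total = trans (cong (λ N → sumTo N (coprimeTo m)) N≡e*m)
          (trans (sum-periods e (coprimeTo-periodic m)) (cong (+ e *ᶻ_) (sym (φ-sum m))))

      -- With qⁿ = 1 + e m, the quantity to be bounded, times the radical, is m (X - D): D is the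
      -- value of Λ at the sieve, and X is what the summand 1 leaves behind. As B ≥ 1, X is at most
      -- X √B, while |D| is at most X W(m) √B; finally 1 + W(m) ≤ 2 W(m).
      deviation-bounded : ∀ m → .{{NonZero m}} → m ∣ Q →
        Bounded B (+ q *ᶻ (+ (φ m * q ^ l) -ᶻ + (m * N₀ F q n m))) (2 * φ m * W m)
      deviation-bounded m m∣Q with ∣.∣-trans m∣Q Q∣N
      ... | divides e N≡e*m = bounded-weaken φ[1+W]≤2φW (bounded-cancel rad {{product≢0 m}}
        (subst₂ (Bounded B) (sym identity) coefficient (bounded-scale m (bounded-+ X-bounded (bounded-neg (Λ-bounded m∣Q))))))
        where
        rad = product (primesOf m)
        X = totient (primesOf m)
        D = Λ (sieve (primesOf m))
        n₀ = N₀ F q n m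
        instance
          W≢0 : NonZero (W m)
          W≢0 = ℕₚ.m^n≢0 2 (ν m)
        φ[1+W]≤2φW : φ m * (1 + W m) ≤ 2 * φ m * W m
        φ[1+W]≤2φW = subst (φ m * (1 + W m) ≤_) (rearrange (φ m) (W m))
          (ℕₚ.*-monoʳ-≤ (φ m) (ℕₚ.+-monoˡ-≤ (W m) (>-nonZero⁻¹ (W m))))
          where
          rearrange : ∀ f w → f * (w + w) ≡ 2 * f * w
          rearrange = ℕ-Solver.solve-∀
        coefficient : m * (X + X * W m) ≡ rad * (φ m * (1 + W m))
        coefficient = trans (left m X (W m)) (trans (cong (_* (1 + W m)) (sym (product*φ m))) (ℕₚ.*-assoc rad (φ m) (1 + W m)))
          where
          left : ∀ m x w → m * (x + x * w) ≡ x * m * (1 + w)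
          left = ℕ-Solver.solve-∀
        X-bounded : Bounded B (+ X) X
        X-bounded = bounded (ℕₚ.m≤m*n (X * X) B {{ℕₚ.m*n≢0 (r * r) (suc N) {{ℕₚ.m*n≢0 r r}}}})
        q*q^l : + q *ᶻ + (q ^ l) ≡ 1ℤ +ᶻ + e *ᶻ + m
        q*q^l = trans (sym (ℤₚ.pos-* q (q ^ l))) (trans (cong +_ (sym 1+N≡))
          (cong (1ℤ +ᶻ_) (trans (cong +_ N≡e*m) (ℤₚ.pos-* e m))))
        rad*φ : + rad *ᶻ + φ m ≡ + X *ᶻ + m
        rad*φ = trans (sym (ℤₚ.pos-* rad (φ m))) (trans (cong +_ (product*φ m)) (ℤₚ.pos-* X m))
        identity : + rad *ᶻ (+ q *ᶻ (+ (φ m * q ^ l) -ᶻ + (m * n₀))) ≡ + m *ᶻ (+ X +ᶻ -ᶻ D)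
        identity = begin
          + rad *ᶻ (+ q *ᶻ (+ (φ m * q ^ l) -ᶻ + (m * n₀)))
            ≡⟨ cong₂ (λ x y → + rad *ᶻ (+ q *ᶻ (x -ᶻ y))) (ℤₚ.pos-* (φ m) (q ^ l)) (ℤₚ.pos-* m n₀) ⟩
          + rad *ᶻ (+ q *ᶻ (+ φ m *ᶻ + (q ^ l) -ᶻ + m *ᶻ + n₀))
            ≡⟨ ring₁ (+ rad) (+ q) (+ φ m) (+ (q ^ l)) (+ m) (+ n₀) ⟩
          (+ rad *ᶻ + φ m) *ᶻ (+ q *ᶻ + (q ^ l)) -ᶻ + rad *ᶻ + q *ᶻ (+ m *ᶻ + n₀)
            ≡⟨ cong (λ x → (+ rad *ᶻ + φ m) *ᶻ x -ᶻ + rad *ᶻ + q *ᶻ (+ m *ᶻ + n₀)) q*q^l ⟩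
          (+ rad *ᶻ + φ m) *ᶻ (1ℤ +ᶻ + e *ᶻ + m) -ᶻ + rad *ᶻ + q *ᶻ (+ m *ᶻ + n₀)
            ≡⟨ ring₂ (+ rad) (+ φ m) (+ e) (+ m) (+ q) (+ n₀) ⟩
          (+ rad *ᶻ + φ m) +ᶻ -ᶻ (+ m *ᶻ (+ rad *ᶻ (+ q *ᶻ + n₀ -ᶻ + e *ᶻ + φ m)))
            ≡⟨ cong₂ (λ x y → x +ᶻ -ᶻ (+ m *ᶻ y)) rad*φ (sym (Λ-value m m∣Q e N≡e*m)) ⟩
          + X *ᶻ + m +ᶻ -ᶻ (+ m *ᶻ D)
            ≡⟨ ring₃ (+ X) (+ m) D ⟩
          + m *ᶻ (+ X +ᶻ -ᶻ D) ∎
          where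
          open ≡-Reasoning
          ring₁ : ∀ a q f p m x → a *ᶻ (q *ᶻ (f *ᶻ p -ᶻ m *ᶻ x)) ≡ (a *ᶻ f) *ᶻ (q *ᶻ p) -ᶻ a *ᶻ q *ᶻ (m *ᶻ x)
          ring₁ = ℤ-Solver.solve-∀
          ring₂ : ∀ a f e m q x → (a *ᶻ f) *ᶻ (1ℤ +ᶻ e *ᶻ m) -ᶻ a *ᶻ q *ᶻ (m *ᶻ x) ≡
            (a *ᶻ f) +ᶻ -ᶻ (m *ᶻ (a *ᶻ (q *ᶻ x -ᶻ e *ᶻ f)))
          ring₂ = ℤ-Solver.solve-∀
          ring₃ : ∀ x m d → x *ᶻ m +ᶻ -ᶻ (m *ᶻ d) ≡ m *ᶻ (x +ᶻ -ᶻ d)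
          ring₃ = ℤ-Solver.solve-∀

      -- This is the bound on N₀ multiplied by q m, with N₀ moved to the other side and both sides
      -- squared to remove q^(n/2). When the difference would be negative, truncation makes the left
      -- side 0, in accordance with a bound that then holds trivially.
      lower-bound : ∀ m → m ∣ Q → q ^ 2 * (φ m * q ^ l ∸ m * N₀ F q n m) ^ 2 ≤ (2 * φ m * W m * r) ^ 2 * q ^ n
      lower-bound m m∣Q = begin
        q ^ 2 * y ^ 2                       ≡⟨ squares q y ⟩
        (q * y) * (q * y)                   ≤⟨ ℕₚ.*-mono-≤ q*y≤ q*y≤ ⟩
        abs z * abs z                       ≤⟨ Bounded.square≤ (deviation-bounded m m∣Q) ⟩
        2 * φ m * W m * (2 * φ m * W m) * (r * r * suc N)  ≡⟨ regroup (2 * φ m * W m) r (suc N) ⟩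
        (2 * φ m * W m * r) ^ 2 * suc N     ≡⟨ cong ((2 * φ m * W m * r) ^ 2 *_) 1+N≡ ⟩
        (2 * φ m * W m * r) ^ 2 * q ^ n     ∎
        where
        open ℕₚ.≤-Reasoning
        instance
          m≢0 : NonZero m
          m≢0 = ≢-nonZero λ { refl → ≢-nonZero⁻¹ Q (∣.0∣⇒≡0 m∣Q) }
        y = φ m * q ^ l ∸ m * N₀ F q n m
        z = + q *ᶻ (+ (φ m * q ^ l) -ᶻ + (m * N₀ F q n m))
        q*y≤ : q * y ≤ abs z
        q*y≤ = subst (q * y ≤_) (sym (ℤₚ.abs-* (+ q) (+ (φ m * q ^ l) -ᶻ + (m * N₀ F q n m))))
          (ℕₚ.*-monoʳ-≤ q (m∸n≤∣m-n∣ (φ m * q ^ l) (m * N₀ F q n m)))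
        squares : ∀ q y → q * (q * 1) * (y * (y * 1)) ≡ (q * y) * (q * y)
        squares = ℕ-Solver.solve-∀
        regroup : ∀ a r s → a * a * (r * r * s) ≡ a * r * (a * r * 1) * s
        regroup = ℕ-Solver.solve-∀

      -- For N₀ = 0 the lower bound reads φ(Q)² q²ⁿ ≤ φ(Q)² (2 W(Q) (q - 1))² qⁿ, where φ(Q)² qⁿ
      -- cancels.
      N₀-Q>0 : (2 * W Q * r) ^ 2 < q ^ n → N₀ F q n Q ≢ 0
      N₀-Q>0 small N₀≡0 = ℕₚ.<⇒≱
        (ℕₚ.*-monoˡ-< (q ^ n) {{ℕₚ.m^n≢0 q n}}
          (ℕₚ.*-monoʳ-< (φ Q ^ 2) {{ℕₚ.m^n≢0 (φ Q) 2 {{>-nonZero (φ>0 Q)}}}} small)) (begin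
        φ Q ^ 2 * q ^ n * q ^ n                                     ≡⟨ squares (φ Q) q (q ^ l) ⟩
        q ^ 2 * (φ Q * q ^ l ∸ 0) ^ 2
          ≡⟨ cong (λ x → q ^ 2 * (φ Q * q ^ l ∸ x) ^ 2) (trans (cong (Q *_) N₀≡0) (ℕₚ.*-zeroʳ Q)) ⟨
        q ^ 2 * (φ Q * q ^ l ∸ Q * N₀ F q n Q) ^ 2                  ≤⟨ lower-bound Q ∣.∣-refl ⟩
        (2 * φ Q * W Q * r) ^ 2 * q ^ n                             ≡⟨ cong (_* q ^ n) (regroup (φ Q) (W Q) r) ⟩
        φ Q ^ 2 * (2 * W Q * r) ^ 2 * q ^ n                         ∎)
        where
        open ℕₚ.≤-Reasoning
        squares : ∀ f q p → f * (f * 1) * (q * p) * (q * p) ≡ q * (q * 1) * (f * p * (f * p * 1))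
        squares = ℕ-Solver.solve-∀
        regroup : ∀ f w r → 2 * f * w * r * (2 * f * w * r * 1) ≡ f * (f * 1) * (2 * w * r * (2 * w * r * 1))
        regroup = ℕ-Solver.solve-∀

      -- A nonzero summand provides k prime to Q with Tr g²ᵏ = 0. Passing to k + jQ prime to N
      -- multiplies g²ᵏ by `scalar (j + j)`, which comes out of the trace.
      N₀-N>0 : N₀ F q n Q ≢ 0 → 0 < N₀ F q n N
      N₀-N>0 N₀≢0 = from-exponent (sum≢0⇒∃≢0 N (λ k → coprimeTo Q k *ᶻ τ (k + k))
        λ sum≡0 → N₀≢0 (ℤₚ.+-injective (trans (N₀-double Q Q∣N) sum≡0)))
        where
        ι≢0 : ∀ {p} {P : Set p} (d : Dec P) → ι d ≢ 0ℤ → P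
        ι≢0 (yes p) _   = p
        ι≢0 (no _)  0≢0 = contradiction refl 0≢0
        N₀>0 : ∀ m → .{{NonZero m}} → ∀ x → Free F m x → tr (x ^ᶠ 2) ≈ 0# → 0 < N₀ F q n m
        N₀>0 m@(suc _) x free tr≈0 = ∈-length (∈-filter⁺ (λ i → free? F m (enum i) ×-dec (Tr F q n (enum i ^ᶠ 2) ≈? 0#))
          (∈-allFin (index x)) (free-resp (≈-sym (enum-index x)) free , ≈-trans (tr-cong (^-congˡ 2 (enum-index x))) tr≈0))
        double : ∀ k j Q → (k + j * Q) + (k + j * Q) ≡ (j + j) * Q + (k + k)
        double = ℕ-Solver.solve-∀
        from-exponent : (∃ λ k → coprimeTo Q k *ᶻ τ (k + k) ≢ 0ℤ) → 0 < N₀ F q n N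
        from-exponent (k , ≢0) = N₀>0 N (g ^ᶠ (k + j * Q)) (coprime⇒free ∣.∣-refl (k + j * Q) (proj₂ lift)) (begin
          tr ((g ^ᶠ (k + j * Q)) ^ᶠ 2)              ≈⟨ tr-cong (square≈ (k + j * Q)) ⟩
          tr (g ^ᶠ ((k + j * Q) + (k + j * Q)))     ≈⟨ tr-cong (^-congʳ g (double k j Q)) ⟩
          tr (g ^ᶠ ((j + j) * Q + (k + k)))         ≈⟨ tr-cong (^-homo-* g ((j + j) * Q) (k + k)) ⟩
          tr (scalar (j + j) *ᶠ g ^ᶠ (k + k))       ≈⟨ tr-scalar (j + j) (g ^ᶠ (k + k)) ⟩
          scalar (j + j) *ᶠ tr (g ^ᶠ (k + k))       ≈⟨ *-congˡ tr≈0 ⟩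
          scalar (j + j) *ᶠ 0#                      ≈⟨ zeroʳ _ ⟩
          0#                                        ∎)
          where
          open ≈-Reasoning
          gcd≡1 : gcd k Q ≡ 1
          gcd≡1 = ι≢0 (gcd k Q ℕₚ.≟ 1) λ eq → ≢0 (trans (cong (_*ᶻ τ (k + k)) eq) (ℤₚ.*-zeroˡ (τ (k + k))))
          tr≈0 : tr (g ^ᶠ (k + k)) ≈ 0#
          tr≈0 = ι≢0 (tr (g ^ᶠ (k + k)) ≈? 0#) λ eq → ≢0 (trans (cong (coprimeTo Q k *ᶻ_) eq) (ℤₚ.*-zeroʳ (coprimeTo Q k)))
          lift = coprime-lift {k} {Q} N (gcd≡1⇒coprime gcd≡1)
          j = proj₁ lift

theorem5p5 : ∀ {c ℓ : Level} (F : FiniteField c ℓ) (q n : ℕ) →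
    IsPrimePower q → ¬ (2 ∣ q) →
    Prime n → ¬ (2 ∣ n) →
    2 ∣ ((q ^ n ∸ 1) / 2) →
    FiniteField.size F ≡ q ^ n →
    (∀ (m : ℕ) → m ∣ Q q n →
    q ^ 2 * (φ m * q ^ (n ∸ 1) ∸ m * N₀ F q n m) ^ 2
    ≤ (2 * φ m * W m * (q ∸ 1)) ^ 2 * q ^ n)
    × ((2 * W (Q q n) * (q ∸ 1)) ^ 2 < q ^ n → 0 < N₀ F q n (q ^ n ∸ 1))
-- The degenerate values are excluded: 0 is even, for q as for n, and 1 is not a positive power of a
-- prime.
theorem5p5 F zero n _ 2∤q = contradiction (2 ∣.∣0) 2∤q
theorem5p5 F (suc zero) n (p , k , pr , 1≤k , 1≡p^k) =
  contradiction 1≡p^k (ℕₚ.<⇒≢ (ℕₚ.^-monoʳ-< p (prime>1 pr) 1≤k))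
theorem5p5 F (suc (suc _)) zero _ _ _ 2∤n = contradiction (2 ∣.∣0) 2∤n
theorem5p5 F q@(suc r@(suc k)) n@(suc l) (p , i , pr , _ , q≡p^i) 2∤q _ 2∤n _ size≡q^n =
  lower-bound , λ small → N₀-N>0 (N₀-Q>0 small)
  where
  open FieldTheory F
  N = q ^ n ∸ 1
  1+N≡ : suc N ≡ q ^ n
  1+N≡ = ℕₚ.m+[n∸m]≡n (ℕₚ.m^n>0 q n)
  size≡ : FiniteField.size F ≡ suc N
  size≡ = trans size≡q^n (sym 1+N≡)
  -- The field has p^(i n) elements, so p · 1# vanishes and the p-th power is additive; the q-th
  -- power is its i-fold iterate.
  additive : Additive q
  additive = subst Additive (sym q≡p^i) (additive-^ {p} (frobenius pr (characteristic (i * n)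
    (trans size≡q^n (trans (cong (_^ n) q≡p^i) (ℕₚ.^-*-assoc p i n))))) i)
  N≡r*Q : N ≡ r * Q q n
  N≡r*Q = trans (cong (_∸ 1) (sym (geometric-sum r n)))
    (trans (ℕₚ.*-comm (geometric q n) r) (cong (r *_) (sym (Q≡geometric k n))))
  odd : ∃ λ h → Q q n ≡ suc (h + h)
  odd = odd-form (Q q n) (subst (λ x → ¬ 2 ∣ x) (sym (Q≡geometric k n)) (odd-geometric 2∤q 2∤n))
  root : ∃ λ g → HasOrder g N
  root = primitive-root size≡
  open TraceForm r l N (Q q n) z<s additive size≡ 1+N≡ N≡r*Q (proj₁ root) (proj₂ root)
  open OddCofactor (proj₁ odd) (proj₂ odd)
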